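{- Let $X$ be a flag simplicial complex triangulating $S^5$. Assume $X$ has an edge $\eta$ whose link $\mathrm{Lk}_\eta$ is a cross-polytope, and that $h_X(-1)<0$ (equivalently, the coefficient of $t^3$ in $\gamma_X$ is positive). Then for every sufficiently large natural number $m$, the h-polynomial of the $m$-fold subdivision $\mathrm{Sub}^m_\eta(X)$ has a non-real root.
   Context: Simplicial complexes contain the empty face; $\#\sigma$ is the number of vertices of $\sigma$. Link: $\mathrm{Lk}_\sigma=\{\tau\in X:\sigma\cup\tau\in X,\ \sigma\cap\tau=\emptyset\}$. Flag: every set of pairwise adjacent vertices is a face. The join of complexes $X,Y$ on disjoint vertex sets is $\{\sigma\cup\tau:\sigma\in X,\tau\in Y\}$; the $k$-dimensional cross-polytope is the $(k+1)$-fold join of the complex consisting of two vertices and no edge. f-polynomial: $f_X(t)=\sum_{\sigma\in X}t^{\#\sigma}$; for $X$ a triangulation of $S^{n-1}$, $h_X$ is defined by $(1+t)^n h_X(\frac1{1+t})=t^nf_X(\frac1t)$, and $\gamma_X$ is the unique polynomial with $h_X(t)=(1+t)^{n}\gamma_X\!\left(\frac{t}{(1+t)^2}\right)$. Edge subdivision: for an edge $\eta=\{s,t\}$ of $X$ and a new vertex $e$, $\mathrm{Sub}_\eta(X)=\{\sigma:\eta\not\subset\sigma\in X\}\cup\{\sigma\cup\{e\},\sigma\cup\{s,e\},\sigma\cup\{t,e\}:\sigma\in\mathrm{Lk}_\eta\}$. The $m$-fold subdivision $\mathrm{Sub}^m_\eta(X)$ is obtained by $m$ successive edge subdivisions, the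 first along $\eta$ and each subsequent one along an edge joining the most recently added vertex to an endpoint of the previously subdivided edge (such an edge has link equal to $\mathrm{Lk}_\eta$). -}

module Defs where

open import Algebra.Bundles.Raw using (RawRing)
import Data.Bool.Properties as Bool
open import Data.Empty using (⊥-elim)
open import Data.Fin.Base using (Fin; zero; suc)
import Data.Fin.Properties as Fin
open import Data.Fin.Subset
  using (Subset; inside; outside; _∈_; _⊆_; _∪_; _∩_; ⊥; ⁅_⁆; ∣_∣)
open import Data.Fin.Subset.Properties
  using (_∈?_; _⊆?_; ⊆-antisym; ⊆-trans; ⊆-min; p∩q⊆p; p∩q⊆q; x∈p∩q⁺; x∈p∪q⁻;
         x∈p∪q⁺; x∈⁅x⁆; x∈⁅y⁆⇒x≡y; ∉⊥; anySubset?; ∪-identityʳ; ∩-zeroʳ; drop-∷-⊆)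
open import Data.Integer.Base using (ℤ; 0ℤ; 1ℤ)
import Data.Integer.Base as ℤ
open import Data.List.Base using (List; []; _∷_; [_]; _++_; foldr; map; filter)
open import Data.Nat.Base as ℕ using (ℕ; zero; suc; _⊔_)
import Data.Nat.Properties as ℕ
open import Data.Product.Base using (Σ; ∃; _×_; _,_; proj₁; proj₂)
open import Data.Rational.Base as ℚ using (ℚ; 0ℚ; 1ℚ; ½; 1/_; NonZero)
import Data.Rational.Properties as ℚ
open import Data.Rational.Solver using (module +-*-Solver)
open import Data.Sum.Base using (_⊎_; inj₁; inj₂)
open import Data.Vec.Base using ([]; _∷_; here; there; take; drop; tabulate)
import Data.Vec.Properties as Vec
open import Data.Vec.Functional using (Vector)
import Data.Vec.Functional as Vector
open import Function.Base using (id)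
open import Function.Bundles using (_⇔_)
open import Function.Definitions using (Injective)
open import Level using (0ℓ)
open import Relation.Binary.PropositionalEquality
  using (_≡_; _≢_; refl; sym; trans; cong; subst)
open import Relation.Nullary using (¬_; Dec; yes; no; does; ¬?)
open import Relation.Nullary.Decidable using (_×-dec_; _⊎-dec_)
open import Relation.Unary using (Pred; Decidable)

open import Algebra.Definitions.RawSemiring ℚ.+-*-rawSemiring using (_^_)

------------------------------------------------------------------------
-- Real numbers: Cauchy sequences of rationals, compared by the setoid
-- equality _≈ᴿ_.

infix 4 _≈ᴿ_ _<ᴿ_ _≤ᴿ_ _≈ᶜ_
infixl 6 _+ᴿ_ _+ᶜ_
infixl 7 _*ᴿ_ _*ᶜ_
infix 8 -ᴿ_ -ᶜ_

record ℝ : Set where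
  constructor mkℝ
  field
    seq    : ℕ → ℚ
    cauchy : ∀ ε → 0ℚ ℚ.< ε → ∃ λ N → ∀ m n → N ℕ.≤ m → N ℕ.≤ n →
             ℚ.∣ seq m ℚ.- seq n ∣ ℚ.< ε

open ℝ public

_≈ᴿ_ : ℝ → ℝ → Set
x ≈ᴿ y = ∀ ε → 0ℚ ℚ.< ε → ∃ λ N → ∀ n → N ℕ.≤ n → ℚ.∣ seq x n ℚ.- seq y n ∣ ℚ.< ε

_<ᴿ_ : ℝ → ℝ → Set
x <ᴿ y = ∃ λ ε → 0ℚ ℚ.< ε × ∃ λ N → ∀ n → N ℕ.≤ n → seq x n ℚ.+ ε ℚ.≤ seq y n

_≤ᴿ_ : ℝ → ℝ → Set
x ≤ᴿ y = ¬ (y <ᴿ x)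

fromℚ : ℚ → ℝ
fromℚ q = mkℝ (λ _ → q) λ ε 0<ε → 0 , λ _ _ _ _ →
  subst (ℚ._< ε) (sym (cong ℚ.∣_∣ (ℚ.+-inverseʳ q))) 0<ε

0ᴿ 1ᴿ : ℝ
0ᴿ = fromℚ 0ℚ
1ᴿ = fromℚ 1ℚ

private
  halve : ∀ {ε} → 0ℚ ℚ.< ε → 0ℚ ℚ.< ½ ℚ.* ε
  halve {ε} 0<ε = ℚ.positive⁻¹ (½ ℚ.* ε) {{ℚ.pos*pos⇒pos ½ ε {{ℚ.positive 0<ε}}}}

  halves : ∀ ε → ½ ℚ.* ε ℚ.+ ½ ℚ.* ε ≡ ε
  halves ε = trans (sym (ℚ.*-distribʳ-+ ε ½ ½)) (ℚ.*-identityˡ ε)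

  +-diff : ∀ a b c d → (a ℚ.+ b) ℚ.- (c ℚ.+ d) ≡ (a ℚ.- c) ℚ.+ (b ℚ.- d)
  +-diff = solve 4 (λ a b c d → (a :+ b) :- (c :+ d) := (a :- c) :+ (b :- d)) refl
    where open +-*-Solver

  neg-diff : ∀ a b → (ℚ.- a) ℚ.- (ℚ.- b) ≡ ℚ.- (a ℚ.- b)
  neg-diff = solve 2 (λ a b → (:- a) :- (:- b) := :- (a :- b)) refl
    where open +-*-Solver

  *-diff : ∀ a b c d → a ℚ.* b ℚ.- c ℚ.* d ≡ a ℚ.* (b ℚ.- d) ℚ.+ d ℚ.* (a ℚ.- c)
  *-diff = solve 4 (λ a b c d → a :* b :- c :* d := a :* (b :- d) :+ d :* (a :- c)) refl
    where open +-*-Solver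

  split : ∀ a b → a ≡ b ℚ.+ (a ℚ.- b)
  split = solve 2 (λ a b → a := b :+ (a :- b)) refl
    where open +-*-Solver

  Bounded : (ℕ → ℚ) → Set
  Bounded u = ∃ λ K → 0ℚ ℚ.< K × ∃ λ N → ∀ n → N ℕ.≤ n → ℚ.∣ u n ∣ ℚ.≤ K

  bounded : ∀ x → Bounded (seq x)
  bounded x with cauchy x 1ℚ (ℚ.positive⁻¹ 1ℚ)
  ... | N , close = K , 0<K , N , bound
    where
    K = ℚ.∣ seq x N ∣ ℚ.+ 1ℚ
    0<K : 0ℚ ℚ.< K
    0<K = ℚ.positive⁻¹ K
      {{ℚ.nonNeg+pos⇒pos ℚ.∣ seq x N ∣ {{ℚ.∣-∣-nonNeg (seq x N)}} 1ℚ}}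
    bound : ∀ n → N ℕ.≤ n → ℚ.∣ seq x n ∣ ℚ.≤ K
    bound n N≤n = ℚ.≤-trans
      (ℚ.≤-reflexive (cong ℚ.∣_∣ (split (seq x n) (seq x N))))
      (ℚ.≤-trans (ℚ.∣p+q∣≤∣p∣+∣q∣ (seq x N) (seq x n ℚ.- seq x N))
        (ℚ.+-monoʳ-≤ ℚ.∣ seq x N ∣ (ℚ.<⇒≤ (close n N N≤n ℕ.≤-refl))))

  shrink : ∀ {K ε} → 0ℚ ℚ.< K → 0ℚ ℚ.< ε → ∃ λ δ → 0ℚ ℚ.< δ × K ℚ.* δ ≡ ε
  shrink {K} {ε} 0<K 0<ε =
    δ , ℚ.positive⁻¹ δ {{ℚ.pos*pos⇒pos (1/ K) {{ℚ.1/pos⇒pos K {{ℚ.positive 0<K}}}} ε {{ℚ.positive 0<ε}}}}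
      , trans (sym (ℚ.*-assoc K (1/ K) ε))
          (trans (cong (ℚ._* ε) (ℚ.*-inverseʳ K)) (ℚ.*-identityˡ ε))
    where
    instance
      K≢0 : NonZero K
      K≢0 = ℚ.pos⇒nonZero K {{ℚ.positive 0<K}}
    δ = 1/ K ℚ.* ε

  small-* : ∀ {K δ ε} a b → 0ℚ ℚ.< K → K ℚ.* δ ≡ ε →
            ℚ.∣ a ∣ ℚ.≤ K → ℚ.∣ b ∣ ℚ.< δ → ℚ.∣ a ℚ.* b ∣ ℚ.< ε
  small-* {K} {δ} {ε} a b 0<K Kδ≡ε a≤K b<δ =
    ℚ.≤-<-trans (ℚ.≤-reflexive (ℚ.∣p*q∣≡∣p∣*∣q∣ a b))
      (ℚ.≤-<-trans (ℚ.*-monoʳ-≤-nonNeg ℚ.∣ b ∣ {{ℚ.∣-∣-nonNeg b}} a≤K)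
        (subst (K ℚ.* ℚ.∣ b ∣ ℚ.<_) Kδ≡ε
          (ℚ.*-monoʳ-<-pos K {{ℚ.positive 0<K}} b<δ)))

  sum< : ∀ {d} u v ε → d ≡ u ℚ.+ v → ℚ.∣ u ∣ ℚ.< ½ ℚ.* ε → ℚ.∣ v ∣ ℚ.< ½ ℚ.* ε →
         ℚ.∣ d ∣ ℚ.< ε
  sum< u v ε refl u< v< = ℚ.≤-<-trans (ℚ.∣p+q∣≤∣p∣+∣q∣ u v)
    (subst (ℚ.∣ u ∣ ℚ.+ ℚ.∣ v ∣ ℚ.<_) (halves ε) (ℚ.+-mono-< u< v<))

  close-+ : ∀ a b c d ε → ℚ.∣ a ℚ.- c ∣ ℚ.< ½ ℚ.* ε → ℚ.∣ b ℚ.- d ∣ ℚ.< ½ ℚ.* ε →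
            ℚ.∣ (a ℚ.+ b) ℚ.- (c ℚ.+ d) ∣ ℚ.< ε
  close-+ a b c d ε = sum< (a ℚ.- c) (b ℚ.- d) ε (+-diff a b c d)

  close-* : ∀ a b c d ε →
            ℚ.∣ a ℚ.* (b ℚ.- d) ∣ ℚ.< ½ ℚ.* ε → ℚ.∣ d ℚ.* (a ℚ.- c) ∣ ℚ.< ½ ℚ.* ε →
            ℚ.∣ a ℚ.* b ℚ.- c ℚ.* d ∣ ℚ.< ε
  close-* a b c d ε = sum< (a ℚ.* (b ℚ.- d)) (d ℚ.* (a ℚ.- c)) ε (*-diff a b c d)

_+ᴿ_ : ℝ → ℝ → ℝ
x +ᴿ y = mkℝ (λ n → seq x n ℚ.+ seq y n) prf
  where
  prf : ∀ ε → 0ℚ ℚ.< ε → ∃ λ N → ∀ m n → N ℕ.≤ m → N ℕ.≤ n →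
        ℚ.∣ (seq x m ℚ.+ seq y m) ℚ.- (seq x n ℚ.+ seq y n) ∣ ℚ.< ε
  prf ε 0<ε =
    let
      M , p = cauchy x (½ ℚ.* ε) (halve 0<ε)
      N , q = cauchy y (½ ℚ.* ε) (halve 0<ε)
    in M ⊔ N , λ m n m≥ n≥ →
    close-+ (seq x m) (seq y m) (seq x n) (seq y n) ε
      (p m n (ℕ.m⊔n≤o⇒m≤o M N m≥) (ℕ.m⊔n≤o⇒m≤o M N n≥))
      (q m n (ℕ.m⊔n≤o⇒n≤o M N m≥) (ℕ.m⊔n≤o⇒n≤o M N n≥))

-ᴿ_ : ℝ → ℝ
-ᴿ x = mkℝ (λ n → ℚ.- seq x n) prf
  where
  prf : ∀ ε → 0ℚ ℚ.< ε → ∃ λ N → ∀ m n → N ℕ.≤ m → N ℕ.≤ n →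
        ℚ.∣ (ℚ.- seq x m) ℚ.- (ℚ.- seq x n) ∣ ℚ.< ε
  prf ε 0<ε with cauchy x ε 0<ε
  ... | N , p = N , λ m n m≥ n≥ → ℚ.≤-<-trans
    (ℚ.≤-reflexive (trans (cong ℚ.∣_∣ (neg-diff (seq x m) (seq x n)))
                          (ℚ.∣-p∣≡∣p∣ (seq x m ℚ.- seq x n))))
    (p m n m≥ n≥)

_*ᴿ_ : ℝ → ℝ → ℝ
x *ᴿ y = mkℝ (λ n → seq x n ℚ.* seq y n) prf
  where
  prf : ∀ ε → 0ℚ ℚ.< ε → ∃ λ N → ∀ m n → N ℕ.≤ m → N ℕ.≤ n →
        ℚ.∣ seq x m ℚ.* seq y m ℚ.- seq x n ℚ.* seq y n ∣ ℚ.< ε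
  prf ε 0<ε =
    let
      K , 0<K , A , x≤K = bounded x
      L , 0<L , B , y≤L = bounded y
      δ , 0<δ , Kδ      = shrink 0<K (halve 0<ε)
      δ′ , 0<δ′ , Lδ′   = shrink 0<L (halve 0<ε)
      C , q             = cauchy y δ 0<δ
      D , p             = cauchy x δ′ 0<δ′
    in (A ⊔ B) ⊔ (C ⊔ D) , λ m n m≥ n≥ →
    let
      mAB = ℕ.m⊔n≤o⇒m≤o (A ⊔ B) (C ⊔ D) m≥
      nAB = ℕ.m⊔n≤o⇒m≤o (A ⊔ B) (C ⊔ D) n≥
      mCD = ℕ.m⊔n≤o⇒n≤o (A ⊔ B) (C ⊔ D) m≥
      nCD = ℕ.m⊔n≤o⇒n≤o (A ⊔ B) (C ⊔ D) n≥
    in close-* (seq x m) (seq y m) (seq x n) (seq y n) ε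
         (small-* (seq x m) (seq y m ℚ.- seq y n) 0<K Kδ (x≤K m (ℕ.m⊔n≤o⇒m≤o A B mAB))
           (q m n (ℕ.m⊔n≤o⇒m≤o C D mCD) (ℕ.m⊔n≤o⇒m≤o C D nCD)))
         (small-* (seq y n) (seq x m ℚ.- seq x n) 0<L Lδ′ (y≤L n (ℕ.m⊔n≤o⇒n≤o A B nAB))
           (p m n (ℕ.m⊔n≤o⇒n≤o C D mCD) (ℕ.m⊔n≤o⇒n≤o C D nCD)))

-- |x - y| < δ
Within : ℚ → ℝ → ℝ → Set
Within δ x y = x <ᴿ y +ᴿ fromℚ δ × y <ᴿ x +ᴿ fromℚ δ

sumᴿ : ∀ {n} → Vector ℝ n → ℝ
sumᴿ = Vector.foldr _+ᴿ_ 0ᴿ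

------------------------------------------------------------------------
-- Complex numbers

record ℂ : Set where
  constructor _+i_
  field
    re im : ℝ

open ℂ public

_≈ᶜ_ : ℂ → ℂ → Set
z ≈ᶜ w = re z ≈ᴿ re w × im z ≈ᴿ im w

_+ᶜ_ _*ᶜ_ : ℂ → ℂ → ℂ
z +ᶜ w = (re z +ᴿ re w) +i (im z +ᴿ im w)
z *ᶜ w = (re z *ᴿ re w +ᴿ -ᴿ (im z *ᴿ im w)) +i (re z *ᴿ im w +ᴿ im z *ᴿ re w)

-ᶜ_ : ℂ → ℂ
-ᶜ z = (-ᴿ re z) +i (-ᴿ im z)

0ᶜ 1ᶜ : ℂ
0ᶜ = 0ᴿ +i 0ᴿ
1ᶜ = 1ᴿ +i 0ᴿ

ℂ-rawRing : RawRing 0ℓ 0ℓ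
ℂ-rawRing = record
  { Carrier = ℂ ; _≈_ = _≈ᶜ_ ; _+_ = _+ᶜ_ ; _*_ = _*ᶜ_ ; -_ = -ᶜ_ ; 0# = 0ᶜ ; 1# = 1ᶜ }

------------------------------------------------------------------------
-- Integer polynomials as coefficient lists, constant term first;
-- trailing zeros are allowed.

Poly : Set
Poly = List ℤ

infixl 6 _+ᴾ_
_+ᴾ_ : Poly → Poly → Poly
[]      +ᴾ q       = q
(a ∷ p) +ᴾ []      = a ∷ p
(a ∷ p) +ᴾ (b ∷ q) = a ℤ.+ b ∷ (p +ᴾ q)

t^_ : ℕ → Poly
t^ zero  = [ 1ℤ ]
t^ suc n = 0ℤ ∷ t^ n

coeff : Poly → ℕ → ℤ
coeff []      _       = 0ℤ
coeff (a ∷ p) zero    = a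
coeff (a ∷ p) (suc i) = coeff p i

module Evaluation (R : RawRing 0ℓ 0ℓ) (ι : ℤ → RawRing.Carrier R) where
  open RawRing R

  eval : Poly → Carrier → Carrier
  eval p x = foldr (λ a r → ι a + x * r) 0# p

ℤ→ℚ : ℤ → ℚ
ℤ→ℚ a = a ℚ./ 1

ℤ→ℂ : ℤ → ℂ
ℤ→ℂ a = fromℚ (ℤ→ℚ a) +i 0ᴿ

open Evaluation ℤ.+-*-rawRing id public renaming (eval to evalℤ)
open Evaluation ℚ.+-*-rawRing ℤ→ℚ public renaming (eval to evalℚ)
open Evaluation ℂ-rawRing ℤ→ℂ public renaming (eval to evalℂ)

HasNonRealRoot : Poly → Set
HasNonRealRoot p = ∃ λ z → evalℂ p z ≈ᶜ 0ᶜ × ¬ (im z ≈ᴿ 0ᴿ)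

------------------------------------------------------------------------
-- Finite simplicial complexes. The ground set Fin N may contain
-- elements that are not vertices, so that links and subcomplexes live
-- on the same ground set; the vertices are the i with ⁅ i ⁆ a face.

record Complex (N : ℕ) : Set₁ where
  field
    Face   : Pred (Subset N) 0ℓ
    face?  : Decidable Face
    ∅-face : Face ⊥
    ⊆-face : ∀ {σ τ} → τ ⊆ σ → Face σ → Face τ

open Complex public

_≟ˢ_ : ∀ {n} (σ τ : Subset n) → Dec (σ ≡ τ)
_≟ˢ_ = Vec.≡-dec Bool._≟_

-- For i ≡ j the condition says that i is a vertex.
Flag : ∀ {N} → Complex N → Set
Flag X = ∀ σ → (∀ i j → i ∈ σ → j ∈ σ → Face X (⁅ i ⁆ ∪ ⁅ j ⁆)) → Face X σ

private
  ∪-monoʳ : ∀ {n} (σ : Subset n) {τ τ′} → τ ⊆ τ′ → σ ∪ τ ⊆ σ ∪ τ′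
  ∪-monoʳ σ {τ} τ⊆τ′ x∈ with x∈p∪q⁻ σ τ x∈
  ... | inj₁ x∈σ = x∈p∪q⁺ (inj₁ x∈σ)
  ... | inj₂ x∈τ = x∈p∪q⁺ (inj₂ (τ⊆τ′ x∈τ))

  ∩-monoʳ : ∀ {n} (σ : Subset n) {τ τ′} → τ ⊆ τ′ → σ ∩ τ ⊆ σ ∩ τ′
  ∩-monoʳ σ {τ} τ⊆τ′ x∈ = x∈p∩q⁺ (p∩q⊆p σ τ x∈ , τ⊆τ′ (p∩q⊆q σ τ x∈))

  ⊆⊥⇒≡⊥ : ∀ {n} {σ : Subset n} → σ ⊆ ⊥ → σ ≡ ⊥
  ⊆⊥⇒≡⊥ {σ = σ} σ⊆⊥ = ⊆-antisym σ⊆⊥ (⊆-min σ)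

Link : ∀ {N} (X : Complex N) (σ : Subset N) → Face X σ → Complex N
Link X σ σ∈X = record
  { Face   = λ τ → Face X τ × Face X (σ ∪ τ) × σ ∩ τ ≡ ⊥
  ; face?  = λ τ → face? X τ ×-dec face? X (σ ∪ τ) ×-dec (σ ∩ τ) ≟ˢ ⊥
  ; ∅-face = ∅-face X , subst (Face X) (sym (∪-identityʳ σ)) σ∈X , ∩-zeroʳ σ
  ; ⊆-face = λ {τ} τ′⊆τ (f , g , d) →
      ⊆-face X τ′⊆τ f ,
      ⊆-face X (∪-monoʳ σ τ′⊆τ) g ,
      ⊆⊥⇒≡⊥ (subst (_ ⊆_) d (∩-monoʳ σ τ′⊆τ))
  }

------------------------------------------------------------------------
-- Joins and cross-polytopes

private
  take-⊆ : ∀ m {n} {σ τ : Subset (m ℕ.+ n)} → σ ⊆ τ → take m σ ⊆ take m τ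
  take-⊆ (suc m) {σ = _ ∷ _} {_ ∷ _} σ⊆τ here with σ⊆τ here
  ... | here = here
  take-⊆ (suc m) {σ = _ ∷ _} {_ ∷ _} σ⊆τ (there x∈) =
    there (take-⊆ m (drop-∷-⊆ σ⊆τ) x∈)

  drop-⊆ : ∀ m {n} {σ τ : Subset (m ℕ.+ n)} → σ ⊆ τ → drop m σ ⊆ drop m τ
  drop-⊆ zero σ⊆τ = σ⊆τ
  drop-⊆ (suc m) {σ = _ ∷ _} {_ ∷ _} σ⊆τ = drop-⊆ m (drop-∷-⊆ σ⊆τ)

  take-⊥ : ∀ m {n} → take m (⊥ {m ℕ.+ n}) ≡ ⊥
  take-⊥ zero    = refl
  take-⊥ (suc m) = cong (outside ∷_) (take-⊥ m)

  drop-⊥ : ∀ m {n} → drop m (⊥ {m ℕ.+ n}) ≡ ⊥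
  drop-⊥ zero    = refl
  drop-⊥ (suc m) = drop-⊥ m

-- The ground set Fin (m + n) is the disjoint union of Fin m and Fin n;
-- a subset ρ of it is the union of take m ρ and drop m ρ.
join : ∀ {m n} → Complex m → Complex n → Complex (m ℕ.+ n)
join {m} X Y = record
  { Face   = λ ρ → Face X (take m ρ) × Face Y (drop m ρ)
  ; face?  = λ ρ → face? X (take m ρ) ×-dec face? Y (drop m ρ)
  ; ∅-face = subst (Face X) (sym (take-⊥ m)) (∅-face X) ,
             subst (Face Y) (sym (drop-⊥ m)) (∅-face Y)
  ; ⊆-face = λ τ⊆σ (f , g) → ⊆-face X (take-⊆ m τ⊆σ) f , ⊆-face Y (drop-⊆ m τ⊆σ) g
  }

twoPoints : Complex 2
twoPoints = record
  { Face   = λ σ → σ ≢ inside ∷ inside ∷ []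
  ; face?  = λ σ → ¬? (σ ≟ˢ (inside ∷ inside ∷ []))
  ; ∅-face = λ ()
  ; ⊆-face = λ { τ⊆σ σ≢ refl → σ≢ (⊆-antisym (λ { {zero} _ → here ; {suc zero} _ → there here }) τ⊆σ) }
  }

-- {∅}, the unit for joins
emptyFaceOnly : Complex 0
emptyFaceOnly = record
  { Face   = λ σ → σ ≡ []
  ; face?  = λ σ → σ ≟ˢ []
  ; ∅-face = refl
  ; ⊆-face = λ { {τ = []} _ _ → refl }
  }

joinPower : ∀ r → Complex (r ℕ.* 2)
joinPower zero    = emptyFaceOnly
joinPower (suc r) = join twoPoints (joinPower r)

crossPolytope : ∀ k → Complex (suc k ℕ.* 2)
crossPolytope k = joinPower (suc k)

image : ∀ {m n} → (Fin m → Fin n) → Subset m → Subset n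
image e τ = tabulate λ i → does (Fin.any? λ j → (j ∈? τ) ×-dec (e j Fin.≟ i))

-- X is Y with its vertices renamed along an injection. (Used for Y all
-- of whose ground set consists of vertices.)
record _IsCopyOf_ {m n} (X : Complex m) (Y : Complex n) : Set where
  field
    rename    : Fin n → Fin m
    injective : Injective _≡_ _≡_ rename
    faces     : ∀ σ → Face X σ ⇔ (∃ λ τ → Face Y τ × σ ≡ image rename τ)

IsCrossPolytope : ∀ {N} → Complex N → Set
IsCrossPolytope X = ∃ λ k → X IsCopyOf crossPolytope k

------------------------------------------------------------------------
-- Edge subdivision

record Edge {N} (X : Complex N) : Set where
  field
    s t  : Fin N
    s≢t  : s ≢ t
    face : Face X (⁅ s ⁆ ∪ ⁅ t ⁆)

  vertices : Subset N
  vertices = ⁅ s ⁆ ∪ ⁅ t ⁆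

LinkEdge : ∀ {N} (X : Complex N) → Edge X → Complex N
LinkEdge X η = Link X (Edge.vertices η) (Edge.face η)

data Endpoint : Set where
  at-s at-t : Endpoint

-- The new vertex is zero : Fin (suc N); an old vertex i becomes suc i.
module _ {N} (X : Complex N) (η : Edge X) where
  open Edge η
  private L = LinkEdge X η

  SubFace : Subset (suc N) → Set
  SubFace (outside ∷ σ) = Face X σ × ¬ (vertices ⊆ σ)
  SubFace (inside  ∷ σ) =
    ∃ λ τ → Face L τ × (σ ≡ τ ⊎ σ ≡ τ ∪ ⁅ s ⁆ ⊎ σ ≡ τ ∪ ⁅ t ⁆)

  private
    s∈η : s ∈ vertices
    s∈η = x∈p∪q⁺ (inj₁ (x∈⁅x⁆ s))

    t∈η : t ∈ vertices
    t∈η = x∈p∪q⁺ (inj₂ (x∈⁅x⁆ t))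

    SubFace? : Decidable SubFace
    SubFace? (outside ∷ σ) = face? X σ ×-dec ¬? (vertices ⊆? σ)
    SubFace? (inside  ∷ σ) = anySubset? λ τ →
      face? L τ ×-dec (σ ≟ˢ τ ⊎-dec σ ≟ˢ (τ ∪ ⁅ s ⁆) ⊎-dec σ ≟ˢ (τ ∪ ⁅ t ⁆))

    -- a subset of τ ∪ ⁅ x ⁆ is ρ ∩ τ or (ρ ∩ τ) ∪ ⁅ x ⁆
    trace : ∀ {n} {ρ τ : Subset n} x → ρ ⊆ τ ∪ ⁅ x ⁆ →
            ρ ≡ ρ ∩ τ ⊎ ρ ≡ (ρ ∩ τ) ∪ ⁅ x ⁆
    trace {ρ = ρ} {τ} x ρ⊆ with x ∈? ρ
    ... | yes x∈ρ = inj₂ (⊆-antisym to from)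
      where
      to : ρ ⊆ (ρ ∩ τ) ∪ ⁅ x ⁆
      to y∈ρ with x∈p∪q⁻ τ ⁅ x ⁆ (ρ⊆ y∈ρ)
      ... | inj₁ y∈τ = x∈p∪q⁺ (inj₁ (x∈p∩q⁺ (y∈ρ , y∈τ)))
      ... | inj₂ y∈x = x∈p∪q⁺ (inj₂ y∈x)
      from : (ρ ∩ τ) ∪ ⁅ x ⁆ ⊆ ρ
      from y∈ with x∈p∪q⁻ (ρ ∩ τ) ⁅ x ⁆ y∈
      ... | inj₁ y∈ρτ = p∩q⊆p ρ τ y∈ρτ
      ... | inj₂ y∈x  = subst (_∈ ρ) (sym (x∈⁅y⁆⇒x≡y x y∈x)) x∈ρ
    ... | no x∉ρ = inj₁ (⊆-antisym to (p∩q⊆p ρ τ))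
      where
      to : ρ ⊆ ρ ∩ τ
      to {y} y∈ρ with x∈p∪q⁻ τ ⁅ x ⁆ (ρ⊆ y∈ρ)
      ... | inj₁ y∈τ = x∈p∩q⁺ (y∈ρ , y∈τ)
      ... | inj₂ y∈x = ⊥-elim (x∉ρ (subst (_∈ ρ) (x∈⁅y⁆⇒x≡y x y∈x) y∈ρ))

    inner : ∀ {ρ τ} → Face L τ → (ρ ⊆ τ ⊎ ρ ⊆ τ ∪ ⁅ s ⁆ ⊎ ρ ⊆ τ ∪ ⁅ t ⁆) →
            SubFace (inside ∷ ρ)
    inner {ρ} f (inj₁ ρ⊆) = ρ , ⊆-face L ρ⊆ f , inj₁ refl
    inner {ρ} {τ} f (inj₂ (inj₁ ρ⊆)) with trace s ρ⊆
    ... | inj₁ eq = ρ ∩ τ , ⊆-face L (p∩q⊆q ρ τ) f , inj₁ eq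
    ... | inj₂ eq = ρ ∩ τ , ⊆-face L (p∩q⊆q ρ τ) f , inj₂ (inj₁ eq)
    inner {ρ} {τ} f (inj₂ (inj₂ ρ⊆)) with trace t ρ⊆
    ... | inj₁ eq = ρ ∩ τ , ⊆-face L (p∩q⊆q ρ τ) f , inj₁ eq
    ... | inj₂ eq = ρ ∩ τ , ⊆-face L (p∩q⊆q ρ τ) f , inj₂ (inj₂ eq)

    inner-⊆ : ∀ {ρ σ} → ρ ⊆ σ → SubFace (inside ∷ σ) → SubFace (inside ∷ ρ)
    inner-⊆ ρ⊆ (τ , f , inj₁ refl)        = inner f (inj₁ ρ⊆)
    inner-⊆ ρ⊆ (τ , f , inj₂ (inj₁ refl)) = inner f (inj₂ (inj₁ ρ⊆))
    inner-⊆ ρ⊆ (τ , f , inj₂ (inj₂ refl)) = inner f (inj₂ (inj₂ ρ⊆))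

    -- τ ∪ ⁅ x ⁆ cannot contain an endpoint of η other than x
    avoid : ∀ {τ} x {y} → Face L τ → y ∈ vertices → y ≢ x → ¬ (y ∈ τ ∪ ⁅ x ⁆)
    avoid {τ} x (_ , _ , d) y∈η y≢x y∈ with x∈p∪q⁻ τ ⁅ x ⁆ y∈
    ... | inj₁ y∈τ = ∉⊥ (subst (_ ∈_) d (x∈p∩q⁺ (y∈η , y∈τ)))
    ... | inj₂ y∈x = y≢x (x∈⁅y⁆⇒x≡y x y∈x)

    outer : ∀ {σ} → SubFace (inside ∷ σ) → SubFace (outside ∷ σ)
    outer (τ , (f , g , d) , inj₁ refl) =
      f , λ η⊆ → ∉⊥ (subst (_ ∈_) d (x∈p∩q⁺ (s∈η , η⊆ s∈η)))
    outer {σ} (τ , l@(f , g , d) , inj₂ (inj₁ refl)) =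
      ⊆-face X sub g , λ η⊆ → avoid s l t∈η (λ t≡s → s≢t (sym t≡s)) (η⊆ t∈η)
      where
      sub : τ ∪ ⁅ s ⁆ ⊆ vertices ∪ τ
      sub x∈ with x∈p∪q⁻ τ ⁅ s ⁆ x∈
      ... | inj₁ x∈τ = x∈p∪q⁺ (inj₂ x∈τ)
      ... | inj₂ x∈s = x∈p∪q⁺ (inj₁ (x∈p∪q⁺ (inj₁ x∈s)))
    outer {σ} (τ , l@(f , g , d) , inj₂ (inj₂ refl)) =
      ⊆-face X sub g , λ η⊆ → avoid t l s∈η s≢t (η⊆ s∈η)
      where
      sub : τ ∪ ⁅ t ⁆ ⊆ vertices ∪ τ
      sub x∈ with x∈p∪q⁻ τ ⁅ t ⁆ x∈
      ... | inj₁ x∈τ = x∈p∪q⁺ (inj₂ x∈τ)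
      ... | inj₂ x∈t = x∈p∪q⁺ (inj₁ (x∈p∪q⁺ (inj₂ x∈t)))

    outer-⊆ : ∀ {ρ σ} → ρ ⊆ σ → SubFace (outside ∷ σ) → SubFace (outside ∷ ρ)
    outer-⊆ ρ⊆ (f , η⊈) = ⊆-face X ρ⊆ f , λ η⊆ → η⊈ (⊆-trans η⊆ ρ⊆)

    SubFace-⊆ : ∀ {σ τ} → τ ⊆ σ → SubFace σ → SubFace τ
    SubFace-⊆ {outside ∷ σ} {outside ∷ τ} τ⊆ f = outer-⊆ (drop-∷-⊆ τ⊆) f
    SubFace-⊆ {outside ∷ σ} {inside  ∷ τ} τ⊆ f with () ← τ⊆ here
    SubFace-⊆ {inside  ∷ σ} {outside ∷ τ} τ⊆ f = outer-⊆ (drop-∷-⊆ τ⊆) (outer f)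
    SubFace-⊆ {inside  ∷ σ} {inside  ∷ τ} τ⊆ f = inner-⊆ (drop-∷-⊆ τ⊆) f

  Sub : Complex (suc N)
  Sub = record
    { Face   = SubFace
    ; face?  = SubFace?
    ; ∅-face = ∅-face X , λ η⊆⊥ → ∉⊥ (η⊆⊥ s∈η)
    ; ⊆-face = SubFace-⊆
    }

  endpoint : Endpoint → Fin N
  endpoint at-s = s
  endpoint at-t = t

  -- the edge of Sub joining the new vertex to the chosen endpoint of η
  nextEdge : Endpoint → Edge Sub
  nextEdge c = record
    { s    = zero
    ; t    = suc (endpoint c)
    ; s≢t  = λ ()
    ; face = isFace c
    }
    where
    isFace : ∀ c → SubFace (⁅ zero ⁆ ∪ ⁅ suc (endpoint c) ⁆)
    isFace at-s = ⊥ , ∅-face L , inj₂ (inj₁ refl)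
    isFace at-t = ⊥ , ∅-face L , inj₂ (inj₂ refl)

-- After m subdivisions: the complex obtained and the edge to be
-- subdivided next. At step m + 1, c m selects the endpoint of the edge
-- just subdivided that the next edge joins to the new vertex.
iterateSub : ∀ {N} (X : Complex N) → Edge X → (ℕ → Endpoint) →
             (m : ℕ) → Σ (Complex (m ℕ.+ N)) Edge
iterateSub X η c zero    = X , η
iterateSub X η c (suc m) =
  let Y , ζ = iterateSub X η c m in Sub Y ζ , nextEdge Y ζ (c m)

Sub^ : ∀ {N} (m : ℕ) (X : Complex N) → Edge X → (ℕ → Endpoint) → Complex (m ℕ.+ N)
Sub^ m X η c = proj₁ (iterateSub X η c m)

------------------------------------------------------------------------
-- f-, h- and γ-polynomials

subsets : ∀ n → List (Subset n)
subsets zero    = [ [] ]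
subsets (suc n) = map (outside ∷_) (subsets n) ++ map (inside ∷_) (subsets n)

fPoly : ∀ {N} → Complex N → Poly
fPoly {N} X = foldr (λ σ p → t^ ∣ σ ∣ +ᴾ p) [] (filter (face? X) (subsets N))

-- (1+t)ⁿ h(1/(1+t)) = tⁿ f(1/t); an identity of rational functions,
-- hence expressed at all rational t for which both sides are defined.
IsHPoly : ∀ {N} → ℕ → Complex N → Poly → Set
IsHPoly n X h = ∀ t .{{_ : NonZero t}} .{{_ : NonZero (1ℚ ℚ.+ t)}} →
  (1ℚ ℚ.+ t) ^ n ℚ.* evalℚ h (1/ (1ℚ ℚ.+ t)) ≡ t ^ n ℚ.* evalℚ (fPoly X) (1/ t)

-- h(t) = (1+t)ⁿ γ(t/(1+t)²)
IsγPoly : ℕ → Poly → Poly → Set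
IsγPoly n h γ = ∀ t .{{_ : NonZero (1ℚ ℚ.+ t)}} →
  evalℚ h t ≡ (1ℚ ℚ.+ t) ^ n ℚ.* evalℚ γ (t ℚ.* (1/ (1ℚ ℚ.+ t)) ^ 2)

------------------------------------------------------------------------
-- Geometric realisations and triangulations of spheres

-- Points in barycentric coordinates. As X is closed under subsets, the
-- last condition says that the support of x is a face.
Realisation : ∀ {N} → Complex N → Pred (Vector ℝ N) 0ℓ
Realisation X x =
  (∀ i → 0ᴿ ≤ᴿ x i) ×
  sumᴿ x ≈ᴿ 1ᴿ ×
  (∀ σ → (∀ i → i ∈ σ → 0ᴿ <ᴿ x i) → Face X σ)

Sphere : ∀ d → Pred (Vector ℝ (suc d)) 0ℓ
Sphere d x = sumᴿ (λ i → x i *ᴿ x i) ≈ᴿ 1ᴿ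

Near : ∀ {n} {A : Pred (Vector ℝ n) 0ℓ} → ℚ → ∃ A → ∃ A → Set
Near δ (x , _) (y , _) = ∀ i → Within δ (x i) (y i)

_≈ᴾ_ : ∀ {n} {A : Pred (Vector ℝ n) 0ℓ} → ∃ A → ∃ A → Set
(x , _) ≈ᴾ (y , _) = ∀ i → x i ≈ᴿ y i

Continuous : ∀ {m n} {A : Pred (Vector ℝ m) 0ℓ} {B : Pred (Vector ℝ n) 0ℓ} →
             (∃ A → ∃ B) → Set
Continuous {A = A} {B} f = ∀ p ε → 0ℚ ℚ.< ε → ∃ λ δ → 0ℚ ℚ.< δ ×
  (∀ q → Near {A = A} δ p q → Near {A = B} ε (f p) (f q))

record Homeomorphic {m n} (A : Pred (Vector ℝ m) 0ℓ) (B : Pred (Vector ℝ n) 0ℓ) : Set where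
  field
    to              : ∃ A → ∃ B
    from            : ∃ B → ∃ A
    to-continuous   : Continuous {A = A} {B = B} to
    from-continuous : Continuous {A = B} {B = A} from
    from∘to         : ∀ p → _≈ᴾ_ {A = A} (from (to p)) p
    to∘from         : ∀ q → _≈ᴾ_ {A = B} (to (from q)) q

HasDimension : ∀ {N} → Complex N → ℕ → Set
HasDimension X d =
  (∀ σ → Face X σ → ∣ σ ∣ ℕ.≤ suc d) × (∃ λ σ → Face X σ × ∣ σ ∣ ≡ suc d)

TriangulatesSphere : ∀ {N} → ℕ → Complex N → Set
TriangulatesSphere d X = HasDimension X d × Homeomorphic (Realisation X) (Sphere d)

{-# OPTIONS --safe #-}
-- Each subdivision adds x (1 + x)^(k+1) (1 - x)^(3-k) to the h-polynomial, where k ≤ 3 is the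
-- dimension of the cross-polytope Lk_η. For k ≥ 1 the roots of h + m x (1 + x)^(k+1) (1 - x)^(3-k)
-- close to -1 are x = -1 - y with y^(k+1) ≈ const · h (-1) / m, where the constant is such that
-- h (-1) < 0 makes one of the solutions y non-real. For k = 0 the same argument works at x = 1, a
-- triple zero of the added polynomial, because h (1) is the number of facets and so positive. A root
-- of the exact equation is the limit of a contraction that starts at the approximate one; all
-- iterates are Gaussian rationals, so they are the Cauchy sequences that define the root.
-- For the statement on γ: since h (t) stays bounded as t → -1 while t / (1 + t)² → ∞, the polynomial
-- γ has degree at most 3, and t → -1 gives h (-1) = -γ₃.
module Submission where

open import Defs
open import Algebra.Bundles.Raw using (RawRing)
import Algebra.Definitions.RawSemiring as RawSemiringDefs
import Algebra.Solver.Ring as RingSolver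
import Algebra.Solver.Ring.AlmostCommutativeRing as ACR
open import Algebra.Structures using (IsCommutativeRing; IsMagma)
open import Data.Bool.Base using (Bool; true; false; not)
open import Data.Empty using (⊥-elim)
open import Data.Fin.Base using (Fin; zero; suc)
import Data.Fin.Properties as Fin
open import Data.Fin.Subset using (Subset; inside; outside; _∈_; _∉_; _⊆_; _∪_; _∩_; ⊥; ⁅_⁆; ∣_∣)
open import Data.Fin.Subset.Properties using (_∈?_; ⊆-antisym; ⊆-min; x∈p∩q⁺; x∈p∩q⁻; x∈p∪q⁻; x∈p∪q⁺; x∈⁅x⁆; x∈⁅y⁆⇒x≡y; ∉⊥; ∪-identityʳ; drop-there; p⊆p∪q; ∪-identityˡ; ∪-comm; ∣⊥∣≡0)
open import Data.Integer using (0ℤ; -1ℤ; _<_)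
open import Data.Integer.Base as ℤ using (ℤ; +[1+_]; -[1+_]; 1ℤ)
import Data.Integer.Properties as ℤ
open import Data.List.Base using (List; drop; []; _∷_; _++_; foldr; map; filter)
import Data.Maybe.Base as Maybe
open import Data.Nat using (ℕ; _≤_)
open import Data.Nat.Base as ℕ using (zero; suc)
import Data.Nat.Coprimality as Coprime
import Data.Nat.Properties as ℕ
open import Data.Product using (∃; _×_)
open import Data.Product.Base using (_,_; proj₁; proj₂)
open import Data.Rational.Base as ℚ using (ℚ; mkℚ; 0ℚ; 1ℚ; ½; *≤*; *<*; 1/_; NonZero)
import Data.Rational.Properties as ℚ
open import Data.Rational.Solver using (module +-*-Solver)
open import Data.Sum.Base using (inj₁; inj₂)
open import Data.Vec.Base using ([]; _∷_; here; there)
open import Data.Vec.Properties using (lookup∘tabulate; lookup⇒[]=; []=⇒lookup)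
open import Function.Base using (_∘_; case_of_)
open import Function.Bundles using (_⇔_; mk⇔; Equivalence)
open import Function.Definitions using (Injective)
open import Level using (0ℓ)
open import Relation.Binary.PropositionalEquality using (_≡_; _≢_; refl; sym; trans; cong; cong₂; subst; subst₂; isEquivalence; module ≡-Reasoning)
open import Relation.Nullary using (¬_; Dec; yes; no; does)
open import Relation.Nullary.Decidable using (from-yes; _×-dec_; dec⇒maybe; does-⇔; dec-true; dec-false)

-- The embedding of ℤ in ℚ

-- The root must be produced as a Cauchy sequence with a rate, hence an explicit contraction. Let r
-- be the order of the zero of the added polynomial at b = -1 or 1, and B what remains of it after
-- division by y ^ r. Neither the scale (1/m)^(1/r) nor the direction of y is in general a Gaussian
-- rational, so both are rounded: y = v u₀ / q, where q is an integer r-th root of β m / α with α =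
-- |h (b)|, and u₀ is a fixed Gaussian rational with u₀ ^ r close to β / B (0) up to sign. Division
-- by -h (b) turns the equation into v ^ r - 1 + error = 0. The error collects the variation of h
-- and B over a distance O(1/q), the rounding of q and the rounding of u₀; the first two tend to 0
-- as m grows, the third is a fixed small number. Hence one disc about v = 1 and one contraction
-- factor serve for all large m, and the imaginary parts of the iterates stay at least 1/(2q) in
-- absolute value, which survives in the limit. To first order y² = h (-1) / (4m), y³ = -h (-1) /
-- (2m), y⁴ = h (-1) / m for k = 1, 2, 3. For the even exponents a negative h (-1) leaves no real
-- solution; a cube root can always be taken non-real.

fromℤ : ℤ → ℚ
fromℤ a = mkℚ a 0 (Coprime.sym (Coprime.1-coprimeTo ℤ.∣ a ∣))

ℤ→ℚ-fromℤ : ∀ a → ℤ→ℚ a ≡ fromℤ a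
ℤ→ℚ-fromℤ a = ℚ.↥p/↧p≡p (fromℤ a)

ℤ→ℚ-+ : ∀ a b → ℤ→ℚ (a ℤ.+ b) ≡ ℤ→ℚ a ℚ.+ ℤ→ℚ b
ℤ→ℚ-+ a b = sym (trans (cong₂ ℚ._+_ (ℤ→ℚ-fromℤ a) (ℤ→ℚ-fromℤ b))
  (cong₂ (λ c d → ℤ→ℚ (c ℤ.+ d)) (ℤ.*-identityʳ a) (ℤ.*-identityʳ b)))

ℤ→ℚ-* : ∀ a b → ℤ→ℚ (a ℤ.* b) ≡ ℤ→ℚ a ℚ.* ℤ→ℚ b
ℤ→ℚ-* a b = sym (cong₂ ℚ._*_ (ℤ→ℚ-fromℤ a) (ℤ→ℚ-fromℤ b))

ℤ→ℚ-neg : ∀ a → ℤ→ℚ (ℤ.- a) ≡ ℚ.- ℤ→ℚ a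
ℤ→ℚ-neg (ℤ.+ zero)  = refl
ℤ→ℚ-neg +[1+ n ]  = refl
ℤ→ℚ-neg -[1+ n ]  = trans (ℤ→ℚ-fromℤ +[1+ n ]) (cong ℚ.-_ (sym (ℤ→ℚ-fromℤ -[1+ n ])))

ℤ→ℚ-mono-≤ : ∀ {a b} → a ℤ.≤ b → ℤ→ℚ a ℚ.≤ ℤ→ℚ b
ℤ→ℚ-mono-≤ {a} {b} a≤b = subst₂ ℚ._≤_ (sym (ℤ→ℚ-fromℤ a)) (sym (ℤ→ℚ-fromℤ b))
  (*≤* (ℤ.*-monoʳ-≤-nonNeg (ℤ.+ 1) a≤b))

ℤ→ℚ-mono-< : ∀ {a b} → a ℤ.< b → ℤ→ℚ a ℚ.< ℤ→ℚ b
ℤ→ℚ-mono-< {a} {b} a<b = subst₂ ℚ._<_ (sym (ℤ→ℚ-fromℤ a)) (sym (ℤ→ℚ-fromℤ b))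
  (*<* (ℤ.*-monoʳ-<-pos (ℤ.+ 1) a<b))

-- Subsets and links

∷-injectiveʳ : ∀ {n b c} {σ ρ : Subset n} → b ∷ σ ≡ c ∷ ρ → σ ≡ ρ
∷-injectiveʳ refl = refl

∉-∪⁅⁆ : ∀ {n} {i j : Fin n} {σ} → i ∉ σ → i ≢ j → i ∉ σ ∪ ⁅ j ⁆
∉-∪⁅⁆ {j = j} {σ} i∉σ i≢j i∈ with x∈p∪q⁻ σ ⁅ j ⁆ i∈
... | inj₁ i∈σ = i∉σ i∈σ
... | inj₂ i∈j = i≢j (x∈⁅y⁆⇒x≡y j i∈j)

∣∪⁅⁆∣ : ∀ {n} (i : Fin n) (σ : Subset n) → i ∉ σ → ∣ σ ∪ ⁅ i ⁆ ∣ ≡ suc ∣ σ ∣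
∣∪⁅⁆∣ zero (outside ∷ σ) _ = cong (suc ∘ ∣_∣) (∪-identityʳ σ)
∣∪⁅⁆∣ zero (inside ∷ σ) i∉ = ⊥-elim (i∉ here)
∣∪⁅⁆∣ (suc i) (outside ∷ σ) i∉ = ∣∪⁅⁆∣ i σ (i∉ ∘ there)
∣∪⁅⁆∣ (suc i) (inside ∷ σ) i∉ = cong suc (∣∪⁅⁆∣ i σ (i∉ ∘ there))

x∈p∪⁅x⁆ : ∀ {n} {σ : Subset n} i → i ∈ σ ∪ ⁅ i ⁆
x∈p∪⁅x⁆ i = x∈p∪q⁺ (inj₂ (x∈⁅x⁆ i))

∪⁅⁆-cancel : ∀ {n} {σ τ : Subset n} {i} → i ∉ σ → i ∉ τ → σ ∪ ⁅ i ⁆ ≡ τ ∪ ⁅ i ⁆ → σ ≡ τ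
∪⁅⁆-cancel {n} {σ} {τ} {i} i∉σ i∉τ eq = ⊆-antisym (half i∉σ eq) (half i∉τ (sym eq))
  where
  half : ∀ {ρ π : Subset n} → i ∉ ρ → ρ ∪ ⁅ i ⁆ ≡ π ∪ ⁅ i ⁆ → ρ ⊆ π
  half {ρ} {π} i∉ρ eq {j} j∈ρ with x∈p∪q⁻ π ⁅ i ⁆ (subst (j ∈_) eq (x∈p∪q⁺ (inj₁ j∈ρ)))
  ... | inj₁ j∈π = j∈π
  ... | inj₂ j∈i = ⊥-elim (i∉ρ (subst (_∈ ρ) (x∈⁅y⁆⇒x≡y i j∈i) j∈ρ))

∉⇒≡⊥ : ∀ {n} {σ : Subset n} → (∀ {i} → i ∉ σ) → σ ≡ ⊥
∉⇒≡⊥ {σ = σ} ∉σ = ⊆-antisym (⊥-elim ∘ ∉σ) (⊆-min σ)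

module _ {N} (X : Complex N) (η : Edge X) where
  open Edge η
  private L = LinkEdge X η

  s∈η : s ∈ vertices
  s∈η = x∈p∪q⁺ (inj₁ (x∈⁅x⁆ s))

  t∈η : t ∈ vertices
  t∈η = x∈p∪q⁺ (inj₂ (x∈⁅x⁆ t))

  link-∌ : ∀ {σ i} → Face L σ → i ∈ vertices → i ∉ σ
  link-∌ (_ , _ , d) i∈η i∈σ = ∉⊥ (subst (_ ∈_) d (x∈p∩q⁺ (i∈η , i∈σ)))

  -- The left side is the form in which two applications of `∑-split` produce the union of σ with
  -- the edge.
  ∪st : ∀ σ → (σ ∪ ⁅ t ⁆) ∪ ⁅ s ⁆ ≡ vertices ∪ σ
  ∪st σ = ⊆-antisym to from
    where
    to : (σ ∪ ⁅ t ⁆) ∪ ⁅ s ⁆ ⊆ vertices ∪ σ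
    to i∈ with x∈p∪q⁻ (σ ∪ ⁅ t ⁆) ⁅ s ⁆ i∈
    ... | inj₂ i∈s = x∈p∪q⁺ (inj₁ (x∈p∪q⁺ (inj₁ i∈s)))
    ... | inj₁ i∈σt with x∈p∪q⁻ σ ⁅ t ⁆ i∈σt
    ...   | inj₁ i∈σ = x∈p∪q⁺ (inj₂ i∈σ)
    ...   | inj₂ i∈t = x∈p∪q⁺ (inj₁ (x∈p∪q⁺ (inj₂ i∈t)))
    from : vertices ∪ σ ⊆ (σ ∪ ⁅ t ⁆) ∪ ⁅ s ⁆
    from i∈ with x∈p∪q⁻ vertices σ i∈
    ... | inj₂ i∈σ = x∈p∪q⁺ (inj₁ (x∈p∪q⁺ (inj₁ i∈σ)))
    ... | inj₁ i∈η with x∈p∪q⁻ ⁅ s ⁆ ⁅ t ⁆ i∈η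
    ...   | inj₁ i∈s = x∈p∪q⁺ (inj₂ i∈s)
    ...   | inj₂ i∈t = x∈p∪q⁺ (inj₁ (x∈p∪q⁺ (inj₂ i∈t)))

  -- For σ avoiding both endpoints the three conditions of a link reduce to one: σ is a face by
  -- closure under subsets, and disjointness is the avoidance itself.
  link⁺ : ∀ {σ} → s ∉ σ → t ∉ σ → Face X ((σ ∪ ⁅ t ⁆) ∪ ⁅ s ⁆) → Face L σ
  link⁺ {σ} s∉ t∉ σst∈X =
    ⊆-face X (λ i∈σ → x∈p∪q⁺ (inj₁ (x∈p∪q⁺ (inj₁ i∈σ)))) σst∈X ,
    subst (Face X) (∪st σ) σst∈X ,
    ∉⇒≡⊥ disjoint
    where
    disjoint : ∀ {i} → i ∉ vertices ∩ σ
    disjoint i∈ with x∈p∩q⁻ vertices σ i∈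
    ... | i∈η , i∈σ with x∈p∪q⁻ ⁅ s ⁆ ⁅ t ⁆ i∈η
    ...   | inj₁ i∈s = s∉ (subst (_∈ σ) (x∈⁅y⁆⇒x≡y s i∈s) i∈σ)
    ...   | inj₂ i∈t = t∉ (subst (_∈ σ) (x∈⁅y⁆⇒x≡y t i∈t) i∈σ)

-- Commutative rings over ℤ, to be instantiated with ℚ and the Gaussian rationals

record ℤ-Algebra : Set₁ where
  infixl 6 _+_ _-_
  infixl 7 _*_
  infix  8 -_
  field
    Carrier : Set
    _+_ _*_ : Carrier → Carrier → Carrier
    -_      : Carrier → Carrier
    0# 1#   : Carrier
    isCommutativeRing : IsCommutativeRing _≡_ _+_ _*_ -_ 0# 1#
    ι       : ℤ → Carrier
    ι-+     : ∀ a b → ι (a ℤ.+ b) ≡ ι a + ι b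
    ι-*     : ∀ a b → ι (a ℤ.* b) ≡ ι a * ι b
    ι-neg   : ∀ a → ι (ℤ.- a) ≡ - ι a
    ι-0     : ι 0ℤ ≡ 0#
    ι-1     : ι 1ℤ ≡ 1#

  rawRing : RawRing 0ℓ 0ℓ
  rawRing = record { _≈_ = _≡_ ; _+_ = _+_ ; _*_ = _*_ ; -_ = -_ ; 0# = 0# ; 1# = 1# }

  open IsCommutativeRing isCommutativeRing public
    using (+-assoc; +-identityˡ; +-identityʳ; -‿inverseʳ; *-comm; *-identityˡ; zeroˡ; zeroʳ; distribˡ)
  open RawSemiringDefs (RawRing.rawSemiring rawRing) public using (_^_)
  open Evaluation rawRing ι public using (eval)

  _-_ : Carrier → Carrier → Carrier
  x - y = x + - y

-- The coefficients are integers interpreted by `ι`, so constants must appear as `ι a`. This is why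
-- `ι 0ℤ` and `ι 1ℤ` stand in place of `0#` and `1#` in the identities solved with it.
module ℤ-Solver (A : ℤ-Algebra) where
  open ℤ-Algebra A

  private
    almostCommutativeRing : ACR.AlmostCommutativeRing 0ℓ 0ℓ
    almostCommutativeRing = ACR.fromCommutativeRing record { isCommutativeRing = isCommutativeRing }

    morphism : ℤ.+-*-rawRing ACR.-Raw-AlmostCommutative⟶ almostCommutativeRing
    morphism = record
      { ⟦_⟧ = ι ; +-homo = ι-+ ; *-homo = ι-* ; -‿homo = ι-neg ; 0-homo = ι-0 ; 1-homo = ι-1 }

  open RingSolver ℤ.+-*-rawRing almostCommutativeRing morphism
    (λ a b → Maybe.map (cong ι) (dec⇒maybe (a ℤ.≟ b))) public
    using (Polynomial; solve; con; _:+_; _:*_; _:-_; :-_; _:=_)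

module FPolynomials (A : ℤ-Algebra) where
  open ℤ-Algebra A

  -- Sums over all subsets

  ∑ : ∀ {n} → (Subset n → Carrier) → Carrier
  ∑ {zero}  g = g []
  ∑ {suc n} g = ∑ (g ∘ (outside ∷_)) + ∑ (g ∘ (inside ∷_))

  ∑-cong : ∀ {n} {f g : Subset n → Carrier} → (∀ σ → f σ ≡ g σ) → ∑ f ≡ ∑ g
  ∑-cong {zero}  f≗g = f≗g []
  ∑-cong {suc n} f≗g = cong₂ _+_ (∑-cong (f≗g ∘ (outside ∷_))) (∑-cong (f≗g ∘ (inside ∷_)))

  interchange : ∀ a b c d → (a + b) + (c + d) ≡ (a + c) + (b + d)
  interchange = solve 4 (λ a b c d → (a :+ b) :+ (c :+ d) := (a :+ c) :+ (b :+ d)) refl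
    where open ℤ-Solver A

  ∑-+ : ∀ {n} (f g : Subset n → Carrier) → ∑ (λ σ → f σ + g σ) ≡ ∑ f + ∑ g
  ∑-+ {zero}  f g = refl
  ∑-+ {suc n} f g = trans (cong₂ _+_ (∑-+ {n} _ _) (∑-+ {n} _ _)) (interchange _ _ _ _)

  ∑-*ˡ : ∀ {n} c (g : Subset n → Carrier) → ∑ (λ σ → c * g σ) ≡ c * ∑ g
  ∑-*ˡ {zero}  c g = refl
  ∑-*ˡ {suc n} c g = trans (cong₂ _+_ (∑-*ˡ {n} c _) (∑-*ˡ {n} c _)) (sym (distribˡ c _ _))

  ∑-zero : ∀ {n} {g : Subset n → Carrier} → (∀ σ → g σ ≡ 0#) → ∑ g ≡ 0#
  ∑-zero {zero}  g≗0 = g≗0 []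
  ∑-zero {suc n} g≗0 = trans (cong₂ _+_ (∑-zero (g≗0 ∘ (outside ∷_))) (∑-zero (g≗0 ∘ (inside ∷_)))) (+-identityˡ 0#)

  ∑-swap : ∀ {m n} (g : Subset m → Subset n → Carrier) →
           ∑ (λ σ → ∑ (g σ)) ≡ ∑ (λ τ → ∑ (λ σ → g σ τ))
  ∑-swap {zero}  g = refl
  ∑-swap {suc m} {n} g = trans (cong₂ _+_ (∑-swap {m} {n} _) (∑-swap {m} {n} _)) (sym (∑-+ {n} _ _))

  -- Valued in images of ℤ so that indicators known to be 0 or 1 are constants for the solver.
  χ : Bool → Carrier
  χ true  = ι 1ℤ
  χ false = ι 0ℤ

  ι0-* : ∀ x → ι 0ℤ * x ≡ 0#
  ι0-* x = trans (cong (_* x) ι-0) (zeroˡ x)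

  ι1-* : ∀ x → ι 1ℤ * x ≡ x
  ι1-* x = trans (cong (_* x) ι-1) (*-identityˡ x)

  χ-yes : ∀ {P : Set} (P? : Dec P) → P → χ (does P?) ≡ ι 1ℤ
  χ-yes P? p = cong χ (dec-true P? p)

  χ-no : ∀ {P : Set} (P? : Dec P) → ¬ P → χ (does P?) ≡ ι 0ℤ
  χ-no P? ¬p = cong χ (dec-false P? ¬p)

  χ-⇔ : ∀ {P Q : Set} (P? : Dec P) (Q? : Dec Q) → (P → Q) → (Q → P) → χ (does P?) ≡ χ (does Q?)
  χ-⇔ P? Q? to from = cong χ (does-⇔ (mk⇔ to from) P? Q?)

  χ-no-* : ∀ {P : Set} (P? : Dec P) x → ¬ P → χ (does P?) * x ≡ 0#
  χ-no-* P? x ¬p = trans (cong (_* x) (χ-no P? ¬p)) (ι0-* x)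

  ∑-δ : ∀ {n} (ρ : Subset n) (g : Subset n → Carrier) → ∑ (λ σ → χ (does (σ ≟ˢ ρ)) * g σ) ≡ g ρ
  ∑-δ [] g = ι1-* _
  ∑-δ (outside ∷ ρ) g = trans
    (cong₂ _+_
      (trans (∑-cong λ σ → cong (_* g (outside ∷ σ)) (χ-⇔ ((outside ∷ σ) ≟ˢ (outside ∷ ρ)) (σ ≟ˢ ρ) ∷-injectiveʳ (cong (outside ∷_))))
             (∑-δ ρ (g ∘ (outside ∷_))))
      (∑-zero λ σ → χ-no-* ((inside ∷ σ) ≟ˢ (outside ∷ ρ)) _ λ ()))
    (+-identityʳ _)
  ∑-δ (inside ∷ ρ) g = trans
    (cong₂ _+_
      (∑-zero λ σ → χ-no-* ((outside ∷ σ) ≟ˢ (inside ∷ ρ)) _ λ ())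
      (trans (∑-cong λ σ → cong (_* g (inside ∷ σ)) (χ-⇔ ((inside ∷ σ) ≟ˢ (inside ∷ ρ)) (σ ≟ˢ ρ) ∷-injectiveʳ (cong (inside ∷_))))
             (∑-δ ρ (g ∘ (inside ∷_)))))
    (+-identityˡ _)

  -- Pairs σ with σ ∪ {i}, where i ∉ σ.
  ∑-split : ∀ {n} (i : Fin n) (g : Subset n → Carrier) →
            ∑ g ≡ ∑ (λ σ → χ (not (does (i ∈? σ))) * (g σ + g (σ ∪ ⁅ i ⁆)))
  ∑-split {suc n} zero g = sym (trans
    (cong₂ _+_
      (∑-cong λ σ → trans (ι1-* _)
        (cong (λ ρ → g (outside ∷ σ) + g (inside ∷ ρ)) (∪-identityʳ σ)))
      (∑-zero {n} λ σ → ι0-* _))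
    (trans (+-identityʳ _) (∑-+ {n} _ _)))
  ∑-split {suc n} (suc i) g = cong₂ _+_
    (trans (∑-split i _) (∑-cong λ σ → cong (_* (g (outside ∷ σ) + g (outside ∷ (σ ∪ ⁅ i ⁆))))
      (cong (χ ∘ not) (does-⇔ (mk⇔ there drop-there) (i ∈? σ) (suc i ∈? (outside ∷ σ))))))
    (trans (∑-split i _) (∑-cong λ σ → cong (_* (g (inside ∷ σ) + g (inside ∷ (σ ∪ ⁅ i ⁆))))
      (cong (χ ∘ not) (does-⇔ (mk⇔ there drop-there) (i ∈? σ) (suc i ∈? (inside ∷ σ))))))

  -- It suffices to compare the sums on each block of four sets that agree outside s and t.
  -- Subdivision of the edge {s, t} changes the faces only within such blocks.
  ∑-split₂-cong : ∀ {n} {s t : Fin n} → s ≢ t → (f g : Subset n → Carrier) →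
    (∀ σ → s ∉ σ → t ∉ σ →
      (f σ + f (σ ∪ ⁅ s ⁆)) + (f (σ ∪ ⁅ t ⁆) + f ((σ ∪ ⁅ t ⁆) ∪ ⁅ s ⁆)) ≡
      (g σ + g (σ ∪ ⁅ s ⁆)) + (g (σ ∪ ⁅ t ⁆) + g ((σ ∪ ⁅ t ⁆) ∪ ⁅ s ⁆))) →
    ∑ f ≡ ∑ g
  ∑-split₂-cong {s = s} {t} s≢t f g eq =
    trans (trans (∑-split s f) (∑-split t _)) (trans (∑-cong pointwise)
      (sym (trans (∑-split s g) (∑-split t _))))
    where
    half : (Subset _ → Carrier) → Subset _ → Carrier
    half k σ = χ (not (does (s ∈? σ))) * (k σ + k (σ ∪ ⁅ s ⁆))
    pointwise : ∀ σ → χ (not (does (t ∈? σ))) * (half f σ + half f (σ ∪ ⁅ t ⁆)) ≡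
                      χ (not (does (t ∈? σ))) * (half g σ + half g (σ ∪ ⁅ t ⁆))
    pointwise σ with t ∈? σ
    ... | yes _ = trans (ι0-* _) (sym (ι0-* _))
    ... | no t∉ = cong (ι 1ℤ *_) inner
      where
      inner : half f σ + half f (σ ∪ ⁅ t ⁆) ≡ half g σ + half g (σ ∪ ⁅ t ⁆)
      inner with s ∈? σ
      ... | yes s∈ rewrite dec-true (s ∈? (σ ∪ ⁅ t ⁆)) (p⊆p∪q ⁅ t ⁆ s∈) = cong₂ _+_
        (trans (ι0-* _) (sym (ι0-* _))) (trans (ι0-* _) (sym (ι0-* _)))
      ... | no s∉ rewrite dec-false (s ∈? (σ ∪ ⁅ t ⁆)) (∉-∪⁅⁆ s∉ s≢t) =
        trans (cong₂ _+_ (ι1-* _) (ι1-* _))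
          (trans (eq σ s∉ t∉) (sym (cong₂ _+_ (ι1-* _) (ι1-* _))))

  -- f-polynomials

  fTerm : ∀ {N} → Complex N → Carrier → Subset N → Carrier
  fTerm X x σ = χ (does (face? X σ)) * x ^ ∣ σ ∣

  f : ∀ {N} → Complex N → Carrier → Carrier
  f X x = ∑ (fTerm X x)

  eval-+ᴾ : ∀ p q x → eval (p +ᴾ q) x ≡ eval p x + eval q x
  eval-+ᴾ [] q x = sym (+-identityˡ _)
  eval-+ᴾ (a ∷ p) [] x = sym (+-identityʳ _)
  eval-+ᴾ (a ∷ p) (b ∷ q) x = trans
    (cong₂ (λ c r → c + x * r) (ι-+ a b) (eval-+ᴾ p q x))
    (distrib _ _ _ _ _)
    where
    open ℤ-Solver A
    distrib : ∀ a b x r s → (a + b) + x * (r + s) ≡ (a + x * r) + (b + x * s)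
    distrib = solve 5 (λ a b x r s → (a :+ b) :+ x :* (r :+ s) := (a :+ x :* r) :+ (b :+ x :* s)) refl

  eval-t^ : ∀ n x → eval (t^ n) x ≡ x ^ n
  eval-t^ zero x = trans (cong₂ _+_ ι-1 (zeroʳ x)) (+-identityʳ 1#)
  eval-t^ (suc n) x = trans (trans (cong (_+ x * eval (t^ n) x) ι-0) (+-identityˡ _)) (cong (x *_) (eval-t^ n x))

  ∑ᴸ : ∀ {n} → (Subset n → Carrier) → List (Subset n) → Carrier
  ∑ᴸ g = foldr (λ σ r → g σ + r) 0#

  ∑ᴸ-++ : ∀ {n} (g : Subset n → Carrier) k l → ∑ᴸ g (k ++ l) ≡ ∑ᴸ g k + ∑ᴸ g l
  ∑ᴸ-++ g []      l = sym (+-identityˡ _)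
  ∑ᴸ-++ g (σ ∷ k) l = trans (cong (g σ +_) (∑ᴸ-++ g k l)) (sym (+-assoc (g σ) _ _))

  ∑ᴸ-map : ∀ {m n} (g : Subset n → Carrier) (e : Subset m → Subset n) l → ∑ᴸ g (map e l) ≡ ∑ᴸ (g ∘ e) l
  ∑ᴸ-map g e []      = refl
  ∑ᴸ-map g e (σ ∷ l) = cong (g (e σ) +_) (∑ᴸ-map g e l)

  ∑ᴸ-subsets : ∀ n (g : Subset n → Carrier) → ∑ᴸ g (subsets n) ≡ ∑ g
  ∑ᴸ-subsets zero    g = +-identityʳ _
  ∑ᴸ-subsets (suc n) g = trans (∑ᴸ-++ g (map (outside ∷_) (subsets n)) _)
    (cong₂ _+_ (trans (∑ᴸ-map g _ (subsets n)) (∑ᴸ-subsets n _))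
               (trans (∑ᴸ-map g _ (subsets n)) (∑ᴸ-subsets n _)))

  eval-fPoly : ∀ {N} (X : Complex N) x → eval (fPoly X) x ≡ f X x
  eval-fPoly {N} X x = trans (go (subsets N)) (∑ᴸ-subsets N (fTerm X x))
    where
    go : ∀ l → eval (foldr (λ σ p → t^ ∣ σ ∣ +ᴾ p) [] (filter (face? X) l)) x ≡ ∑ᴸ (fTerm X x) l
    go [] = refl
    go (σ ∷ l) with does (face? X σ)
    ... | true  = trans (eval-+ᴾ (t^ ∣ σ ∣) _ x)
      (cong₂ _+_ (trans (eval-t^ ∣ σ ∣ x) (sym (ι1-* _))) (go l))
    ... | false = trans (go l) (sym (trans (cong (_+ ∑ᴸ (fTerm X x) l) (ι0-* (x ^ ∣ σ ∣))) (+-identityˡ _)))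

  module _ {N} (X : Complex N) (η : Edge X) where
    open Edge η
    private L = LinkEdge X η

    -- Let σ avoid s and t, and let e be the new vertex. If σ lies in the link, the subdivision
    -- removes σ ∪ {s, t} and adds σ ∪ {e}, σ ∪ {s, e}, σ ∪ {t, e}; otherwise it changes nothing in
    -- this block. The net change is x ^ ∣ σ ∣ times -x² + x + 2x².
    f-Sub : ∀ x → f (Sub X η) x ≡ f X x + (x + x * x) * f L x
    -- By definition a sum over `Subset (suc N)` is the sum over sets without the new vertex plus
    -- the sum over sets with it; `k` merges the two.
    f-Sub x = trans (sym (∑-+ {N} _ _)) (trans
      (∑-split₂-cong s≢t _ _ Pointwise.eq)
      (trans (∑-+ {N} (fTerm X x) _) (cong (f X x +_) (∑-*ˡ (x + x * x) (fTerm L x)))))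
      where
      open ℤ-Solver A
      -- The comparison on one block: P is x ^ ∣ σ ∣, while a, b, c are the indicators in X of σ, σ
      -- ∪ {s}, σ ∪ {t}, and l is that of σ in the link. The indicator of σ ∪ {s, t} in X is again
      -- l.
      collect : ∀ a b c l x P →
        ((a * P + l * (x * P)) + (b * (x * P) + l * (x * (x * P)))) +
        ((c * (x * P) + l * (x * (x * P))) + (ι 0ℤ * (x * (x * P)) + ι 0ℤ * (x * (x * (x * P))))) ≡
        ((a * P + (x + x * x) * (l * P)) + (b * (x * P) + (x + x * x) * (ι 0ℤ * (x * P)))) +
        ((c * (x * P) + (x + x * x) * (ι 0ℤ * (x * P))) + (l * (x * (x * P)) + (x + x * x) * (ι 0ℤ * (x * (x * P)))))
      collect = solve 6 (λ a b c l x P →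
        ((a :* P :+ l :* (x :* P)) :+ (b :* (x :* P) :+ l :* (x :* (x :* P)))) :+
        ((c :* (x :* P) :+ l :* (x :* (x :* P))) :+ (con 0ℤ :* (x :* (x :* P)) :+ con 0ℤ :* (x :* (x :* (x :* P))))) :=
        ((a :* P :+ (x :+ x :* x) :* (l :* P)) :+ (b :* (x :* P) :+ (x :+ x :* x) :* (con 0ℤ :* (x :* P)))) :+
        ((c :* (x :* P) :+ (x :+ x :* x) :* (con 0ℤ :* (x :* P))) :+ (l :* (x :* (x :* P)) :+ (x :+ x :* x) :* (con 0ℤ :* (x :* (x :* P)))))) refl

      k : Subset N → Carrier
      k σ = fTerm (Sub X η) x (outside ∷ σ) + fTerm (Sub X η) x (inside ∷ σ)
      k′ : Subset N → Carrier
      k′ σ = fTerm X x σ + (x + x * x) * fTerm L x σ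

      module Pointwise (σ : Subset N) (s∉ : s ∉ σ) (t∉ : t ∉ σ) where
        outer : ∀ ρ → ¬ vertices ⊆ ρ → χ (does (face? (Sub X η) (outside ∷ ρ))) ≡ χ (does (face? X ρ))
        outer ρ η⊈ = χ-⇔ (face? (Sub X η) (outside ∷ ρ)) (face? X ρ) proj₁ (_, η⊈)
        inner : ∀ ρ → (Face L σ → SubFace X η (inside ∷ ρ)) → (SubFace X η (inside ∷ ρ) → Face L σ) →
                χ (does (face? (Sub X η) (inside ∷ ρ))) ≡ χ (does (face? L σ))
        inner ρ to from = χ-⇔ (face? (Sub X η) (inside ∷ ρ)) (face? L σ) from to
        inj-∅ : Face L σ → SubFace X η (inside ∷ σ)
        inj-∅ l = σ , l , inj₁ refl
        case∅ : SubFace X η (inside ∷ σ) → Face L σ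
        case∅ (τ , l , inj₁ refl) = l
        case∅ (τ , l , inj₂ (inj₁ refl)) = ⊥-elim (s∉ (x∈p∪⁅x⁆ s))
        case∅ (τ , l , inj₂ (inj₂ refl)) = ⊥-elim (t∉ (x∈p∪⁅x⁆ t))
        cases : SubFace X η (inside ∷ (σ ∪ ⁅ s ⁆)) → Face L σ
        cases (τ , l , inj₁ eq) = ⊥-elim (link-∌ X η l (s∈η X η) (subst (s ∈_) eq (x∈p∪⁅x⁆ s)))
        cases (τ , l , inj₂ (inj₁ eq)) = subst (Face L) (∪⁅⁆-cancel (link-∌ X η l (s∈η X η)) s∉ (sym eq)) l
        cases (τ , l , inj₂ (inj₂ eq)) = ⊥-elim (∉-∪⁅⁆ (link-∌ X η l (s∈η X η)) s≢t (subst (s ∈_) eq (x∈p∪⁅x⁆ s)))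
        caset : SubFace X η (inside ∷ (σ ∪ ⁅ t ⁆)) → Face L σ
        caset (τ , l , inj₁ eq) = ⊥-elim (link-∌ X η l (t∈η X η) (subst (t ∈_) eq (x∈p∪⁅x⁆ t)))
        caset (τ , l , inj₂ (inj₁ eq)) = ⊥-elim (∉-∪⁅⁆ (link-∌ X η l (t∈η X η)) (s≢t ∘ sym) (subst (t ∈_) eq (x∈p∪⁅x⁆ t)))
        caset (τ , l , inj₂ (inj₂ eq)) = subst (Face L) (∪⁅⁆-cancel (link-∌ X η l (t∈η X η)) t∉ (sym eq)) l
        s∈st : s ∈ (σ ∪ ⁅ t ⁆) ∪ ⁅ s ⁆
        s∈st = x∈p∪⁅x⁆ s
        t∈st : t ∈ (σ ∪ ⁅ t ⁆) ∪ ⁅ s ⁆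
        t∈st = x∈p∪q⁺ (inj₁ (x∈p∪⁅x⁆ t))
        casest : ¬ SubFace X η (inside ∷ ((σ ∪ ⁅ t ⁆) ∪ ⁅ s ⁆))
        casest (τ , l , inj₁ eq) = link-∌ X η l (s∈η X η) (subst (s ∈_) eq s∈st)
        casest (τ , l , inj₂ (inj₁ eq)) = ∉-∪⁅⁆ (link-∌ X η l (t∈η X η)) (s≢t ∘ sym) (subst (t ∈_) eq t∈st)
        casest (τ , l , inj₂ (inj₂ eq)) = ∉-∪⁅⁆ (link-∌ X η l (s∈η X η)) s≢t (subst (s ∈_) eq s∈st)
        eq :
          (k σ + k (σ ∪ ⁅ s ⁆)) + (k (σ ∪ ⁅ t ⁆) + k ((σ ∪ ⁅ t ⁆) ∪ ⁅ s ⁆)) ≡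
          (k′ σ + k′ (σ ∪ ⁅ s ⁆)) + (k′ (σ ∪ ⁅ t ⁆) + k′ ((σ ∪ ⁅ t ⁆) ∪ ⁅ s ⁆))
        eq
          rewrite ∣∪⁅⁆∣ s (σ ∪ ⁅ t ⁆) (∉-∪⁅⁆ s∉ s≢t) | ∣∪⁅⁆∣ s σ s∉ | ∣∪⁅⁆∣ t σ t∉
                | outer σ (λ η⊆ → s∉ (η⊆ (s∈η X η)))
                | outer (σ ∪ ⁅ s ⁆) (λ η⊆ → ∉-∪⁅⁆ t∉ (s≢t ∘ sym) (η⊆ (t∈η X η)))
                | outer (σ ∪ ⁅ t ⁆) (λ η⊆ → ∉-∪⁅⁆ s∉ s≢t (η⊆ (s∈η X η)))
                | χ-no (face? (Sub X η) (outside ∷ ((σ ∪ ⁅ t ⁆) ∪ ⁅ s ⁆)))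
                    (λ { (_ , η⊈) → η⊈ λ i∈η → subst (_ ∈_) (sym (∪st X η σ)) (x∈p∪q⁺ (inj₁ i∈η)) })
                | inner σ inj-∅ (λ τ∈ → case∅ τ∈)
                | inner (σ ∪ ⁅ s ⁆) (λ l → σ , l , inj₂ (inj₁ refl)) (λ τ∈ → cases τ∈)
                | inner (σ ∪ ⁅ t ⁆) (λ l → σ , l , inj₂ (inj₂ refl)) (λ τ∈ → caset τ∈)
                | χ-no (face? (Sub X η) (inside ∷ ((σ ∪ ⁅ t ⁆) ∪ ⁅ s ⁆))) casest
                | χ-no (face? L (σ ∪ ⁅ s ⁆)) (λ l → link-∌ X η l (s∈η X η) (x∈p∪⁅x⁆ s))
                | χ-no (face? L (σ ∪ ⁅ t ⁆)) (λ l → link-∌ X η l (t∈η X η) (x∈p∪⁅x⁆ t))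
                | χ-no (face? L ((σ ∪ ⁅ t ⁆) ∪ ⁅ s ⁆)) (λ l → link-∌ X η l (s∈η X η) (x∈p∪⁅x⁆ s))
                | χ-⇔ (face? X ((σ ∪ ⁅ t ⁆) ∪ ⁅ s ⁆)) (face? L σ) (link⁺ X η s∉ t∉) (λ { (_ , g , _) → subst (Face X) (sym (∪st X η σ)) g })
          = collect _ _ _ _ x _

-- A face of the subdivision that contains the new vertex and an endpoint of η consists, apart from
-- these two, of a face of the old link. Faces containing the new vertex cannot lie in the new link,
-- so this accounts for all of it.
Link-nextEdge : ∀ {N} (X : Complex N) (η : Edge X) c (σ : Subset N) →
  Face (LinkEdge (Sub X η) (nextEdge X η c)) (outside ∷ σ) ⇔ Face (LinkEdge X η) σ
Link-nextEdge X η c σ = mk⇔ (to c) (from c)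
  where
  open Edge η
  L = LinkEdge X η

  L′ : Endpoint → Complex _
  L′ c = LinkEdge (Sub X η) (nextEdge X η c)

  v∪ : ∀ v → (⊥ ∪ ⁅ v ⁆) ∪ σ ≡ σ ∪ ⁅ v ⁆
  v∪ v = trans (cong (_∪ σ) (∪-identityˡ ⁅ v ⁆)) (∪-comm ⁅ v ⁆ σ)

  ∉σ : ∀ c → Face (L′ c) (outside ∷ σ) → endpoint X η c ∉ σ
  ∉σ c l v∈σ = link-∌ (Sub X η) (nextEdge X η c) l (t∈η (Sub X η) (nextEdge X η c)) (there v∈σ)

  to : ∀ c → Face (L′ c) (outside ∷ σ) → Face L σ
  to at-s l@(_ , (τ , k , e) , _) with e
  ... | inj₁ eq = ⊥-elim (link-∌ X η k (s∈η X η) (subst (s ∈_) (trans (sym (v∪ s)) eq) (x∈p∪⁅x⁆ s)))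
  ... | inj₂ (inj₁ eq) = subst (Face L) (sym (∪⁅⁆-cancel (∉σ at-s l) (link-∌ X η k (s∈η X η)) (trans (sym (v∪ s)) eq))) k
  ... | inj₂ (inj₂ eq) = ⊥-elim (∉-∪⁅⁆ (link-∌ X η k (s∈η X η)) s≢t (subst (s ∈_) (trans (sym (v∪ s)) eq) (x∈p∪⁅x⁆ s)))
  to at-t l@(_ , (τ , k , e) , _) with e
  ... | inj₁ eq = ⊥-elim (link-∌ X η k (t∈η X η) (subst (t ∈_) (trans (sym (v∪ t)) eq) (x∈p∪⁅x⁆ t)))
  ... | inj₂ (inj₁ eq) = ⊥-elim (∉-∪⁅⁆ (link-∌ X η k (t∈η X η)) (s≢t ∘ sym) (subst (t ∈_) (trans (sym (v∪ t)) eq) (x∈p∪⁅x⁆ t)))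
  ... | inj₂ (inj₂ eq) = subst (Face L) (sym (∪⁅⁆-cancel (∉σ at-t l) (link-∌ X η k (t∈η X η)) (trans (sym (v∪ t)) eq))) k

  disjoint : ∀ v → v ∉ σ → ∀ {i} → i ∉ (⁅ zero ⁆ ∪ ⁅ suc v ⁆) ∩ (outside ∷ σ)
  disjoint v v∉σ {suc i} (there i∈) with x∈p∩q⁻ (⊥ ∪ ⁅ v ⁆) σ i∈
  ... | i∈v , i∈σ = v∉σ (subst (_∈ σ) (x∈⁅y⁆⇒x≡y v (subst (i ∈_) (∪-identityˡ ⁅ v ⁆) i∈v)) i∈σ)

  from : ∀ c → Face L σ → Face (L′ c) (outside ∷ σ)
  from at-s l = (proj₁ l , λ η⊆ → link-∌ X η l (s∈η X η) (η⊆ (s∈η X η))) ,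
    (σ , l , inj₂ (inj₁ (v∪ s))) , ∉⇒≡⊥ (disjoint s (link-∌ X η l (s∈η X η)))
  from at-t l = (proj₁ l , λ η⊆ → link-∌ X η l (s∈η X η) (η⊆ (s∈η X η))) ,
    (σ , l , inj₂ (inj₂ (v∪ t))) , ∉⇒≡⊥ (disjoint t (link-∌ X η l (t∈η X η)))

-- Renaming of vertices

image-∈⁺ : ∀ {m n} (e : Fin m → Fin n) {τ j} → j ∈ τ → e j ∈ image e τ
image-∈⁺ e {τ} {j} j∈τ = lookup⇒[]= (e j) _ (trans (lookup∘tabulate _ (e j))
  (dec-true (Fin.any? λ k → (k ∈? τ) ×-dec (e k Fin.≟ e j)) (j , j∈τ , refl)))

image-∈⁻ : ∀ {m n} (e : Fin m → Fin n) {τ i} → i ∈ image e τ → ∃ λ j → j ∈ τ × e j ≡ i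
image-∈⁻ e {τ} {i} i∈ with Fin.any? (λ k → (k ∈? τ) ×-dec (e k Fin.≟ i))
  | trans (sym (lookup∘tabulate (λ i → does (Fin.any? λ k → (k ∈? τ) ×-dec (e k Fin.≟ i))) i)) ([]=⇒lookup i∈)
... | yes found | _ = found
... | no  _     | ()

module _ {m n} {e : Fin m → Fin n} (inj : Injective _≡_ _≡_ e) where

  image-∈⁻′ : ∀ {τ j} → e j ∈ image e τ → j ∈ τ
  image-∈⁻′ {τ} i∈ with image-∈⁻ e i∈
  ... | k , k∈τ , ek≡ej = subst (_∈ τ) (inj ek≡ej) k∈τ

  image-injective : ∀ {σ τ} → image e σ ≡ image e τ → σ ≡ τ
  image-injective eq = ⊆-antisym
    (λ j∈σ → image-∈⁻′ (subst (_ ∈_) eq (image-∈⁺ e j∈σ)))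
    (λ j∈τ → image-∈⁻′ (subst (_ ∈_) (sym eq) (image-∈⁺ e j∈τ)))

∣image∣ : ∀ {m n} {e : Fin m → Fin n} → Injective _≡_ _≡_ e → ∀ τ → ∣ image e τ ∣ ≡ ∣ τ ∣
∣image∣ {n = n} {e} inj [] = trans
  (cong ∣_∣ (∉⇒≡⊥ {σ = image e []} λ i∈ → case image-∈⁻ e {[]} i∈ of λ ()))
  (∣⊥∣≡0 n)
∣image∣ {e = e} inj (outside ∷ τ) = trans (cong ∣_∣ (⊆-antisym to from)) (∣image∣ (Fin.suc-injective ∘ inj) τ)
  where
  to : image e (outside ∷ τ) ⊆ image (e ∘ suc) τ
  to i∈ with image-∈⁻ e {outside ∷ τ} i∈
  ... | suc j , there j∈τ , refl = image-∈⁺ (e ∘ suc) j∈τ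
  from : image (e ∘ suc) τ ⊆ image e (outside ∷ τ)
  from i∈ with image-∈⁻ (e ∘ suc) {τ} i∈
  ... | j , j∈τ , refl = image-∈⁺ e {outside ∷ τ} (there j∈τ)
∣image∣ {e = e} inj (inside ∷ τ) = trans (cong ∣_∣ (⊆-antisym to from))
  (trans (∣∪⁅⁆∣ (e zero) (image (e ∘ suc) τ) e0∉) (cong suc (∣image∣ (Fin.suc-injective ∘ inj) τ)))
  where
  e0∉ : e zero ∉ image (e ∘ suc) τ
  e0∉ e0∈ with image-∈⁻ (e ∘ suc) {τ} e0∈
  ... | j , _ , eq with inj eq
  ...   | ()
  to : image e (inside ∷ τ) ⊆ image (e ∘ suc) τ ∪ ⁅ e zero ⁆
  to i∈ with image-∈⁻ e {inside ∷ τ} i∈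
  ... | zero , _ , refl = x∈p∪⁅x⁆ (e zero)
  ... | suc j , there j∈τ , refl = x∈p∪q⁺ (inj₁ (image-∈⁺ (e ∘ suc) j∈τ))
  from : image (e ∘ suc) τ ∪ ⁅ e zero ⁆ ⊆ image e (inside ∷ τ)
  from i∈ with x∈p∪q⁻ (image (e ∘ suc) τ) ⁅ e zero ⁆ i∈
  ... | inj₂ i∈0 = subst (_∈ image e (inside ∷ τ)) (sym (x∈⁅y⁆⇒x≡y (e zero) i∈0)) (image-∈⁺ e {inside ∷ τ} here)
  ... | inj₁ i∈e with image-∈⁻ (e ∘ suc) {τ} i∈e
  ...   | j , j∈τ , refl = image-∈⁺ e {inside ∷ τ} (there j∈τ)

joinPower-facet : ∀ r → ∃ λ τ → Face (joinPower r) τ × ∣ τ ∣ ≡ r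
joinPower-facet zero = [] , refl , refl
joinPower-facet (suc r) with joinPower-facet r
... | τ , τ∈ , size = inside ∷ outside ∷ τ , ((λ ()) , τ∈) , cong suc size

-- A cross-polytope of dimension k contributes a face of X with k + 3 vertices.
link-dimension : ∀ {N} (X : Complex N) d → HasDimension X d → (η : Edge X) → ∀ k →
  LinkEdge X η IsCopyOf crossPolytope k → 3 ℕ.+ k ℕ.≤ suc d
link-dimension X d (bound , _) η k copy with joinPower-facet (suc k)
... | τ , τ∈ , size = subst (ℕ._≤ suc d) card
  (bound _ (subst (Face X) (sym (∪st X η σ)) (proj₁ (proj₂ l))))
  where
  open _IsCopyOf_ copy
  open Edge η
  σ = image rename τ
  l : Face (LinkEdge X η) σ
  l = Equivalence.from (faces σ) (τ , τ∈ , refl)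
  card : ∣ (σ ∪ ⁅ t ⁆) ∪ ⁅ s ⁆ ∣ ≡ 3 ℕ.+ k
  card = trans (∣∪⁅⁆∣ s (σ ∪ ⁅ t ⁆) (∉-∪⁅⁆ (link-∌ X η l (s∈η X η)) s≢t))
    (cong suc (trans (∣∪⁅⁆∣ t σ (link-∌ X η l (t∈η X η)))
      (cong suc (trans (∣image∣ injective τ) size))))

-- f-polynomials of iterated subdivisions, copies and cross-polytopes

module Subdivisions (A : ℤ-Algebra) where
  open ℤ-Algebra A
  open FPolynomials A

  f-nextEdge : ∀ {N} (X : Complex N) (η : Edge X) c x →
    f (LinkEdge (Sub X η) (nextEdge X η c)) x ≡ f (LinkEdge X η) x
  f-nextEdge {N} X η c x = trans
    (cong₂ _+_
      (∑-cong {N} λ σ → cong (_* x ^ ∣ σ ∣)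
        (χ-⇔ (face? L′ (outside ∷ σ)) (face? (LinkEdge X η) σ)
          (Equivalence.to (Link-nextEdge X η c σ)) (Equivalence.from (Link-nextEdge X η c σ))))
      (∑-zero {N} λ σ → χ-no-* (face? L′ (inside ∷ σ)) _
        λ l → link-∌ (Sub X η) (nextEdge X η c) l (s∈η (Sub X η) (nextEdge X η c)) here))
    (+-identityʳ _)
    where L′ = LinkEdge (Sub X η) (nextEdge X η c)

  -- Both equalities go through one induction: the increment is the same at every step because the
  -- link of the current edge keeps its f-polynomial.
  f-iterateSub : ∀ {N} (X : Complex N) (η : Edge X) c m x →
    let Y , ζ = iterateSub X η c m in
    f (LinkEdge Y ζ) x ≡ f (LinkEdge X η) x ×
    f Y x ≡ f X x + ι (ℤ.+ m) * ((x + x * x) * f (LinkEdge X η) x)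
  f-iterateSub X η c zero x = refl , sym (trans (cong (f X x +_) (ι0-* _)) (+-identityʳ _))
  f-iterateSub X η c (suc m) x with iterateSub X η c m | f-iterateSub X η c m x
  ... | Y , ζ | fL , fY = trans (f-nextEdge Y ζ (c m) x) fL , (begin
    f (Sub Y ζ) x                                    ≡⟨ f-Sub Y ζ x ⟩
    f Y x + (x + x * x) * f (LinkEdge Y ζ) x         ≡⟨ cong₂ (λ y l → y + (x + x * x) * l) fY fL ⟩
    f X x + ι (ℤ.+ m) * b + b                        ≡⟨ collect _ _ _ ⟩
    f X x + (ι 1ℤ + ι (ℤ.+ m)) * b                   ≡⟨ cong (λ k → f X x + k * b) (ι-+ 1ℤ (ℤ.+ m)) ⟨
    f X x + ι (ℤ.+ suc m) * b                        ∎)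
    where
    open ≡-Reasoning
    open ℤ-Solver A
    b = (x + x * x) * f (LinkEdge X η) x
    collect : ∀ a k b → a + k * b + b ≡ a + (ι 1ℤ + k) * b
    collect = solve 3 (λ a k b → a :+ k :* b :+ b := a :+ (con 1ℤ :+ k) :* b) refl

  -- Double counting of the pairs (σ, τ) with σ the image of the face τ; renaming along an injection
  -- preserves the number of vertices.
  f-copy : ∀ {m n} {X : Complex m} {Y : Complex n} → X IsCopyOf Y → ∀ x → f X x ≡ f Y x
  f-copy {m} {n} {X} {Y} copy x = begin
    ∑ (fTerm X x)
      ≡⟨ ∑-cong (λ σ → trans (cong (_* x ^ ∣ σ ∣) (fibre σ)) (trans (*-comm _ _) (sym (∑-*ˡ (x ^ ∣ σ ∣) (g σ))))) ⟩
    ∑ (λ σ → ∑ λ τ → x ^ ∣ σ ∣ * g σ τ)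
      ≡⟨ ∑-swap (λ σ τ → x ^ ∣ σ ∣ * g σ τ) ⟩
    ∑ (λ τ → ∑ λ σ → x ^ ∣ σ ∣ * g σ τ)
      ≡⟨ ∑-cong {n} (λ τ → ∑-cong {m} λ σ → reorder (x ^ ∣ σ ∣) _ _) ⟩
    ∑ (λ τ → ∑ λ σ → χ (does (σ ≟ˢ image rename τ)) * (χ (does (face? Y τ)) * x ^ ∣ σ ∣))
      ≡⟨ ∑-cong (λ τ → ∑-δ (image rename τ) (λ σ → χ (does (face? Y τ)) * x ^ ∣ σ ∣)) ⟩
    ∑ (λ τ → χ (does (face? Y τ)) * x ^ ∣ image rename τ ∣)
      ≡⟨ ∑-cong (λ τ → cong (λ k → χ (does (face? Y τ)) * x ^ k) (∣image∣ injective τ)) ⟩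
    ∑ (fTerm Y x) ∎
    where
    open ≡-Reasoning
    open _IsCopyOf_ copy
    open ℤ-Solver A
    g : Subset m → Subset n → Carrier
    g σ τ = χ (does (face? Y τ)) * χ (does (σ ≟ˢ image rename τ))
    reorder : ∀ a b c → a * (b * c) ≡ c * (b * a)
    reorder = solve 3 (λ a b c → a :* (b :* c) := c :* (b :* a)) refl
    -- each face of X is the image of exactly one face of Y
    fibre : ∀ σ → χ (does (face? X σ)) ≡ ∑ (g σ)
    fibre σ with face? X σ
    ... | yes σ∈X with Equivalence.to (faces σ) σ∈X
    ...   | τ₀ , τ₀∈Y , refl = sym (trans
      (∑-cong λ τ → trans (*-comm _ _) (cong (_* χ (does (face? Y τ)))
        (χ-⇔ (image rename τ₀ ≟ˢ image rename τ) (τ ≟ˢ τ₀)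
          (λ eq → sym (image-injective injective eq)) (λ eq → cong (image rename) (sym eq)))))
      (trans (∑-δ τ₀ (χ ∘ does ∘ face? Y)) (χ-yes (face? Y τ₀) τ₀∈Y)))
    fibre σ | no σ∉X = trans ι-0 (sym (∑-zero zeros))
      where
      zeros : ∀ τ → g σ τ ≡ 0#
      zeros τ with face? Y τ
      ... | no  _   = ι0-* _
      ... | yes τ∈Y = trans (*-comm _ _) (χ-no-* (σ ≟ˢ image rename τ) _
                        λ eq → σ∉X (Equivalence.from (faces σ) (τ , τ∈Y , eq)))

  -- Each factor `twoPoints` contributes 1 + 2x: of the four subsets of a pair only the full one is
  -- not a face.
  f-joinPower : ∀ r x → f (joinPower r) x ≡ (ι 1ℤ + ι (ℤ.+ 2) * x) ^ r
  f-joinPower zero x = ι1-* 1#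
  f-joinPower (suc r) x = begin
    (∑ (fTerm Z x) + ∑ (λ ρ → c ρ * (x * x ^ ∣ ρ ∣))) + (∑ (λ ρ → c ρ * (x * x ^ ∣ ρ ∣)) + ∑ {r ℕ.* 2} (λ ρ → ι 0ℤ * (x * (x * x ^ ∣ ρ ∣))))
      ≡⟨ cong₂ (λ a b → (∑ (fTerm Z x) + a) + (a + b)) x-term (∑-zero {r ℕ.* 2} λ ρ → ι0-* _) ⟩
    (F + x * F) + (x * F + 0#)
      ≡⟨ cong (λ z → (F + x * F) + (x * F + z)) (sym ι-0) ⟩
    (F + x * F) + (x * F + ι 0ℤ)
      ≡⟨ collect F x ⟩
    (ι 1ℤ + ι (ℤ.+ 2) * x) * F
      ≡⟨ cong ((ι 1ℤ + ι (ℤ.+ 2) * x) *_) (f-joinPower r x) ⟩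
    (ι 1ℤ + ι (ℤ.+ 2) * x) ^ suc r ∎
    where
    open ≡-Reasoning
    open ℤ-Solver A
    Z = joinPower r
    F = f Z x
    c : Subset (r ℕ.* 2) → Carrier
    c ρ = χ (does (face? Z ρ))
    swap : ∀ a b c → a * (b * c) ≡ b * (a * c)
    swap = solve 3 (λ a b c → a :* (b :* c) := b :* (a :* c)) refl
    x-term : ∑ (λ ρ → c ρ * (x * x ^ ∣ ρ ∣)) ≡ x * F
    x-term = trans (∑-cong λ ρ → swap (c ρ) x (x ^ ∣ ρ ∣)) (∑-*ˡ x (fTerm Z x))
    collect : ∀ F x → (F + x * F) + (x * F + ι 0ℤ) ≡ (ι 1ℤ + ι (ℤ.+ 2) * x) * F
    collect = solve 2 (λ F x → (F :+ x :* F) :+ (x :* F :+ con 0ℤ) := (con 1ℤ :+ con (ℤ.+ 2) :* x) :* F) refl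

-- Inequalities in ℚ

*-mono-≤ : ∀ {a b c d} → 0ℚ ℚ.≤ a → a ℚ.≤ b → 0ℚ ℚ.≤ c → c ℚ.≤ d → a ℚ.* c ℚ.≤ b ℚ.* d
*-mono-≤ {a} {b} {c} {d} 0≤a a≤b 0≤c c≤d = ℚ.≤-trans
  (ℚ.*-monoʳ-≤-nonNeg c {{ℚ.nonNegative 0≤c}} a≤b)
  (ℚ.*-monoˡ-≤-nonNeg b {{ℚ.nonNegative (ℚ.≤-trans 0≤a a≤b)}} c≤d)

0≤* : ∀ {a b} → 0ℚ ℚ.≤ a → 0ℚ ℚ.≤ b → 0ℚ ℚ.≤ a ℚ.* b
0≤* {a} {b} 0≤a 0≤b = ℚ.≤-trans (ℚ.≤-reflexive (sym (ℚ.*-zeroˡ 0ℚ))) (*-mono-≤ ℚ.≤-refl 0≤a ℚ.≤-refl 0≤b)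

0≤+ : ∀ {a b} → 0ℚ ℚ.≤ a → 0ℚ ℚ.≤ b → 0ℚ ℚ.≤ a ℚ.+ b
0≤+ 0≤a 0≤b = ℚ.≤-trans (ℚ.≤-reflexive (sym (ℚ.+-identityˡ 0ℚ))) (ℚ.+-mono-≤ 0≤a 0≤b)

ℚ-algebra : ℤ-Algebra
ℚ-algebra = record
  { Carrier = ℚ ; _+_ = ℚ._+_ ; _*_ = ℚ._*_ ; -_ = ℚ.-_ ; 0# = 0ℚ ; 1# = 1ℚ
  ; isCommutativeRing = ℚ.+-*-isCommutativeRing
  ; ι = ℤ→ℚ ; ι-+ = ℤ→ℚ-+ ; ι-* = ℤ→ℚ-* ; ι-neg = ℤ→ℚ-neg ; ι-0 = refl ; ι-1 = refl
  }

open ℤ-Algebra ℚ-algebra using () renaming (_^_ to _^ℚ_) public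

-- Normed algebras over ℚ

record NormedAlgebra : Set₁ where
  field
    algebra : ℤ-Algebra
  open ℤ-Algebra algebra public
  field
    κ     : ℚ → Carrier
    κ-+   : ∀ a b → κ (a ℚ.+ b) ≡ κ a + κ b
    κ-*   : ∀ a b → κ (a ℚ.* b) ≡ κ a * κ b
    κ-ℤ   : ∀ a → κ (ℤ→ℚ a) ≡ ι a
    ‖_‖   : Carrier → ℚ
    0≤‖‖  : ∀ x → 0ℚ ℚ.≤ ‖ x ‖
    ‖+‖   : ∀ x y → ‖ x + y ‖ ℚ.≤ ‖ x ‖ ℚ.+ ‖ y ‖
    ‖*‖   : ∀ x y → ‖ x * y ‖ ℚ.≤ ‖ x ‖ ℚ.* ‖ y ‖
    ‖neg‖ : ∀ x → ‖ - x ‖ ≡ ‖ x ‖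
    ‖κ‖   : ∀ a → ‖ κ a ‖ ≡ ℚ.∣ a ∣

module Lipschitz (𝔸 : NormedAlgebra) where
  open NormedAlgebra 𝔸

  ‖ι‖ : ∀ a → ‖ ι a ‖ ≡ ℚ.∣ ℤ→ℚ a ∣
  ‖ι‖ a = trans (cong ‖_‖ (sym (κ-ℤ a))) (‖κ‖ (ℤ→ℚ a))

  ‖0‖ : ‖ 0# ‖ ≡ 0ℚ
  ‖0‖ = trans (cong ‖_‖ (sym ι-0)) (‖ι‖ 0ℤ)

  ‖1‖ : ‖ 1# ‖ ≡ 1ℚ
  ‖1‖ = trans (cong ‖_‖ (sym ι-1)) (‖ι‖ 1ℤ)

  ‖*‖≤ : ∀ {a b} x y → ‖ x ‖ ℚ.≤ a → ‖ y ‖ ℚ.≤ b → ‖ x * y ‖ ℚ.≤ a ℚ.* b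
  ‖*‖≤ x y x≤a y≤b = ℚ.≤-trans (‖*‖ x y) (*-mono-≤ (0≤‖‖ x) x≤a (0≤‖‖ y) y≤b)

  ‖+‖≤ : ∀ {a b} x y → ‖ x ‖ ℚ.≤ a → ‖ y ‖ ℚ.≤ b → ‖ x + y ‖ ℚ.≤ a ℚ.+ b
  ‖+‖≤ x y x≤a y≤b = ℚ.≤-trans (‖+‖ x y) (ℚ.+-mono-≤ x≤a y≤b)

  -- Bound and Lipschitz constant travel together because the product rule for the latter uses both.
  -- The constants are indices so that the contraction condition can be decided by evaluating them.
  record Lip (R : ℚ) (g : Carrier → Carrier) (M L : ℚ) : Set where
    field
      bound : ∀ x → ‖ x ‖ ℚ.≤ R → ‖ g x ‖ ℚ.≤ M
      lip   : ∀ x y → ‖ x ‖ ℚ.≤ R → ‖ y ‖ ℚ.≤ R → ‖ g x - g y ‖ ℚ.≤ L ℚ.* ‖ x - y ‖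
  open Lip public

  Lip-weaken : ∀ {R g M L M′ L′} → M ℚ.≤ M′ → L ℚ.≤ L′ → Lip R g M L → Lip R g M′ L′
  Lip-weaken M≤M′ L≤L′ G = record
    { bound = λ x x∈ → ℚ.≤-trans (bound G x x∈) M≤M′
    ; lip   = λ x y x∈ y∈ → ℚ.≤-trans (lip G x y x∈ y∈)
        (ℚ.*-monoʳ-≤-nonNeg ‖ x - y ‖ {{ℚ.nonNegative (0≤‖‖ (x - y))}} L≤L′)
    }

  Lip-const : ∀ {R M} a → ‖ a ‖ ℚ.≤ M → Lip R (λ _ → a) M 0ℚ
  Lip-const a a≤M = record
    { bound = λ _ _ → a≤M
    ; lip   = λ x y _ _ → ℚ.≤-reflexive
        (trans (cong ‖_‖ (-‿inverseʳ a)) (trans ‖0‖ (sym (ℚ.*-zeroˡ ‖ x - y ‖))))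
    }

  Lip-id : ∀ {R} → Lip R (λ x → x) R 1ℚ
  Lip-id = record
    { bound = λ _ x∈ → x∈
    ; lip   = λ x y _ _ → ℚ.≤-reflexive (sym (ℚ.*-identityˡ ‖ x - y ‖))
    }

  Lip-+ : ∀ {R g k M L M′ L′} → Lip R g M L → Lip R k M′ L′ →
          Lip R (λ x → g x + k x) (M ℚ.+ M′) (L ℚ.+ L′)
  Lip-+ {R} {g} {k} {M} {L} {M′} {L′} G K = record
    { bound = λ x x∈ → ‖+‖≤ (g x) (k x) (bound G x x∈) (bound K x x∈)
    ; lip   = λ x y x∈ y∈ → subst₂ ℚ._≤_
        (cong ‖_‖ (sym (regroup (g x) (k x) (g y) (k y))))
        (sym (ℚ.*-distribʳ-+ ‖ x - y ‖ L L′))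
        (‖+‖≤ (g x - g y) (k x - k y) (lip G x y x∈ y∈) (lip K x y x∈ y∈))
    }
    where
    open ℤ-Solver algebra
    regroup : ∀ a b c d → (a + b) - (c + d) ≡ (a - c) + (b - d)
    regroup = solve 4 (λ a b c d → (a :+ b) :- (c :+ d) := (a :- c) :+ (b :- d)) refl

  Lip-* : ∀ {R g k M L M′ L′} → Lip R g M L → Lip R k M′ L′ →
          Lip R (λ x → g x * k x) (M ℚ.* M′) (M ℚ.* L′ ℚ.+ L ℚ.* M′)
  Lip-* {R} {g} {k} {M} {L} {M′} {L′} G K = record
    { bound = λ x x∈ → ‖*‖≤ (g x) (k x) (bound G x x∈) (bound K x x∈)
    ; lip   = λ x y x∈ y∈ → subst₂ ℚ._≤_
        (cong ‖_‖ (sym (regroup (g x) (k x) (g y) (k y))))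
        (collect M L′ L M′ ‖ x - y ‖)
        (‖+‖≤ (g x * (k x - k y)) ((g x - g y) * k y)
          (‖*‖≤ (g x) (k x - k y) (bound G x x∈) (lip K x y x∈ y∈))
          (‖*‖≤ (g x - g y) (k y) (lip G x y x∈ y∈) (bound K y y∈)))
    }
    where
    regroup : ∀ a b c d → a * b - c * d ≡ a * (b - d) + (a - c) * d
    regroup = solve 4 (λ a b c d → a :* b :- c :* d := a :* (b :- d) :+ (a :- c) :* d) refl
      where open ℤ-Solver algebra
    collect : ∀ a b c d e → a ℚ.* (b ℚ.* e) ℚ.+ (c ℚ.* e) ℚ.* d ≡ (a ℚ.* b ℚ.+ c ℚ.* d) ℚ.* e
    collect = solve 5 (λ a b c d e → a :* (b :* e) :+ (c :* e) :* d := (a :* b :+ c :* d) :* e) refl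
      where open +-*-Solver

  Lip-scale : ∀ {R g M L α} a → ‖ a ‖ ℚ.≤ α → Lip R g M L → Lip R (λ x → a * g x) (α ℚ.* M) (α ℚ.* L)
  Lip-scale {R} {g} {M} {L} {α} a a≤α G = record
    { bound = λ x x∈ → ‖*‖≤ a (g x) a≤α (bound G x x∈)
    ; lip   = λ x y x∈ y∈ → subst₂ ℚ._≤_
        (cong ‖_‖ (distrib a (g x) (g y)))
        (sym (ℚ.*-assoc α L ‖ x - y ‖))
        (‖*‖≤ a (g x - g y) a≤α (lip G x y x∈ y∈))
    }
    where
    open ℤ-Solver algebra
    distrib : ∀ a b c → a * (b - c) ≡ a * b - a * c
    distrib = solve 3 (λ a b c → a :* (b :- c) := a :* b :- a :* c) refl

  eval-Lipschitz : ∀ p {R} → 0ℚ ℚ.≤ R → ∃ λ M → ∃ λ L → 0ℚ ℚ.≤ M × 0ℚ ℚ.≤ L × Lip R (eval p) M L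
  eval-Lipschitz [] 0≤R = 0ℚ , 0ℚ , ℚ.≤-refl , ℚ.≤-refl , Lip-const 0# (ℚ.≤-reflexive ‖0‖)
  eval-Lipschitz (a ∷ p) {R} 0≤R with eval-Lipschitz p 0≤R
  ... | M , L , 0≤M , 0≤L , P = _ , _ ,
    0≤+ (0≤‖‖ (ι a)) (0≤* 0≤R 0≤M) ,
    0≤+ ℚ.≤-refl (0≤+ (0≤* 0≤R 0≤L) (0≤* (from-yes (0ℚ ℚ.≤? 1ℚ)) 0≤M)) ,
    Lip-+ (Lip-const (ι a) ℚ.≤-refl) (Lip-* Lip-id P)

  -- The Banach fixed point theorem, without passing to the limit.
  module Iteration (T : Carrier → Carrier) {ρ M : ℚ} (0≤ρ : 0ℚ ℚ.≤ ρ) (T-lip : Lip ρ T M ½)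
                   (T0-small : ‖ T 0# ‖ ℚ.≤ ½ ℚ.* ρ) where

    iterate : ℕ → Carrier
    iterate zero    = 0#
    iterate (suc n) = T (iterate n)

    x-0≡x : ∀ x → x - 0# ≡ x
    x-0≡x x = trans (cong (λ z → x - z) (sym ι-0)) (solve 1 (λ x → x :- con 0ℤ := x) refl x)
      where open ℤ-Solver algebra

    split : ∀ x y → x ≡ (x - y) + y
    split = solve 2 (λ x y → x := (x :- y) :+ y) refl
      where open ℤ-Solver algebra

    ‖0‖≤ρ : ‖ 0# ‖ ℚ.≤ ρ
    ‖0‖≤ρ = ℚ.≤-trans (ℚ.≤-reflexive ‖0‖) 0≤ρ

    halves : ½ ℚ.* ρ ℚ.+ ½ ℚ.* ρ ≡ ρ
    halves = solve 1 (λ r → con ½ :* r :+ con ½ :* r := r) refl ρ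
      where open +-*-Solver

    -- ‖T x‖ ≤ ½ ‖x‖ + ‖T 0‖ ≤ ½ ρ + ½ ρ, so the iteration never leaves the disc on which T is known
    -- to contract.
    iterate-bounded : ∀ n → ‖ iterate n ‖ ℚ.≤ ρ
    iterate-bounded zero    = ‖0‖≤ρ
    iterate-bounded (suc n) = subst₂ ℚ._≤_ (cong ‖_‖ (sym (split (T x) (T 0#)))) halves
      (‖+‖≤ (T x - T 0#) (T 0#)
        (ℚ.≤-trans (lip T-lip x 0# (iterate-bounded n) ‖0‖≤ρ)
          (ℚ.*-monoˡ-≤-nonNeg ½ (ℚ.≤-trans (ℚ.≤-reflexive (cong ‖_‖ (x-0≡x x))) (iterate-bounded n))))
        T0-small)
      where x = iterate n

    -- Lowering both indices by one gains a factor ½; at index 0 one of the two points is the centre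
    -- of the disc.
    iterate-close : ∀ n k → ‖ iterate n - iterate (n ℕ.+ k) ‖ ℚ.≤ ½ ^ℚ n ℚ.* ρ
    iterate-close zero k = ℚ.≤-trans
      (ℚ.≤-reflexive (trans (cong ‖_‖ (+-identityˡ _)) (‖neg‖ (iterate k))))
      (ℚ.≤-trans (iterate-bounded k) (ℚ.≤-reflexive (sym (ℚ.*-identityˡ ρ))))
    iterate-close (suc n) k = ℚ.≤-trans
      (lip T-lip (iterate n) (iterate (n ℕ.+ k)) (iterate-bounded n) (iterate-bounded (n ℕ.+ k)))
      (ℚ.≤-trans (ℚ.*-monoˡ-≤-nonNeg ½ (iterate-close n k))
        (ℚ.≤-reflexive (sym (ℚ.*-assoc ½ (½ ^ℚ n) ρ))))

1/r*r : ∀ r .{{_ : ℕ.NonZero r}} → (ℤ.+ 1 ℚ./ r) ℚ.* ℤ→ℚ (ℤ.+ r) ≡ 1ℚ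
1/r*r r = trans (cong₂ ℚ._*_ (1/r≡ r) (ℤ→ℚ-fromℤ (ℤ.+ r))) (ℚ.*-inverseˡ (fromℤ (ℤ.+ r)))
  where
  1/r≡ : ∀ r .{{_ : ℕ.NonZero r}} → ℤ.+ 1 ℚ./ r ≡ 1/ fromℤ (ℤ.+ r)
  1/r≡ (suc r) = ℚ.↥p/↧p≡p (1/ fromℤ (ℤ.+ suc r))

0≤1/r : ∀ r .{{_ : ℕ.NonZero r}} → 0ℚ ℚ.≤ ℤ.+ 1 ℚ./ r
0≤1/r r = ℚ.nonNegative⁻¹ _ {{ℚ.normalize-nonNeg 1 r}}

-- Bounds and Lipschitz constants on the disc of radius ρ about 0

powerBounds : ℚ → ℚ → ℕ → ℚ × ℚ
powerBounds M L zero    = 1ℚ , 0ℚ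
powerBounds M L (suc r) with powerBounds M L r
... | M′ , L′ = M ℚ.* M′ , M ℚ.* L′ ℚ.+ L ℚ.* M′

-- Small enough for the nonlinear part of v ^ r to contract when r ≤ 4, large enough for the fixed
-- errors to fit into ½ ρ. `ContractionBounds` tests both.
ρ : ℚ
ρ = ℤ.+ 1 ℚ./ 16

-- Exactly the constants that `Lip-+`, `Lip-*` and `Lip-scale` produce along the recursion of
-- `tail`, left unsimplified so that they agree by computation.
tailBounds : ℕ → ℚ × ℚ
tailBounds zero    = 0ℚ , 0ℚ
tailBounds (suc r) with tailBounds r
... | M , L = (1ℚ ℚ.+ ρ) ℚ.* M ℚ.+ ℤ→ℚ (ℤ.+ r) ℚ.* (ρ ℚ.* ρ) ,
              ((1ℚ ℚ.+ ρ) ℚ.* L ℚ.+ (0ℚ ℚ.+ 1ℚ) ℚ.* M) ℚ.+ ℤ→ℚ (ℤ.+ r) ℚ.* (ρ ℚ.* 1ℚ ℚ.+ 1ℚ ℚ.* ρ)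

-- The three sources of error in order: the variation of h near b, the rounding of q and u₀ (at most
-- 1/48), and the variation of B near 0 multiplied by μ with ‖μ‖ ≤ 2.
errorBounds : ℕ → ℚ × ℚ
errorBounds r with powerBounds (1ℚ ℚ.+ ρ) (0ℚ ℚ.+ 1ℚ) r
... | M , L =
  1ℚ ℚ.* (ℤ.+ 1 ℚ./ 128) ℚ.+ ((ℤ.+ 1 ℚ./ 48) ℚ.* M ℚ.+ (ℤ.+ 2 ℚ./ 1) ℚ.* (M ℚ.* (ℤ.+ 1 ℚ./ 128))) ,
  1ℚ ℚ.* (ℤ.+ 1 ℚ./ 256) ℚ.+ ((ℤ.+ 1 ℚ./ 48) ℚ.* L ℚ.+ (ℤ.+ 2 ℚ./ 1) ℚ.* (M ℚ.* (ℤ.+ 1 ℚ./ 256) ℚ.+ L ℚ.* (ℤ.+ 1 ℚ./ 128)))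

-- (1 + x) ^ r ≤ 1 + growth r · x for 0 ≤ x ≤ 1
growth : ℕ → ℚ
growth zero    = 0ℚ
growth (suc r) = 1ℚ ℚ.+ (growth r ℚ.+ growth r)

-- The Newton step divides by the derivative r of v ^ r at 1.
ContractionBounds : ∀ r .{{_ : ℕ.NonZero r}} → Set
ContractionBounds r =
  (ℤ.+ 1 ℚ./ r) ℚ.* (proj₂ (tailBounds r) ℚ.+ proj₂ (errorBounds r)) ℚ.≤ ½ ×
  (ℤ.+ 1 ℚ./ r) ℚ.* proj₁ (errorBounds r) ℚ.≤ ½ ℚ.* ρ ×
  -- `growth r` is 2 ^ r - 1, and 4 is the largest multiplicity that occurs.
  growth r ℚ.≤ ℤ.+ 15 ℚ./ 1

contractionBounds? : ∀ r .{{_ : ℕ.NonZero r}} → Dec (ContractionBounds r)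
contractionBounds? r = (_ ℚ.≤? _) ×-dec (_ ℚ.≤? _) ×-dec (_ ℚ.≤? _)

-- The perturbed equation as a fixed point problem

module Perturbation (𝔸 : NormedAlgebra) where
  open NormedAlgebra 𝔸
  open Lipschitz 𝔸

  1+_ : Carrier → Carrier
  1+ u = ι 1ℤ + u

  ‖ι1‖≤1 : ‖ ι 1ℤ ‖ ℚ.≤ 1ℚ
  ‖ι1‖≤1 = ℚ.≤-reflexive (‖ι‖ 1ℤ)

  Lip-1+ : Lip ρ 1+_ (1ℚ ℚ.+ ρ) (0ℚ ℚ.+ 1ℚ)
  Lip-1+ = Lip-+ (Lip-const (ι 1ℤ) ‖ι1‖≤1) Lip-id

  Lip-^ : ∀ {R g M L} → Lip R g M L → ∀ r →
          Lip R (λ x → g x ^ r) (proj₁ (powerBounds M L r)) (proj₂ (powerBounds M L r))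
  Lip-^ G zero    = Lip-const 1# (ℚ.≤-reflexive ‖1‖)
  Lip-^ G (suc r) = Lip-* G (Lip-^ G r)

  ^-distrib-* : ∀ x y r → (x * y) ^ r ≡ x ^ r * y ^ r
  ^-distrib-* x y zero    = sym (*-identityˡ 1#)
  ^-distrib-* x y (suc r) = trans (cong (x * y *_) (^-distrib-* x y r)) (swap x y (x ^ r) (y ^ r))
    where
    open ℤ-Solver algebra
    swap : ∀ a b c d → (a * b) * (c * d) ≡ (a * c) * (b * d)
    swap = solve 4 (λ a b c d → (a :* b) :* (c :* d) := (a :* c) :* (b :* d)) refl

  -- The terms of degree at least two in (1 + u) ^ r, in a recursive form from which Lipschitz
  -- constants can be read off.
  tail : ℕ → Carrier → Carrier
  tail zero    u = 0#
  tail (suc r) u = 1+ u * tail r u + ι (ℤ.+ r) * (u * u)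

  1+^ : ∀ r u → (1+ u) ^ r ≡ (1+ (ι (ℤ.+ r) * u)) + tail r u
  1+^ zero u = sym (trans (+-identityʳ _) (trans (cong (ι 1ℤ +_) (trans (cong (_* u) ι-0) (zeroˡ u)))
    (trans (+-identityʳ _) ι-1)))
  1+^ (suc r) u = trans (cong (1+ u *_) (1+^ r u)) (trans (expand u (ι (ℤ.+ r)) (tail r u))
    (cong (λ k → (1+ (k * u)) + tail (suc r) u) (sym (ι-+ 1ℤ (ℤ.+ r)))))
    where
    open ℤ-Solver algebra
    expand : ∀ u k F → 1+ u * ((1+ (k * u)) + F) ≡ (1+ ((1+ k) * u)) + (1+ u * F + k * (u * u))
    expand = solve 3 (λ u k F → (con 1ℤ :+ u) :* ((con 1ℤ :+ k :* u) :+ F) :=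
      (con 1ℤ :+ (con 1ℤ :+ k) :* u) :+ ((con 1ℤ :+ u) :* F :+ k :* (u :* u))) refl

  tail-0 : ∀ r → tail r 0# ≡ 0#
  tail-0 zero    = refl
  tail-0 (suc r) = trans (cong₂ _+_ (trans (cong (1+ 0# *_) (tail-0 r)) (zeroʳ _))
    (trans (cong (ι (ℤ.+ r) *_) (zeroˡ 0#)) (zeroʳ _))) (+-identityˡ 0#)

  Lip-tail : ∀ r → Lip ρ (tail r) (proj₁ (tailBounds r)) (proj₂ (tailBounds r))
  Lip-tail zero    = Lip-const 0# (ℚ.≤-reflexive ‖0‖)
  Lip-tail (suc r) = Lip-+ (Lip-* Lip-1+ (Lip-tail r))
    (Lip-scale (ι (ℤ.+ r)) (ℚ.≤-reflexive (trans (‖ι‖ (ℤ.+ r)) (ℚ.0≤p⇒∣p∣≡p (ℤ→ℚ-mono-≤ {0ℤ} {ℤ.+ r} (ℤ.+≤+ ℕ.z≤n)))))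
      (Lip-* Lip-id Lip-id))

  -- A polynomial is nearly constant on a small disc about a. Since ‖a‖ ≤ 1, ‖d‖ ≤ 1 and ‖1 + u‖ ≤
  -- 2, all arguments have norm at most 3; the 2 is also the ratio of 1/128 to 1/256.
  Lip-eval-affine : ∀ p {M C ε a d} → 0ℚ ℚ.≤ C → Lip (ℤ.+ 3 ℚ./ 1) (eval p) M C →
    ‖ a ‖ ℚ.≤ 1ℚ → ‖ d ‖ ℚ.≤ ε → ε ℚ.≤ 1ℚ → C ℚ.* ε ℚ.≤ ℤ.+ 1 ℚ./ 256 →
    Lip ρ (λ u → eval p (a + d * 1+ u) - eval p a) (ℤ.+ 1 ℚ./ 128) (ℤ.+ 1 ℚ./ 256)
  Lip-eval-affine p {M} {C} {ε} {a} {d} 0≤C P a≤1 d≤ε ε≤1 Cε≤ = record { bound = bnd ; lip = lp }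
    where
    two = ℤ.+ 2 ℚ./ 1
    w : Carrier → Carrier
    w u = a + d * 1+ u
    1+u≤2 : ∀ u → ‖ u ‖ ℚ.≤ ρ → ‖ 1+ u ‖ ℚ.≤ two
    1+u≤2 u u∈ = ℚ.≤-trans (bound Lip-1+ u u∈) (from-yes (1ℚ ℚ.+ ρ ℚ.≤? two))
    w≤3 : ∀ u → ‖ u ‖ ℚ.≤ ρ → ‖ w u ‖ ℚ.≤ ℤ.+ 3 ℚ./ 1
    w≤3 u u∈ = ‖+‖≤ a (d * 1+ u) a≤1 (‖*‖≤ d (1+ u) (ℚ.≤-trans d≤ε ε≤1) (1+u≤2 u u∈))
    a≤3 : ‖ a ‖ ℚ.≤ ℤ.+ 3 ℚ./ 1
    a≤3 = ℚ.≤-trans a≤1 (from-yes (1ℚ ℚ.≤? ℤ.+ 3 ℚ./ 1))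
    step : ∀ {x e} → ‖ x ‖ ℚ.≤ ε ℚ.* e → 0ℚ ℚ.≤ e → C ℚ.* ‖ x ‖ ℚ.≤ (ℤ.+ 1 ℚ./ 256) ℚ.* e
    step {x} {e} x≤ 0≤e = ℚ.≤-trans (ℚ.*-monoˡ-≤-nonNeg C {{ℚ.nonNegative 0≤C}} x≤)
      (ℚ.≤-trans (ℚ.≤-reflexive (sym (ℚ.*-assoc C ε e)))
        (ℚ.*-monoʳ-≤-nonNeg e {{ℚ.nonNegative 0≤e}} Cε≤))
    open ℤ-Solver algebra
    cancel₁ : ∀ a x → (a + x) - a ≡ x
    cancel₁ = solve 2 (λ a x → (a :+ x) :- a := x) refl
    cancel₂ : ∀ a x y → (x - a) - (y - a) ≡ x - y
    cancel₂ = solve 3 (λ a x y → (x :- a) :- (y :- a) := x :- y) refl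
    cancel₃ : ∀ a d u v → (a + d * 1+ u) - (a + d * 1+ v) ≡ d * (u - v)
    cancel₃ = solve 4 (λ a d u v → (a :+ d :* (con 1ℤ :+ u)) :- (a :+ d :* (con 1ℤ :+ v)) := d :* (u :- v)) refl
    bnd : ∀ u → ‖ u ‖ ℚ.≤ ρ → ‖ eval p (w u) - eval p a ‖ ℚ.≤ ℤ.+ 1 ℚ./ 128
    bnd u u∈ = ℚ.≤-trans (lip P (w u) a (w≤3 u u∈) a≤3)
      (step (ℚ.≤-trans (ℚ.≤-reflexive (cong ‖_‖ (cancel₁ a (d * 1+ u)))) (‖*‖≤ d (1+ u) d≤ε (1+u≤2 u u∈)))
        (from-yes (0ℚ ℚ.≤? two)))
    lp : ∀ u v → ‖ u ‖ ℚ.≤ ρ → ‖ v ‖ ℚ.≤ ρ →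
         ‖ (eval p (w u) - eval p a) - (eval p (w v) - eval p a) ‖ ℚ.≤ (ℤ.+ 1 ℚ./ 256) ℚ.* ‖ u - v ‖
    lp u v u∈ v∈ = ℚ.≤-trans (ℚ.≤-reflexive (cong ‖_‖ (cancel₂ (eval p a) (eval p (w u)) (eval p (w v)))))
      (ℚ.≤-trans (lip P (w u) (w v) (w≤3 u u∈) (w≤3 v v∈))
        (step (ℚ.≤-trans (ℚ.≤-reflexive (cong ‖_‖ (cancel₃ a d u v))) (‖*‖≤ d (u - v) d≤ε ℚ.≤-refl))
          (0≤‖‖ (u - v))))

  -- Solving h (x) + m K (x) = 0 at x = b (1 + c v) with v near 1, where
  -- K (b (1 + y)) = y ^ r B (y): multiplied by λ = -1 / h (b), the equation
  -- reads v ^ r - 1 + error = 0.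
  module Root (r : ℕ) .{{_ : ℕ.NonZero r}} (bounds : ContractionBounds r)
    (h K B : Poly) (m : ℤ) (b c l : Carrier)
    (factor : ∀ y → eval K (b * 1+ y) ≡ y ^ r * eval B y)
    (l-inverse : l * eval h b ≡ - ι 1ℤ)
    {M M′ C ε : ℚ} (0≤C : 0ℚ ℚ.≤ C)
    (h-lip : Lip (ℤ.+ 3 ℚ./ 1) (eval h) M C) (B-lip : Lip (ℤ.+ 3 ℚ./ 1) (eval B) M′ C)
    (b≤1 : ‖ b ‖ ℚ.≤ 1ℚ) (l≤1 : ‖ l ‖ ℚ.≤ 1ℚ) (c≤ε : ‖ c ‖ ℚ.≤ ε) (ε≤1 : ε ℚ.≤ 1ℚ)
    (Cε≤ : C ℚ.* ε ℚ.≤ ℤ.+ 1 ℚ./ 256)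
    (μ≤2 : ‖ l * (ι m * c ^ r) ‖ ℚ.≤ ℤ.+ 2 ℚ./ 1)
    (μB≈1 : ‖ l * (ι m * c ^ r) * eval B 0# - ι 1ℤ ‖ ℚ.≤ ℤ.+ 1 ℚ./ 48) where

    μ B₀ : Carrier
    μ  = l * (ι m * c ^ r)
    B₀ = eval B 0#

    point : Carrier → Carrier
    point u = b + b * c * 1+ u

    -- What is left of l (h + m K) after v ^ r - 1 is taken out, with v = 1 + u: the deviations of h
    -- from h (b), of μ B (0) from 1, and of B from B (0).
    error : Carrier → Carrier
    error u = l * (eval h (point u) - eval h b) +
      ((μ * B₀ - ι 1ℤ) * (1+ u) ^ r + μ * ((1+ u) ^ r * (eval B (0# + c * 1+ u) - B₀)))

    bc≤ε : ‖ b * c ‖ ℚ.≤ ε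
    bc≤ε = ℚ.≤-trans (‖*‖≤ b c b≤1 c≤ε) (ℚ.≤-reflexive (ℚ.*-identityˡ ε))

    Lip-error : Lip ρ error (proj₁ (errorBounds r)) (proj₂ (errorBounds r))
    Lip-error = Lip-+
      (Lip-scale l l≤1 (Lip-eval-affine h 0≤C h-lip b≤1 bc≤ε ε≤1 Cε≤))
      (Lip-+ (Lip-scale (μ * B₀ - ι 1ℤ) μB≈1 (Lip-^ Lip-1+ r))
        (Lip-scale μ μ≤2 (Lip-* (Lip-^ Lip-1+ r)
          (Lip-eval-affine B 0≤C B-lip (ℚ.≤-trans (ℚ.≤-reflexive ‖0‖) (from-yes (0ℚ ℚ.≤? 1ℚ))) c≤ε ε≤1 Cε≤))))

    s : Carrier
    s = κ (ℤ.+ 1 ℚ./ r)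

    s-inverse : s * ι (ℤ.+ r) ≡ ι 1ℤ
    s-inverse = trans (cong (s *_) (sym (κ-ℤ (ℤ.+ r)))) (trans (sym (κ-* _ _))
      (trans (cong κ (1/r*r r)) (κ-ℤ 1ℤ)))

    -- Newton's method with the derivative frozen at v = 1, that is u - ((1 + u) ^ r - 1 + error u)
    -- / r; the terms linear in u have cancelled.
    step : Carrier → Carrier
    step u = - s * (tail r u + error u)

    s≤ : ‖ - s ‖ ℚ.≤ ℤ.+ 1 ℚ./ r
    s≤ = ℚ.≤-reflexive (trans (‖neg‖ s) (trans (‖κ‖ _) (ℚ.0≤p⇒∣p∣≡p (0≤1/r r))))

    Lip-step : Lip ρ step _ ½
    Lip-step = Lip-weaken ℚ.≤-refl (proj₁ bounds)
      (Lip-scale (- s) s≤ (Lip-+ (Lip-tail r) Lip-error))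

    step-0 : ‖ step 0# ‖ ℚ.≤ ½ ℚ.* ρ
    step-0 = ℚ.≤-trans
      (‖*‖≤ (- s) _ s≤ (ℚ.≤-trans
        (ℚ.≤-reflexive (cong ‖_‖ (trans (cong (_+ error 0#) (tail-0 r)) (+-identityˡ _))))
        (bound Lip-error 0# (ℚ.≤-trans (ℚ.≤-reflexive ‖0‖) (from-yes (0ℚ ℚ.≤? ρ))))))
      (proj₁ (proj₂ bounds))

    open Iteration step {ρ} (from-yes (0ℚ ℚ.≤? ρ)) Lip-step step-0 public

    value : Carrier → Carrier
    value u = eval h (point u) + ι m * eval K (point u)

    -- The residual of the original equation is a constant multiple of the displacement in one step,
    -- so the closeness of consecutive iterates already bounds it.
    value-step : ∀ u → l * value u ≡ ι (ℤ.+ r) * (u - step u)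
    value-step u = trans (cong (λ k → l * (eval h (point u) + ι m * k)) K-point) (trans
      (rearrange l (ι m) (eval h (point u)) (c ^ r) ((1+ u) ^ r) (eval B (0# + c * 1+ u)) B₀ (eval h b))
      (trans (cong (λ z → ((1+ u) ^ r - ι 1ℤ + error u) + (z + ι 1ℤ)) l-inverse)
      (trans (cong (λ V → (V - ι 1ℤ + error u) + (- ι 1ℤ + ι 1ℤ)) (1+^ r u))
      (trans (simplify (ι (ℤ.+ r)) u (tail r u) (error u))
      (trans (cong (λ z → ι (ℤ.+ r) * u + z * (tail r u + error u)) (sym s-inverse))
        (expand (ι (ℤ.+ r)) s u (tail r u + error u)))))))
      where
      open ℤ-Solver algebra
      K-point : eval K (point u) ≡ c ^ r * (1+ u) ^ r * eval B (0# + c * 1+ u)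
      K-point = trans (cong (eval K) (solve 3 (λ b c v → b :+ b :* c :* v := b :* (con 1ℤ :+ c :* v)) refl b c (1+ u)))
        (trans (factor (c * 1+ u)) (cong₂ (λ p y → p * eval B y) (^-distrib-* c (1+ u) r) (sym (+-identityˡ (c * 1+ u)))))
      rearrange : ∀ l m h c V B B₀ A → l * (h + m * (c * V * B)) ≡
        (V - ι 1ℤ + (l * (h - A) + ((l * (m * c) * B₀ - ι 1ℤ) * V + l * (m * c) * (V * (B - B₀))))) + (l * A + ι 1ℤ)
      rearrange = solve 8 (λ l m h c V B B₀ A → l :* (h :+ m :* (c :* V :* B)) :=
        (V :- con 1ℤ :+ (l :* (h :- A) :+ ((l :* (m :* c) :* B₀ :- con 1ℤ) :* V :+ l :* (m :* c) :* (V :* (B :- B₀))))) :+ (l :* A :+ con 1ℤ)) refl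
      simplify : ∀ k u t e → ((1+ (k * u)) + t - ι 1ℤ + e) + (- ι 1ℤ + ι 1ℤ) ≡ k * u + ι 1ℤ * (t + e)
      simplify = solve 4 (λ k u t e → ((con 1ℤ :+ k :* u) :+ t :- con 1ℤ :+ e) :+ (:- con 1ℤ :+ con 1ℤ) := k :* u :+ con 1ℤ :* (t :+ e)) refl
      expand : ∀ k s u t → k * u + s * k * t ≡ k * (u - - s * t)
      expand = solve 4 (λ k s u t → k :* u :+ s :* k :* t := k :* (u :- :- s :* t)) refl

    value-small : ∀ n → ‖ value (iterate n) ‖ ℚ.≤ ‖ eval h b ‖ ℚ.* (‖ ι (ℤ.+ r) ‖ ℚ.* (½ ^ℚ n ℚ.* ρ))
    value-small n = ℚ.≤-trans (ℚ.≤-reflexive (cong ‖_‖ unscale))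
      (‖*‖≤ (- eval h b) _ (ℚ.≤-reflexive (‖neg‖ (eval h b)))
        (ℚ.≤-trans (ℚ.≤-reflexive (cong ‖_‖ (value-step u)))
          (‖*‖≤ (ι (ℤ.+ r)) (u - step u) ℚ.≤-refl
            (subst (λ k → ‖ u - iterate k ‖ ℚ.≤ ½ ^ℚ n ℚ.* ρ) (ℕ.+-comm n 1) (iterate-close n 1)))))
      where
      open ℤ-Solver algebra
      u = iterate n
      unscale : value u ≡ - eval h b * (l * value u)
      unscale = sym (trans (solve 3 (λ l a v → :- a :* (l :* v) := :- (l :* a) :* v) refl l (eval h b) (value u))
        (trans (cong (λ z → - z * value u) l-inverse)
        (trans (solve 1 (λ v → :- (:- con 1ℤ) :* v := con 1ℤ :* v) refl (value u))
          (trans (cong (_* value u) ι-1) (*-identityˡ _)))))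

ℚ-normed : NormedAlgebra
ℚ-normed = record
  { algebra = ℚ-algebra ; κ = λ a → a ; κ-+ = λ _ _ → refl ; κ-* = λ _ _ → refl ; κ-ℤ = λ _ → refl
  ; ‖_‖ = ℚ.∣_∣ ; 0≤‖‖ = ℚ.0≤∣p∣ ; ‖+‖ = ℚ.∣p+q∣≤∣p∣+∣q∣
  ; ‖*‖ = λ x y → ℚ.≤-reflexive (ℚ.∣p*q∣≡∣p∣*∣q∣ x y) ; ‖neg‖ = ℚ.∣-p∣≡∣p∣ ; ‖κ‖ = λ _ → refl
  }

-- Gaussian rationals; the operations are those of ℂ at each index of the
-- Cauchy sequences.

record ℚ[i] : Set where
  constructor _⊹_
  field
    Re Im : ℚ
open ℚ[i] public

infix 5 _⊹_

infixl 6 _⊕_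
infixl 7 _⊗_
_⊕_ _⊗_ : ℚ[i] → ℚ[i] → ℚ[i]
x ⊕ y = (Re x ℚ.+ Re y) ⊹ (Im x ℚ.+ Im y)
x ⊗ y = (Re x ℚ.* Re y ℚ.+ ℚ.- (Im x ℚ.* Im y)) ⊹ (Re x ℚ.* Im y ℚ.+ Im x ℚ.* Re y)

⊖_ : ℚ[i] → ℚ[i]
⊖ x = (ℚ.- Re x) ⊹ (ℚ.- Im x)

real : ℚ → ℚ[i]
real a = a ⊹ 0ℚ

private
  ext : ∀ {a b c d} → a ≡ b → c ≡ d → a ⊹ c ≡ b ⊹ d
  ext refl refl = refl

ℚ[i]-isCommutativeRing : IsCommutativeRing _≡_ _⊕_ _⊗_ ⊖_ (real 0ℚ) (real 1ℚ)
ℚ[i]-isCommutativeRing = record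
  { isRing = record
    { +-isAbelianGroup = record
      { isGroup = record
        { isMonoid = record
          { isSemigroup = record
            { isMagma = isMagma _⊕_
            ; assoc = λ x y z → ext (ℚ.+-assoc (Re x) (Re y) (Re z)) (ℚ.+-assoc (Im x) (Im y) (Im z))
            }
          ; identity = (λ x → ext (ℚ.+-identityˡ (Re x)) (ℚ.+-identityˡ (Im x))) ,
                       (λ x → ext (ℚ.+-identityʳ (Re x)) (ℚ.+-identityʳ (Im x)))
          }
        ; inverse = (λ x → ext (ℚ.+-inverseˡ (Re x)) (ℚ.+-inverseˡ (Im x))) ,
                    (λ x → ext (ℚ.+-inverseʳ (Re x)) (ℚ.+-inverseʳ (Im x)))
        ; ⁻¹-cong = cong ⊖_
        }
      ; comm = λ x y → ext (ℚ.+-comm (Re x) (Re y)) (ℚ.+-comm (Im x) (Im y))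
      }
    ; *-cong = cong₂ _⊗_
    ; *-assoc = λ x y z → ext (assoc-re (Re x) (Im x) (Re y) (Im y) (Re z) (Im z))
                              (assoc-im (Re x) (Im x) (Re y) (Im y) (Re z) (Im z))
    ; *-identity = (λ x → ext (one-re (Re x) (Im x)) (one-im (Re x) (Im x))) ,
                   (λ x → trans (*-comm x (real 1ℚ)) (ext (one-re (Re x) (Im x)) (one-im (Re x) (Im x))))
    ; distrib = distribˡ ,
                (λ x y z → trans (*-comm (y ⊕ z) x) (trans (distribˡ x y z) (cong₂ _⊕_ (*-comm x y) (*-comm x z))))
    }
  ; *-comm = *-comm
  }
  where
  open +-*-Solver
  isMagma : (_∙_ : ℚ[i] → ℚ[i] → ℚ[i]) → IsMagma _≡_ _∙_
  isMagma _∙_ = record { isEquivalence = isEquivalence ; ∙-cong = cong₂ _∙_ }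
  assoc-re : ∀ a b c d e f → (a ℚ.* c ℚ.+ ℚ.- (b ℚ.* d)) ℚ.* e ℚ.+ ℚ.- ((a ℚ.* d ℚ.+ b ℚ.* c) ℚ.* f) ≡
                             a ℚ.* (c ℚ.* e ℚ.+ ℚ.- (d ℚ.* f)) ℚ.+ ℚ.- (b ℚ.* (c ℚ.* f ℚ.+ d ℚ.* e))
  assoc-re = solve 6 (λ a b c d e f → (a :* c :+ :- (b :* d)) :* e :+ :- ((a :* d :+ b :* c) :* f) :=
                                      a :* (c :* e :+ :- (d :* f)) :+ :- (b :* (c :* f :+ d :* e))) refl
  assoc-im : ∀ a b c d e f → (a ℚ.* c ℚ.+ ℚ.- (b ℚ.* d)) ℚ.* f ℚ.+ (a ℚ.* d ℚ.+ b ℚ.* c) ℚ.* e ≡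
                             a ℚ.* (c ℚ.* f ℚ.+ d ℚ.* e) ℚ.+ b ℚ.* (c ℚ.* e ℚ.+ ℚ.- (d ℚ.* f))
  assoc-im = solve 6 (λ a b c d e f → (a :* c :+ :- (b :* d)) :* f :+ (a :* d :+ b :* c) :* e :=
                                      a :* (c :* f :+ d :* e) :+ b :* (c :* e :+ :- (d :* f))) refl
  one-re : ∀ a b → 1ℚ ℚ.* a ℚ.+ ℚ.- (0ℚ ℚ.* b) ≡ a
  one-re = solve 2 (λ a b → con 1ℚ :* a :+ :- (con 0ℚ :* b) := a) refl
  one-im : ∀ a b → 1ℚ ℚ.* b ℚ.+ 0ℚ ℚ.* a ≡ b
  one-im = solve 2 (λ a b → con 1ℚ :* b :+ con 0ℚ :* a := b) refl
  comm-re : ∀ a b c d → a ℚ.* c ℚ.+ ℚ.- (b ℚ.* d) ≡ c ℚ.* a ℚ.+ ℚ.- (d ℚ.* b)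
  comm-re = solve 4 (λ a b c d → a :* c :+ :- (b :* d) := c :* a :+ :- (d :* b)) refl
  comm-im : ∀ a b c d → a ℚ.* d ℚ.+ b ℚ.* c ≡ c ℚ.* b ℚ.+ d ℚ.* a
  comm-im = solve 4 (λ a b c d → a :* d :+ b :* c := c :* b :+ d :* a) refl
  *-comm : ∀ x y → x ⊗ y ≡ y ⊗ x
  *-comm x y = ext (comm-re (Re x) (Im x) (Re y) (Im y)) (comm-im (Re x) (Im x) (Re y) (Im y))
  distrib-re : ∀ a b c d e f → a ℚ.* (c ℚ.+ e) ℚ.+ ℚ.- (b ℚ.* (d ℚ.+ f)) ≡
                               (a ℚ.* c ℚ.+ ℚ.- (b ℚ.* d)) ℚ.+ (a ℚ.* e ℚ.+ ℚ.- (b ℚ.* f))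
  distrib-re = solve 6 (λ a b c d e f → a :* (c :+ e) :+ :- (b :* (d :+ f)) :=
                                        (a :* c :+ :- (b :* d)) :+ (a :* e :+ :- (b :* f))) refl
  distrib-im : ∀ a b c d e f → a ℚ.* (d ℚ.+ f) ℚ.+ b ℚ.* (c ℚ.+ e) ≡
                               (a ℚ.* d ℚ.+ b ℚ.* c) ℚ.+ (a ℚ.* f ℚ.+ b ℚ.* e)
  distrib-im = solve 6 (λ a b c d e f → a :* (d :+ f) :+ b :* (c :+ e) :=
                                        (a :* d :+ b :* c) :+ (a :* f :+ b :* e)) refl
  distribˡ : ∀ x y z → x ⊗ (y ⊕ z) ≡ (x ⊗ y) ⊕ (x ⊗ z)
  distribˡ x y z = ext (distrib-re (Re x) (Im x) (Re y) (Im y) (Re z) (Im z))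
                       (distrib-im (Re x) (Im x) (Re y) (Im y) (Re z) (Im z))

real-* : ∀ a b → real (a ℚ.* b) ≡ real a ⊗ real b
real-* a b = ext (re-* a b) (im-* a b)
  where
  open +-*-Solver
  re-* : ∀ a b → a ℚ.* b ≡ a ℚ.* b ℚ.+ ℚ.- (0ℚ ℚ.* 0ℚ)
  re-* = solve 2 (λ a b → a :* b := a :* b :+ :- (con 0ℚ :* con 0ℚ)) refl
  im-* : ∀ a b → 0ℚ ≡ a ℚ.* 0ℚ ℚ.+ 0ℚ ℚ.* b
  im-* = solve 2 (λ a b → con 0ℚ := a :* con 0ℚ :+ con 0ℚ :* b) refl

-- The sum norm is submultiplicative and has rational values, unlike the modulus.
∥_∥₁ : ℚ[i] → ℚ
∥ x ∥₁ = ℚ.∣ Re x ∣ ℚ.+ ℚ.∣ Im x ∣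

ℚ[i]-algebra : ℤ-Algebra
ℚ[i]-algebra = record
  { Carrier = ℚ[i] ; _+_ = _⊕_ ; _*_ = _⊗_ ; -_ = ⊖_ ; 0# = real 0ℚ ; 1# = real 1ℚ
  ; isCommutativeRing = ℚ[i]-isCommutativeRing
  ; ι     = λ a → real (ℤ→ℚ a)
  ; ι-+   = λ a b → ext (ℤ→ℚ-+ a b) refl
  ; ι-*   = λ a b → trans (cong real (ℤ→ℚ-* a b)) (real-* (ℤ→ℚ a) (ℤ→ℚ b))
  ; ι-neg = λ a → ext (ℤ→ℚ-neg a) refl
  ; ι-0   = refl
  ; ι-1   = refl
  }

ℚ[i]-normed : NormedAlgebra
ℚ[i]-normed = record
  { algebra = ℚ[i]-algebra
  ; κ       = real
  ; κ-+     = λ _ _ → refl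
  ; κ-*     = real-*
  ; κ-ℤ     = λ _ → refl
  ; ‖_‖     = ∥_∥₁
  ; 0≤‖‖    = λ x → 0≤+ (ℚ.0≤∣p∣ (Re x)) (ℚ.0≤∣p∣ (Im x))
  ; ‖+‖     = λ x y → ℚ.≤-trans
      (ℚ.+-mono-≤ (ℚ.∣p+q∣≤∣p∣+∣q∣ (Re x) (Re y)) (ℚ.∣p+q∣≤∣p∣+∣q∣ (Im x) (Im y)))
      (ℚ.≤-reflexive (interchange ℚ.∣ Re x ∣ ℚ.∣ Re y ∣ ℚ.∣ Im x ∣ ℚ.∣ Im y ∣))
  ; ‖*‖     = λ x y → ℚ.≤-trans
      (ℚ.+-mono-≤
        (ℚ.≤-trans (ℚ.∣p-q∣≤∣p∣+∣q∣ (Re x ℚ.* Re y) (Im x ℚ.* Im y))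
          (ℚ.≤-reflexive (cong₂ ℚ._+_ (ℚ.∣p*q∣≡∣p∣*∣q∣ (Re x) (Re y)) (ℚ.∣p*q∣≡∣p∣*∣q∣ (Im x) (Im y)))))
        (ℚ.≤-trans (ℚ.∣p+q∣≤∣p∣+∣q∣ (Re x ℚ.* Im y) (Im x ℚ.* Re y))
          (ℚ.≤-reflexive (cong₂ ℚ._+_ (ℚ.∣p*q∣≡∣p∣*∣q∣ (Re x) (Im y)) (ℚ.∣p*q∣≡∣p∣*∣q∣ (Im x) (Re y))))))
      (ℚ.≤-reflexive (product ℚ.∣ Re x ∣ ℚ.∣ Im x ∣ ℚ.∣ Re y ∣ ℚ.∣ Im y ∣))
  ; ‖neg‖   = λ x → cong₂ ℚ._+_ (ℚ.∣-p∣≡∣p∣ (Re x)) (ℚ.∣-p∣≡∣p∣ (Im x))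
  ; ‖κ‖     = λ a → ℚ.+-identityʳ ℚ.∣ a ∣
  }
  where
  open +-*-Solver
  interchange : ∀ a b c d → (a ℚ.+ b) ℚ.+ (c ℚ.+ d) ≡ (a ℚ.+ c) ℚ.+ (b ℚ.+ d)
  interchange = solve 4 (λ a b c d → (a :+ b) :+ (c :+ d) := (a :+ c) :+ (b :+ d)) refl
  product : ∀ a b c d → (a ℚ.* c ℚ.+ b ℚ.* d) ℚ.+ (a ℚ.* d ℚ.+ b ℚ.* c) ≡ (a ℚ.+ b) ℚ.* (c ℚ.+ d)
  product = solve 4 (λ a b c d → (a :* c :+ b :* d) :+ (a :* d :+ b :* c) := (a :+ b) :* (c :+ d)) refl

Re≤ : ∀ x → ℚ.∣ Re x ∣ ℚ.≤ ∥ x ∥₁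
Re≤ x = ℚ.≤-trans (ℚ.≤-reflexive (sym (ℚ.+-identityʳ ℚ.∣ Re x ∣))) (ℚ.+-monoʳ-≤ ℚ.∣ Re x ∣ (ℚ.0≤∣p∣ (Im x)))

Im≤ : ∀ x → ℚ.∣ Im x ∣ ℚ.≤ ∥ x ∥₁
Im≤ x = ℚ.≤-trans (ℚ.≤-reflexive (sym (ℚ.+-identityˡ ℚ.∣ Im x ∣))) (ℚ.+-monoˡ-≤ ℚ.∣ Im x ∣ (ℚ.0≤∣p∣ (Re x)))

-- Archimedean estimates

archimedean : ∀ x → ∃ λ K → x ℚ.≤ ℤ→ℚ (ℤ.+ K)
archimedean x@(mkℚ n d-1 _) = ℤ.∣ n ∣ , subst (x ℚ.≤_) (sym (ℤ→ℚ-fromℤ (ℤ.+ ℤ.∣ n ∣)))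
  (*≤* (ℤ.≤-trans (ℤ.≤-reflexive (ℤ.*-identityʳ n)) (ℤ.≤-trans (i≤∣i∣ n)
    (ℤ.≤-trans (ℤ.+≤+ (ℕ.m≤m*n ℤ.∣ n ∣ (suc d-1))) (ℤ.≤-reflexive (ℤ.pos-* ℤ.∣ n ∣ (suc d-1)))))))
  where
  i≤∣i∣ : ∀ i → i ℤ.≤ ℤ.+ ℤ.∣ i ∣
  i≤∣i∣ (ℤ.+ n)    = ℤ.≤-refl
  i≤∣i∣ -[1+ n ] = ℤ.-≤+

0<½^ : ∀ n → 0ℚ ℚ.< ½ ^ℚ n
0<½^ zero    = from-yes (0ℚ ℚ.<? 1ℚ)
0<½^ (suc n) = ℚ.positive⁻¹ _ {{ℚ.pos*pos⇒pos ½ (½ ^ℚ n) {{ℚ.positive (0<½^ n)}}}}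

0≤½^ : ∀ n → 0ℚ ℚ.≤ ½ ^ℚ n
0≤½^ n = ℚ.<⇒≤ (0<½^ n)

-- This is n + 1 ≤ 2 ^ n; it turns the Archimedean property into geometric decay.
½^*n≤1 : ∀ n → ½ ^ℚ n ℚ.* ℤ→ℚ (ℤ.+ suc n) ℚ.≤ 1ℚ
½^*n≤1 zero    = ℚ.≤-refl
½^*n≤1 (suc n) = ℚ.≤-trans
  (*-mono-≤ (0≤½^ (suc n)) ℚ.≤-refl (ℤ→ℚ-mono-≤ {0ℤ} {ℤ.+ suc (suc n)} (ℤ.+≤+ ℕ.z≤n)) (ℤ→ℚ-mono-≤ {ℤ.+ suc (suc n)} {ℤ.+ 2 ℤ.* ℤ.+ suc n} le))
  (ℚ.≤-trans (ℚ.≤-reflexive (trans (cong (½ ^ℚ suc n ℚ.*_) (ℤ→ℚ-* (ℤ.+ 2) (ℤ.+ suc n))) (halve (½ ^ℚ n) (ℤ→ℚ (ℤ.+ suc n)))))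
    (½^*n≤1 n))
  where
  le : ℤ.+ suc (suc n) ℤ.≤ ℤ.+ 2 ℤ.* ℤ.+ suc n
  le = ℤ.+≤+ (ℕ.s≤s (ℕ.≤-trans (ℕ.≤-reflexive (ℕ.+-comm 1 n)) (ℕ.+-monoʳ-≤ n (ℕ.s≤s ℕ.z≤n))))
  open +-*-Solver
  halve : ∀ p k → (½ ℚ.* p) ℚ.* (ℤ→ℚ (ℤ.+ 2) ℚ.* k) ≡ p ℚ.* k
  halve = solve 2 (λ p k → (con ½ :* p) :* (con (ℤ→ℚ (ℤ.+ 2)) :* k) := p :* k) refl

½^-small : ∀ C ε → 0ℚ ℚ.≤ C → 0ℚ ℚ.< ε → ∃ λ N → ∀ n → N ℕ.≤ n → ½ ^ℚ n ℚ.* C ℚ.< ε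
½^-small C ε 0≤C 0<ε with archimedean (C ℚ.* (1/ ε) {{ℚ.>-nonZero 0<ε}})
... | K , C/ε≤K = K , λ n K≤n → begin-strict
  ½ ^ℚ n ℚ.* C                                ≡⟨ cong (½ ^ℚ n ℚ.*_) C≡ ⟩
  ½ ^ℚ n ℚ.* (C ℚ.* 1/ ε ℚ.* ε)               ≡⟨ ℚ.*-assoc (½ ^ℚ n) (C ℚ.* 1/ ε) ε ⟨
  ½ ^ℚ n ℚ.* (C ℚ.* 1/ ε) ℚ.* ε               <⟨ ℚ.*-monoˡ-<-pos ε (below-1 n K≤n) ⟩
  1ℚ ℚ.* ε                                    ≡⟨ ℚ.*-identityˡ ε ⟩
  ε                                           ∎
  where
  open ℚ.≤-Reasoning
  instance
    pos : ℚ.Positive ε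
    pos = ℚ.positive 0<ε
    ε≢0 : NonZero ε
    ε≢0 = ℚ.>-nonZero 0<ε
  C≡ : C ≡ C ℚ.* 1/ ε ℚ.* ε
  C≡ = sym (trans (ℚ.*-assoc C (1/ ε) ε) (trans (cong (C ℚ.*_) (ℚ.*-inverseˡ ε)) (ℚ.*-identityʳ C)))
  below-1 : ∀ n → K ℕ.≤ n → ½ ^ℚ n ℚ.* (C ℚ.* 1/ ε) ℚ.< 1ℚ
  below-1 n K≤n = ℚ.<-≤-trans
    (ℚ.*-monoʳ-<-pos (½ ^ℚ n) {{ℚ.positive (0<½^ n)}}
      (ℚ.≤-<-trans C/ε≤K (ℤ→ℚ-mono-< {ℤ.+ K} {ℤ.+ suc n} (ℤ.+<+ (ℕ.s≤s K≤n)))))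
    (½^*n≤1 n)

-- A root as a limit

_at_ : ℂ → ℕ → ℚ[i]
z at n = seq (re z) n ⊹ seq (im z) n

private
  module ℂᴿ = RawRing ℂ-rawRing
  module G = NormedAlgebra ℚ[i]-normed

at-+ : ∀ z w n → (z ℂᴿ.+ w) at n ≡ (z at n) G.+ (w at n)
at-+ z w n = refl

at-* : ∀ z w n → (z ℂᴿ.* w) at n ≡ (z at n) G.* (w at n)
at-* z w n = refl

foldr-at : ∀ n {step : ℤ → ℂ → ℂ} {step′ : ℤ → ℚ[i] → ℚ[i]} {e e′} → e at n ≡ e′ →
  (∀ a r → step a r at n ≡ step′ a (r at n)) → ∀ p → foldr step e p at n ≡ foldr step′ e′ p
foldr-at n base hom []      = base
foldr-at n {step′ = step′} base hom (a ∷ p) = trans (hom a _) (cong (step′ a) (foldr-at n base hom p))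

-- Arithmetic in ℂ is termwise on Cauchy sequences, so the n-th term of a polynomial value is the
-- value at the n-th term.
evalℂ-at : ∀ p z n → evalℂ p z at n ≡ G.eval p (z at n)
evalℂ-at p z n = foldr-at n refl
  (λ a r → trans (at-+ (ℤ→ℂ a) (z ℂᴿ.* r) n) (cong (G.ι a G.+_) (at-* z r n))) p

module _ (p : Poly) (z : ℕ → ℚ[i]) {C δ : ℚ} (0≤C : 0ℚ ℚ.≤ C)
  (z-close : ∀ n k → G.‖ z n G.- z (n ℕ.+ k) ‖ ℚ.≤ ½ ^ℚ n ℚ.* C)
  (value-small : ∀ n → G.‖ G.eval p (z n) ‖ ℚ.≤ ½ ^ℚ n ℚ.* C)
  (0<δ : 0ℚ ℚ.< δ) (Im-large : ∀ n → δ ℚ.≤ ℚ.∣ Im (z n) ∣) where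

  private
    part : (g : ℚ[i] → ℚ) → (∀ x y → g (x G.- y) ≡ g x ℚ.- g y) → (∀ x → ℚ.∣ g x ∣ ℚ.≤ G.‖ x ‖) → ℝ
    part g g-- g≤ = mkℝ (λ n → g (z n)) cauchy′
      where
      ordered : ∀ ε n k → ½ ^ℚ n ℚ.* C ℚ.< ε → ℚ.∣ g (z n) ℚ.- g (z (n ℕ.+ k)) ∣ ℚ.< ε
      ordered ε n k small = ℚ.≤-<-trans
        (ℚ.≤-trans (ℚ.≤-reflexive (cong ℚ.∣_∣ (sym (g-- (z n) (z (n ℕ.+ k)))))) (ℚ.≤-trans (g≤ _) (z-close n k)))
        small
      cauchy′ : ∀ ε → 0ℚ ℚ.< ε → ∃ λ N → ∀ m n → N ℕ.≤ m → N ℕ.≤ n → ℚ.∣ g (z m) ℚ.- g (z n) ∣ ℚ.< ε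
      cauchy′ ε 0<ε with ½^-small C ε 0≤C 0<ε
      ... | N , small = N , go
        where
        flip : ∀ a b → ℚ.∣ a ℚ.- b ∣ ≡ ℚ.∣ b ℚ.- a ∣
        flip a b = trans (sym (ℚ.∣-p∣≡∣p∣ (a ℚ.- b))) (cong ℚ.∣_∣ (solve 2 (λ a b → :- (a :- b) := b :- a) refl a b))
          where open +-*-Solver
        go : ∀ m n → N ℕ.≤ m → N ℕ.≤ n → ℚ.∣ g (z m) ℚ.- g (z n) ∣ ℚ.< ε
        go m n N≤m N≤n with ℕ.≤-total m n
        ... | inj₁ m≤n = subst (λ k → ℚ.∣ g (z m) ℚ.- g (z k) ∣ ℚ.< ε) (ℕ.m+[n∸m]≡n m≤n) (ordered ε m (n ℕ.∸ m) (small m N≤m))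
        ... | inj₂ n≤m = ℚ.≤-<-trans (ℚ.≤-reflexive (flip (g (z m)) (g (z n))))
          (subst (λ k → ℚ.∣ g (z n) ℚ.- g (z k) ∣ ℚ.< ε) (ℕ.m+[n∸m]≡n n≤m) (ordered ε n (m ℕ.∸ n) (small n N≤n)))

    limit : ℂ
    limit = part Re (λ _ _ → refl) Re≤ +i part Im (λ _ _ → refl) Im≤

    vanishes : (g : ℚ[i] → ℚ) → (∀ x → ℚ.∣ g x ∣ ℚ.≤ G.‖ x ‖) → (y : ℝ) →
               (∀ n → seq y n ≡ g (G.eval p (z n))) → y ≈ᴿ 0ᴿ
    vanishes g g≤ y y≡ ε 0<ε with ½^-small C ε 0≤C 0<ε
    ... | N , small = N , λ n N≤n → ℚ.≤-<-trans
      (ℚ.≤-trans (ℚ.≤-reflexive (cong ℚ.∣_∣ (trans (ℚ.+-identityʳ (seq y n)) (y≡ n)))) (ℚ.≤-trans (g≤ _) (value-small n)))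
      (small n N≤n)

  -- The lower bound δ on ∣Im∣ is uniform in n, and therefore contradicts the convergence of the
  -- imaginary parts to 0.
  nonRealRoot : HasNonRealRoot p
  nonRealRoot = limit ,
    (vanishes Re Re≤ (re (evalℂ p limit)) (λ n → cong Re (evalℂ-at p limit n)) ,
     vanishes Im Im≤ (im (evalℂ p limit)) (λ n → cong Im (evalℂ-at p limit n))) ,
    λ im≈0 → case im≈0 δ 0<δ of λ (N , close) →
      ℚ.<-irrefl refl (ℚ.<-≤-trans (close N ℕ.≤-refl)
        (ℚ.≤-trans (Im-large N) (ℚ.≤-reflexive (cong ℚ.∣_∣ (sym (ℚ.+-identityʳ (Im (z N))))))))

-- The scale of the perturbation

crossing : ∀ {P : ℕ → Set} → (∀ n → Dec (P n)) → ∀ lo k → P lo → ¬ P (lo ℕ.+ k) →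
           ∃ λ q → lo ℕ.≤ q × P q × ¬ P (suc q)
crossing {P} P? lo zero plo ¬p = ⊥-elim (¬p (subst P (sym (ℕ.+-identityʳ lo)) plo))
crossing {P} P? lo (suc k) plo ¬p with P? (suc lo)
... | no ¬p′ = lo , ℕ.≤-refl , plo , ¬p′
... | yes p′ with crossing P? (suc lo) k p′ (λ p → ¬p (subst P (sym (ℕ.+-suc lo k)) p))
...   | q , lo<q , pq , ¬psq = q , ℕ.<⇒≤ lo<q , pq , ¬psq

-- The two bounds place n / (α q ^ r) between 1 and (1 + 1/q) ^ r, so rounding the r-th root of n /
-- α costs a relative error O(1/q).
integerRoot : ∀ r .{{_ : ℕ.NonZero r}} α .{{_ : ℕ.NonZero α}} lo n → α ℕ.* lo ℕ.^ r ℕ.≤ n →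
  ∃ λ q → lo ℕ.≤ q × α ℕ.* q ℕ.^ r ℕ.≤ n × n ℕ.≤ α ℕ.* suc q ℕ.^ r
-- A search over n + 1 steps is enough, as α (lo + n + 1) ^ r exceeds n.
integerRoot r α lo n start with crossing (λ q → α ℕ.* q ℕ.^ r ℕ.≤? n) lo (suc n) start overshoot
  where
  x≤x^r : ∀ r .{{_ : ℕ.NonZero r}} x .{{_ : ℕ.NonZero x}} → x ℕ.≤ x ℕ.^ r
  x≤x^r (suc r) x = ℕ.≤-trans (ℕ.≤-reflexive (sym (ℕ.*-identityʳ x))) (ℕ.*-monoʳ-≤ x (ℕ.m^n>0 x r))
  overshoot : ¬ (α ℕ.* (lo ℕ.+ suc n) ℕ.^ r ℕ.≤ n)
  overshoot le = ℕ.<-irrefl refl (ℕ.≤-trans (ℕ.≤-trans (ℕ.m≤n+m (suc n) lo)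
    (ℕ.≤-trans (x≤x^r r (lo ℕ.+ suc n) {{ℕ.>-nonZero (ℕ.≤-trans (ℕ.s≤s ℕ.z≤n) (ℕ.m≤n+m (suc n) lo))}})
      (ℕ.m≤n*m _ α))) le)
... | q , lo≤q , ≤n , ≰n = q , lo≤q , ≤n , ℕ.<⇒≤ (ℕ.≰⇒> ≰n)

module _ {Q x : ℚ} (Qx≡1 : Q ℚ.* x ≡ 1ℚ) where
  open Perturbation ℚ-normed using (^-distrib-*)

  1^ : ∀ r → 1ℚ ^ℚ r ≡ 1ℚ
  1^ zero    = refl
  1^ (suc r) = trans (ℚ.*-identityˡ (1ℚ ^ℚ r)) (1^ r)

  Q^x^ : ∀ r → Q ^ℚ r ℚ.* x ^ℚ r ≡ 1ℚ
  Q^x^ r = trans (sym (^-distrib-* Q x r)) (trans (cong (_^ℚ r) Qx≡1) (1^ r))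

  1+Q^x^ : ∀ r → (1ℚ ℚ.+ Q) ^ℚ r ℚ.* x ^ℚ r ≡ (1ℚ ℚ.+ x) ^ℚ r
  1+Q^x^ r = trans (sym (^-distrib-* (1ℚ ℚ.+ Q) x r)) (cong (_^ℚ r)
    (trans (solve 2 (λ Q x → (con 1ℚ :+ Q) :* x := Q :* x :+ x) refl Q x) (cong (ℚ._+ x) Qx≡1)))
    where open +-*-Solver

0≤growth : ∀ r → 0ℚ ℚ.≤ growth r
0≤growth zero    = ℚ.≤-refl
0≤growth (suc r) = 0≤+ (from-yes (0ℚ ℚ.≤? 1ℚ)) (0≤+ (0≤growth r) (0≤growth r))

-- The quadratic term of (1 + x)(1 + g x) is at most g x because x ≤ 1; this gives the recursion g ↦
-- 1 + 2g of `growth`.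
1+x^≤ : ∀ r {x} → 0ℚ ℚ.≤ x → x ℚ.≤ 1ℚ → (1ℚ ℚ.+ x) ^ℚ r ℚ.≤ 1ℚ ℚ.+ growth r ℚ.* x
1+x^≤ zero    {x} 0≤x x≤1 = ℚ.≤-reflexive (sym (trans (cong (1ℚ ℚ.+_) (ℚ.*-zeroˡ x)) (ℚ.+-identityʳ 1ℚ)))
1+x^≤ (suc r) {x} 0≤x x≤1 = ℚ.≤-trans
  (ℚ.*-monoˡ-≤-nonNeg (1ℚ ℚ.+ x) {{ℚ.nonNegative (0≤+ (from-yes (0ℚ ℚ.≤? 1ℚ)) 0≤x)}} (1+x^≤ r 0≤x x≤1))
  (ℚ.≤-trans (ℚ.≤-reflexive (expand (growth r) x))
    (ℚ.≤-trans (ℚ.+-monoʳ-≤ (1ℚ ℚ.+ (x ℚ.+ growth r ℚ.* x))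
        (*-mono-≤ (0≤* (0≤growth r) 0≤x) ℚ.≤-refl 0≤x x≤1))
      (ℚ.≤-reflexive (collect (growth r) x))))
  where
  open +-*-Solver
  expand : ∀ g x → (1ℚ ℚ.+ x) ℚ.* (1ℚ ℚ.+ g ℚ.* x) ≡ (1ℚ ℚ.+ (x ℚ.+ g ℚ.* x)) ℚ.+ (g ℚ.* x) ℚ.* x
  expand = solve 2 (λ g x → (con 1ℚ :+ x) :* (con 1ℚ :+ g :* x) := (con 1ℚ :+ (x :+ g :* x)) :+ (g :* x) :* x) refl
  collect : ∀ g x → (1ℚ ℚ.+ (x ℚ.+ g ℚ.* x)) ℚ.+ (g ℚ.* x) ℚ.* 1ℚ ≡ 1ℚ ℚ.+ (1ℚ ℚ.+ (g ℚ.+ g)) ℚ.* x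
  collect = solve 2 (λ g x → (con 1ℚ :+ (x :+ g :* x)) :+ (g :* x) :* con 1ℚ := con 1ℚ :+ (con 1ℚ :+ (g :+ g)) :* x) refl

ℕ→ℚ : ℕ → ℚ
ℕ→ℚ n = ℤ→ℚ (ℤ.+ n)

ℕ→ℚ-mono : ∀ {m n} → m ℕ.≤ n → ℕ→ℚ m ℚ.≤ ℕ→ℚ n
ℕ→ℚ-mono {m} {n} m≤n = ℤ→ℚ-mono-≤ {ℤ.+ m} {ℤ.+ n} (ℤ.+≤+ m≤n)

0≤ℕ→ℚ : ∀ n → 0ℚ ℚ.≤ ℕ→ℚ n
0≤ℕ→ℚ n = ℕ→ℚ-mono {0} {n} ℕ.z≤n

ℕ→ℚ-* : ∀ m n → ℕ→ℚ (m ℕ.* n) ≡ ℕ→ℚ m ℚ.* ℕ→ℚ n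
ℕ→ℚ-* m n = trans (cong ℤ→ℚ (ℤ.pos-* m n)) (ℤ→ℚ-* (ℤ.+ m) (ℤ.+ n))

ℕ→ℚ-^ : ∀ n r → ℕ→ℚ (n ℕ.^ r) ≡ ℕ→ℚ n ^ℚ r
ℕ→ℚ-^ n zero    = refl
ℕ→ℚ-^ n (suc r) = trans (ℕ→ℚ-* n (n ℕ.^ r)) (cong (ℕ→ℚ n ℚ.*_) (ℕ→ℚ-^ n r))

0≤^ : ∀ {x} → 0ℚ ℚ.≤ x → ∀ r → 0ℚ ℚ.≤ x ^ℚ r
0≤^ 0≤x zero    = from-yes (0ℚ ℚ.≤? 1ℚ)
0≤^ 0≤x (suc r) = 0≤* 0≤x (0≤^ 0≤x r)

module _ r α .{{_ : ℕ.NonZero α}} q .{{_ : ℕ.NonZero q}} n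
  (lower : α ℕ.* q ℕ.^ r ℕ.≤ n) (upper : n ℕ.≤ α ℕ.* suc q ℕ.^ r) where

  private
    x a θ : ℚ
    x = ℤ.+ 1 ℚ./ q
    a = ℤ.+ 1 ℚ./ α
    θ = ℕ→ℚ n ℚ.* (a ℚ.* x ^ℚ r)

    Qx≡1 : ℕ→ℚ q ℚ.* x ≡ 1ℚ
    Qx≡1 = trans (ℚ.*-comm (ℕ→ℚ q) x) (1/r*r q)

    0≤ax : 0ℚ ℚ.≤ a ℚ.* x ^ℚ r
    0≤ax = 0≤* (0≤1/r α) (0≤^ (0≤1/r q) r)

    scaled : ∀ p → (ℕ→ℚ α ℚ.* p) ℚ.* (a ℚ.* x ^ℚ r) ≡ p ℚ.* x ^ℚ r
    scaled p = trans (rearrange (ℕ→ℚ α) p a (x ^ℚ r)) (trans (cong (ℚ._* (p ℚ.* x ^ℚ r)) (1/r*r α)) (ℚ.*-identityˡ (p ℚ.* x ^ℚ r)))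
      where
      open +-*-Solver
      rearrange : ∀ b p a y → (b ℚ.* p) ℚ.* (a ℚ.* y) ≡ (a ℚ.* b) ℚ.* (p ℚ.* y)
      rearrange = solve 4 (λ b p a y → (b :* p) :* (a :* y) := (a :* b) :* (p :* y)) refl

    ℕ→ℚ-α*^ : ∀ k → ℕ→ℚ (α ℕ.* k ℕ.^ r) ≡ ℕ→ℚ α ℚ.* ℕ→ℚ k ^ℚ r
    ℕ→ℚ-α*^ k = trans (ℕ→ℚ-* α (k ℕ.^ r)) (cong (ℕ→ℚ α ℚ.*_) (ℕ→ℚ-^ k r))

  1≤ratio : 1ℚ ℚ.≤ θ
  1≤ratio = ℚ.≤-trans
    (ℚ.≤-reflexive (sym (trans (cong (ℚ._* (a ℚ.* x ^ℚ r)) (ℕ→ℚ-α*^ q)) (trans (scaled (ℕ→ℚ q ^ℚ r)) (Q^x^ Qx≡1 r)))))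
    (*-mono-≤ (0≤ℕ→ℚ (α ℕ.* q ℕ.^ r)) (ℕ→ℚ-mono lower) 0≤ax ℚ.≤-refl)

  x≤1 : x ℚ.≤ 1ℚ
  x≤1 = ℚ.≤-trans (ℚ.≤-reflexive (sym (ℚ.*-identityˡ x)))
    (ℚ.≤-trans (*-mono-≤ (from-yes (0ℚ ℚ.≤? 1ℚ)) (ℕ→ℚ-mono {1} {q} (ℕ.>-nonZero⁻¹ q)) (0≤1/r q) ℚ.≤-refl) (ℚ.≤-reflexive Qx≡1))

  ratio≤ : θ ℚ.≤ 1ℚ ℚ.+ growth r ℚ.* x
  ratio≤ = ℚ.≤-trans (*-mono-≤ (0≤ℕ→ℚ n) (ℕ→ℚ-mono upper) 0≤ax ℚ.≤-refl)
    (ℚ.≤-trans (ℚ.≤-reflexive (trans (cong (ℚ._* (a ℚ.* x ^ℚ r)) (ℕ→ℚ-α*^ (suc q)))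
        (trans (scaled (ℕ→ℚ (suc q) ^ℚ r)) (trans (cong (λ k → k ^ℚ r ℚ.* x ^ℚ r) (ℤ→ℚ-+ 1ℤ (ℤ.+ q))) (1+Q^x^ {ℕ→ℚ q} {x} Qx≡1 r)))))
      (1+x^≤ r (0≤1/r q) x≤1))

-- A nonzero integer has absolute value at least 1. Through this bound the integrality of h (b) and
-- of B (0) controls the sizes of l and μ.
ℤ-inverse : ∀ a → a ≢ 0ℤ → ∃ λ x → x ℚ.* ℤ→ℚ a ≡ 1ℚ × ℚ.∣ x ∣ ℚ.≤ 1ℚ
ℤ-inverse a a≢0 = go a a≢0
  where
  1/n≤1 : ∀ n → ℤ.+ 1 ℚ./ suc n ℚ.≤ 1ℚ
  1/n≤1 n = ℚ.≤-trans (ℚ.≤-reflexive (sym (ℚ.*-identityʳ (ℤ.+ 1 ℚ./ suc n))))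
    (ℚ.≤-trans (*-mono-≤ (0≤1/r (suc n)) ℚ.≤-refl (from-yes (0ℚ ℚ.≤? 1ℚ)) (ℕ→ℚ-mono {1} {suc n} (ℕ.s≤s ℕ.z≤n)))
      (ℚ.≤-reflexive (1/r*r (suc n))))
  ∣1/n∣≤1 : ∀ n → ℚ.∣ ℤ.+ 1 ℚ./ suc n ∣ ℚ.≤ 1ℚ
  ∣1/n∣≤1 n = ℚ.≤-trans (ℚ.≤-reflexive (ℚ.0≤p⇒∣p∣≡p (0≤1/r (suc n)))) (1/n≤1 n)
  go : ∀ a → a ≢ 0ℤ → ∃ λ x → x ℚ.* ℤ→ℚ a ≡ 1ℚ × ℚ.∣ x ∣ ℚ.≤ 1ℚ
  go (ℤ.+ zero) a≢0 = ⊥-elim (a≢0 refl)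
  go +[1+ n ] _ = ℤ.+ 1 ℚ./ suc n , 1/r*r (suc n) , ∣1/n∣≤1 n
  go -[1+ n ] _ = ℚ.- (ℤ.+ 1 ℚ./ suc n) ,
    trans (cong (ℚ.- (ℤ.+ 1 ℚ./ suc n) ℚ.*_) (ℤ→ℚ-neg +[1+ n ]))
      (trans (solve 2 (λ a b → :- a :* :- b := a :* b) refl (ℤ.+ 1 ℚ./ suc n) (ℤ→ℚ +[1+ n ])) (1/r*r (suc n))) ,
    ℚ.≤-trans (ℚ.≤-reflexive (ℚ.∣-p∣≡∣p∣ (ℤ.+ 1 ℚ./ suc n))) (∣1/n∣≤1 n)
    where open +-*-Solver

module _ (A : ℤ-Algebra) where
  open ℤ-Algebra A

  eval-ι : ∀ p a → eval p (ι a) ≡ ι (evalℤ p a)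
  eval-ι []      a = sym ι-0
  eval-ι (b ∷ p) a = trans (cong (λ r → ι b + ι a * r) (eval-ι p a))
    (sym (trans (ι-+ b (a ℤ.* evalℤ p a)) (cong (ι b +_) (ι-* a (evalℤ p a)))))

  eval-map-* : ∀ a p x → eval (map (a ℤ.*_) p) x ≡ ι a * eval p x
  eval-map-* a []      x = sym (zeroʳ (ι a))
  eval-map-* a (b ∷ p) x = trans (cong₂ (λ c r → c + x * r) (ι-* a b) (eval-map-* a p x))
    (factor-out (ι a) (ι b) x (eval p x))
    where
    open ℤ-Solver A
    factor-out : ∀ a b x r → a * b + x * (a * r) ≡ a * (b + x * r)
    factor-out = solve 4 (λ a b x r → a :* b :+ x :* (a :* r) := a :* (b :+ x :* r)) refl

-- K vanishes to order r at b, and B is the remaining factor in the local coordinate y.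
record Expansion (𝔸 : NormedAlgebra) (r : ℕ) (K B : Poly) (b : ℤ) : Set where
  open NormedAlgebra 𝔸
  field
    b-unit : ‖ ι b ‖ ℚ.≤ 1ℚ
    factor : ∀ y → eval K (ι b * (ι 1ℤ + y)) ≡ y ^ r * eval B y

-- u₀ is an approximate r-th root of sgn · β / B (0).
record Direction (𝔸 : NormedAlgebra) (r : ℕ) (B : Poly) (sgn : ℤ) (β : ℕ) (u₀ : NormedAlgebra.Carrier 𝔸) : Set where
  open NormedAlgebra 𝔸
  field
    B₀≢0  : evalℤ B 0ℤ ≢ 0ℤ
    u₀≤2  : ‖ u₀ ‖ ℚ.≤ ℤ.+ 2 ℚ./ 1
    w     : Carrier
    w≈1   : ‖ w - ι 1ℤ ‖ ℚ.≤ ℤ.+ 1 ℚ./ 200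
    power : ι sgn * (ι (ℤ.+ β) * w) ≡ ι (evalℤ B 0ℤ) * u₀ ^ r

-- With c = u₀ / q the hypotheses of `Root` hold: μ B (0) becomes θ w, where θ carries the rounding
-- of q and w that of u₀. The bound 512 C ≤ q gives C ε ≤ 1/256 for ε = 2/q, and 1920 = 15 · 128
-- gives θ - 1 ≤ 15/q ≤ 1/128.
module Scaled (𝔸 : NormedAlgebra) (r : ℕ) .{{_ : ℕ.NonZero r}} (bounds : ContractionBounds r)
  (h K B : Poly) (b : ℤ) (expansion : Expansion 𝔸 r K B b)
  (sgn : ℤ) (α : ℕ) .{{_ : ℕ.NonZero α}} (h[b] : ℤ.- evalℤ h b ≡ sgn ℤ.* ℤ.+ α) (h[b]≢0 : evalℤ h b ≢ 0ℤ)
  (β : ℕ) {u₀ : NormedAlgebra.Carrier 𝔸} (direction : Direction 𝔸 r B sgn β u₀)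
  {M M′ C : ℚ} (0≤C : 0ℚ ℚ.≤ C)
  (h-lip : Lipschitz.Lip 𝔸 (ℤ.+ 3 ℚ./ 1) (NormedAlgebra.eval 𝔸 h) M C)
  (B-lip : Lipschitz.Lip 𝔸 (ℤ.+ 3 ℚ./ 1) (NormedAlgebra.eval 𝔸 B) M′ C)
  (m q : ℕ) .{{_ : ℕ.NonZero q}}
  (lower : α ℕ.* q ℕ.^ r ℕ.≤ β ℕ.* m) (upper : β ℕ.* m ℕ.≤ α ℕ.* suc q ℕ.^ r)
  (large : ℤ.+ 512 ℚ./ 1 ℚ.* C ℚ.≤ ℕ→ℚ q) (large′ : 1920 ℕ.≤ q) where

  open NormedAlgebra 𝔸
  open Lipschitz 𝔸
  open Perturbation 𝔸
  open Expansion expansion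
  open Direction direction

  private
    x a θ : ℚ
    x = ℤ.+ 1 ℚ./ q
    a = ℤ.+ 1 ℚ./ α
    θ = ℕ→ℚ (β ℕ.* m) ℚ.* (a ℚ.* x ^ℚ r)

  c l : Carrier
  c = κ x * u₀
  l = κ (ℚ.- proj₁ (ℤ-inverse (evalℤ h b) h[b]≢0))

  private
    0≤x : 0ℚ ℚ.≤ x
    0≤x = 0≤1/r q

    Qx≡1 : ℕ→ℚ q ℚ.* x ≡ 1ℚ
    Qx≡1 = trans (ℚ.*-comm (ℕ→ℚ q) x) (1/r*r q)

    *x≤1 : ∀ {k} → k ℚ.≤ ℕ→ℚ q → k ℚ.* x ℚ.≤ 1ℚ
    *x≤1 k≤q = ℚ.≤-trans (ℚ.*-monoʳ-≤-nonNeg x {{ℚ.nonNegative 0≤x}} k≤q) (ℚ.≤-reflexive Qx≡1)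

    ε : ℚ
    ε = x ℚ.* (ℤ.+ 2 ℚ./ 1)

    κx≤x : ‖ κ x ‖ ℚ.≤ x
    κx≤x = ℚ.≤-reflexive (trans (‖κ‖ x) (ℚ.0≤p⇒∣p∣≡p 0≤x))

    c≤ε : ‖ c ‖ ℚ.≤ ε
    c≤ε = ‖*‖≤ (κ x) u₀ κx≤x u₀≤2

    ε≤1 : ε ℚ.≤ 1ℚ
    ε≤1 = ℚ.≤-trans (ℚ.≤-reflexive (ℚ.*-comm x (ℤ.+ 2 ℚ./ 1)))
      (*x≤1 (ℕ→ℚ-mono {2} {q} (ℕ.≤-trans (ℕ.s≤s (ℕ.s≤s ℕ.z≤n)) large′)))

    Cε≤ : C ℚ.* ε ℚ.≤ ℤ.+ 1 ℚ./ 256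
    Cε≤ = ℚ.≤-trans (ℚ.≤-reflexive (rescale C x))
      (ℚ.*-monoˡ-≤-nonNeg (ℤ.+ 1 ℚ./ 256) (*x≤1 large))
      where
      open +-*-Solver
      rescale : ∀ C x → C ℚ.* (x ℚ.* (ℤ.+ 2 ℚ./ 1)) ≡ (ℤ.+ 1 ℚ./ 256) ℚ.* ((ℤ.+ 512 ℚ./ 1) ℚ.* C ℚ.* x)
      rescale = solve 2 (λ C x → C :* (x :* con (ℤ.+ 2 ℚ./ 1)) := con (ℤ.+ 1 ℚ./ 256) :* (con (ℤ.+ 512 ℚ./ 1) :* C :* x)) refl

    l≤1 : ‖ l ‖ ℚ.≤ 1ℚ
    l≤1 = ℚ.≤-trans (ℚ.≤-reflexive (trans (‖κ‖ _) (ℚ.∣-p∣≡∣p∣ inv))) (proj₂ (proj₂ (ℤ-inverse (evalℤ h b) h[b]≢0)))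
      where inv = proj₁ (ℤ-inverse (evalℤ h b) h[b]≢0)

    l-inverse′ : l * ι (evalℤ h b) ≡ - ι 1ℤ
    l-inverse′ = trans (cong (l *_) (sym (κ-ℤ (evalℤ h b)))) (trans (sym (κ-* _ _))
      (trans (cong κ (trans (sym (ℚ.neg-distribˡ-* inv (ℤ→ℚ (evalℤ h b)))) (cong ℚ.-_ (proj₁ (proj₂ (ℤ-inverse (evalℤ h b) h[b]≢0))))))
        (trans (κ-ℤ -1ℤ) (ι-neg 1ℤ))))
      where inv = proj₁ (ℤ-inverse (evalℤ h b) h[b]≢0)

    l-inverse : l * eval h (ι b) ≡ - ι 1ℤ
    l-inverse = trans (cong (l *_) (eval-ι algebra h b)) l-inverse′

    a-inverse : κ a * ι (ℤ.+ α) ≡ ι 1ℤ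
    a-inverse = trans (cong (κ a *_) (sym (κ-ℤ (ℤ.+ α)))) (trans (sym (κ-* _ _)) (trans (cong κ (1/r*r α)) (κ-ℤ 1ℤ)))

    l-sgn : l * ι sgn ≡ κ a
    l-sgn = trans (insert (l * ι sgn)) (trans (cong ((l * ι sgn) *_) (sym a-inverse))
      (trans (regroup l (ι sgn) (κ a) (ι (ℤ.+ α)))
      (trans (cong (λ z → l * z * κ a) (trans (sym (ι-* sgn (ℤ.+ α))) (trans (cong ι (sym h[b])) (ι-neg (evalℤ h b)))))
      (trans (negate l (ι (evalℤ h b)) (κ a))
      (trans (cong (λ z → - z * κ a) l-inverse′)
        (unit (κ a)))))))
      where
      open ℤ-Solver algebra
      insert : ∀ y → y ≡ y * ι 1ℤ
      insert = solve 1 (λ y → y := y :* con 1ℤ) refl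
      regroup : ∀ l s a b → (l * s) * (a * b) ≡ l * (s * b) * a
      regroup = solve 4 (λ l s a b → (l :* s) :* (a :* b) := l :* (s :* b) :* a) refl
      negate : ∀ l b a → l * (- b) * a ≡ - (l * b) * a
      negate = solve 3 (λ l b a → l :* (:- b) :* a := :- (l :* b) :* a) refl
      unit : ∀ a → - (- ι 1ℤ) * a ≡ a
      unit = solve 1 (λ a → :- (:- con 1ℤ) :* a := a) refl

    κ-^ : ∀ y k → κ (y ^ℚ k) ≡ κ y ^ k
    κ-^ y zero    = trans (κ-ℤ 1ℤ) ι-1
    κ-^ y (suc k) = trans (κ-* y (y ^ℚ k)) (cong (κ y *_) (κ-^ y k))

    B₀≡ : eval B 0# ≡ ι (evalℤ B 0ℤ)
    B₀≡ = trans (cong (eval B) (sym ι-0)) (eval-ι algebra B 0ℤ)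

    μ : Carrier
    μ = l * (ι (ℤ.+ m) * c ^ r)

    -- Since l · sgn = 1/α and B (0) u₀ ^ r = sgn β w, all that remains of μ B (0) is β m / (α q ^
    -- r) times w.
    μB₀≡ : μ * ι (evalℤ B 0ℤ) ≡ κ θ * w
    μB₀≡ = trans (cong (λ z → l * (ι (ℤ.+ m) * z) * ι (evalℤ B 0ℤ)) (^-distrib-* (κ x) u₀ r))
      (trans (regroup l (ι (ℤ.+ m)) (κ x ^ r) (u₀ ^ r) (ι (evalℤ B 0ℤ)))
      (trans (cong (λ z → l * ι (ℤ.+ m) * κ x ^ r * z) (sym power))
      (trans (regroup′ l (ι (ℤ.+ m)) (κ x ^ r) (ι sgn) (ι (ℤ.+ β)) w)
      (trans (cong (λ z → (ι (ℤ.+ β) * ι (ℤ.+ m)) * (z * κ x ^ r) * w) l-sgn)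
        (cong (_* w) (sym κθ))))))
      where
      open ℤ-Solver algebra
      regroup : ∀ l m y u B → l * (m * (y * u)) * B ≡ l * m * y * (B * u)
      regroup = solve 5 (λ l m y u B → l :* (m :* (y :* u)) :* B := l :* m :* y :* (B :* u)) refl
      regroup′ : ∀ l m y s β w → l * m * y * (s * (β * w)) ≡ (β * m) * ((l * s) * y) * w
      regroup′ = solve 6 (λ l m y s β w → l :* m :* y :* (s :* (β :* w)) := (β :* m) :* ((l :* s) :* y) :* w) refl
      κθ : κ θ ≡ (ι (ℤ.+ β) * ι (ℤ.+ m)) * (κ a * κ x ^ r)
      κθ = trans (κ-* _ _) (cong₂ _*_
        (trans (κ-ℤ (ℤ.+ (β ℕ.* m))) (trans (cong ι (ℤ.pos-* β m)) (ι-* (ℤ.+ β) (ℤ.+ m))))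
        (trans (κ-* _ _) (cong (κ a *_) (κ-^ x r))))

    w≤ : ‖ w ‖ ℚ.≤ ℤ.+ 201 ℚ./ 200
    w≤ = ℚ.≤-trans (ℚ.≤-reflexive (cong ‖_‖ (solve 1 (λ w → w := (w :- con 1ℤ) :+ con 1ℤ) refl w)))
      (‖+‖≤ (w - ι 1ℤ) (ι 1ℤ) w≈1 ‖ι1‖≤1)
      where open ℤ-Solver algebra

    θ-1≤ : ‖ κ (θ ℚ.- 1ℚ) ‖ ℚ.≤ ℤ.+ 1 ℚ./ 128
    θ-1≤ = ℚ.≤-trans
      (ℚ.≤-reflexive (trans (‖κ‖ _) (ℚ.0≤p⇒∣p∣≡p (ℚ.≤-trans (ℚ.≤-reflexive (sym (ℚ.+-inverseʳ 1ℚ))) (ℚ.+-monoˡ-≤ (ℚ.- 1ℚ) (1≤ratio r α q (β ℕ.* m) lower upper))))))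
      (ℚ.≤-trans (ℚ.+-monoˡ-≤ (ℚ.- 1ℚ) (ratio≤ r α q (β ℕ.* m) lower upper))
      (ℚ.≤-trans (ℚ.≤-reflexive (drop-1 (growth r ℚ.* x)))
      (ℚ.≤-trans (ℚ.*-monoʳ-≤-nonNeg x {{ℚ.nonNegative 0≤x}} (proj₂ (proj₂ bounds)))
      (ℚ.≤-trans (ℚ.≤-reflexive (rescale x))
        (ℚ.*-monoˡ-≤-nonNeg (ℤ.+ 1 ℚ./ 128) (*x≤1 (ℕ→ℚ-mono {1920} {q} large′)))))))
      where
      open +-*-Solver
      drop-1 : ∀ y → (1ℚ ℚ.+ y) ℚ.- 1ℚ ≡ y
      drop-1 = solve 1 (λ y → (con 1ℚ :+ y) :- con 1ℚ := y) refl
      rescale : ∀ x → (ℤ.+ 15 ℚ./ 1) ℚ.* x ≡ (ℤ.+ 1 ℚ./ 128) ℚ.* (ℕ→ℚ 1920 ℚ.* x)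
      rescale = solve 1 (λ x → con (ℤ.+ 15 ℚ./ 1) :* x := con (ℤ.+ 1 ℚ./ 128) :* (con (ℕ→ℚ 1920) :* x)) refl

    θw≈1 : ‖ κ θ * w - ι 1ℤ ‖ ℚ.≤ ℤ.+ 1 ℚ./ 48
    θw≈1 = ℚ.≤-trans (ℚ.≤-reflexive (cong ‖_‖ (trans (cong (λ z → z * w - ι 1ℤ) κθ) (regroup (κ (θ ℚ.- 1ℚ)) w))))
      (ℚ.≤-trans (‖+‖≤ (κ (θ ℚ.- 1ℚ) * w) (w - ι 1ℤ) (‖*‖≤ (κ (θ ℚ.- 1ℚ)) w θ-1≤ w≤) w≈1)
        (from-yes (ℤ.+ 1 ℚ./ 128 ℚ.* (ℤ.+ 201 ℚ./ 200) ℚ.+ ℤ.+ 1 ℚ./ 200 ℚ.≤? ℤ.+ 1 ℚ./ 48)))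
      where
      κθ : κ θ ≡ κ (θ ℚ.- 1ℚ) + ι 1ℤ
      κθ = trans (cong κ (+-*-Solver.solve 1 (λ y → y := (y :- con 1ℚ) :+ con 1ℚ) refl θ))
        (trans (κ-+ (θ ℚ.- 1ℚ) 1ℚ) (cong (κ (θ ℚ.- 1ℚ) +_) (κ-ℤ 1ℤ)))
        where open +-*-Solver using (_:=_; _:+_; _:-_; con)
      regroup : ∀ d w → (d + ι 1ℤ) * w - ι 1ℤ ≡ d * w + (w - ι 1ℤ)
      regroup = solve 2 (λ d w → (d :+ con 1ℤ) :* w :- con 1ℤ := d :* w :+ (w :- con 1ℤ)) refl
        where open ℤ-Solver algebra

    μB≈1 : ‖ μ * eval B 0# - ι 1ℤ ‖ ℚ.≤ ℤ.+ 1 ℚ./ 48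
    μB≈1 = ℚ.≤-trans (ℚ.≤-reflexive (cong (λ z → ‖ z - ι 1ℤ ‖) (trans (cong (μ *_) B₀≡) μB₀≡))) θw≈1

    -- μ B (0) is close to 1, and dividing by the nonzero integer B (0) does not increase the norm.
    μ≤2 : ‖ μ ‖ ℚ.≤ ℤ.+ 2 ℚ./ 1
    μ≤2 with ℤ-inverse (evalℤ B 0ℤ) B₀≢0
    ... | d , dB≡1 , d≤1 = ℚ.≤-trans (ℚ.≤-reflexive (cong ‖_‖ μ≡))
      (ℚ.≤-trans (‖*‖≤ (κ θ * w) (κ d) θw≤ (ℚ.≤-trans (ℚ.≤-reflexive (‖κ‖ d)) d≤1))
        (from-yes ((ℤ.+ 1 ℚ./ 48 ℚ.+ 1ℚ) ℚ.* 1ℚ ℚ.≤? ℤ.+ 2 ℚ./ 1)))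
      where
      open ℤ-Solver algebra
      θw≤ : ‖ κ θ * w ‖ ℚ.≤ ℤ.+ 1 ℚ./ 48 ℚ.+ 1ℚ
      θw≤ = ℚ.≤-trans (ℚ.≤-reflexive (cong ‖_‖ (solve 1 (λ w → w := (w :- con 1ℤ) :+ con 1ℤ) refl (κ θ * w))))
        (‖+‖≤ (κ θ * w - ι 1ℤ) (ι 1ℤ) θw≈1 ‖ι1‖≤1)
      μ≡ : μ ≡ κ θ * w * κ d
      μ≡ = trans (solve 1 (λ y → y := y :* con 1ℤ) refl μ)
        (trans (cong (μ *_) (sym (trans (cong (κ d *_) (sym (κ-ℤ (evalℤ B 0ℤ)))) (trans (sym (κ-* _ _)) (trans (cong κ dB≡1) (κ-ℤ 1ℤ))))))
        (trans (solve 3 (λ μ d b → μ :* (d :* b) := (μ :* b) :* d) refl μ (κ d) (ι (evalℤ B 0ℤ)))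
          (cong (_* κ d) μB₀≡)))

  open Root r bounds h K B (ℤ.+ m) (ι b) c l factor l-inverse 0≤C h-lip B-lip b-unit l≤1 c≤ε ε≤1 Cε≤ μ≤2 μB≈1 public

  -- The sum dominates both the constant in the distance of the iterates and that in their
  -- residuals, since `HasLimits` asks for a common one.
  limitConstant : ℚ
  limitConstant = ρ ℚ.+ ‖ eval h (ι b) ‖ ℚ.* (‖ ι (ℤ.+ r) ‖ ℚ.* ρ)

  private
    valueConstant : ℚ
    valueConstant = ‖ eval h (ι b) ‖ ℚ.* (‖ ι (ℤ.+ r) ‖ ℚ.* ρ)

    0≤ρ : 0ℚ ℚ.≤ ρ
    0≤ρ = from-yes (0ℚ ℚ.≤? ρ)

    0≤valueConstant : 0ℚ ℚ.≤ valueConstant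
    0≤valueConstant = 0≤* (0≤‖‖ (eval h (ι b))) (0≤* (0≤‖‖ (ι (ℤ.+ r))) 0≤ρ)

  0≤limitConstant : 0ℚ ℚ.≤ limitConstant
  0≤limitConstant = 0≤+ 0≤ρ 0≤valueConstant

  point-close : ∀ n k → ‖ point (iterate n) - point (iterate (n ℕ.+ k)) ‖ ℚ.≤ ½ ^ℚ n ℚ.* limitConstant
  point-close n k = ℚ.≤-trans
    (ℚ.≤-reflexive (cong ‖_‖ (difference (ι b) (ι b * c) (iterate n) (iterate (n ℕ.+ k)))))
    (ℚ.≤-trans (‖*‖≤ (ι b * c) _ (ℚ.≤-trans bc≤ε ε≤1) (iterate-close n k))
    (ℚ.≤-trans (ℚ.≤-reflexive (ℚ.*-identityˡ (½ ^ℚ n ℚ.* ρ)))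
      (ℚ.*-monoˡ-≤-nonNeg (½ ^ℚ n) {{ℚ.nonNegative (0≤½^ n)}}
        (ℚ.≤-trans (ℚ.≤-reflexive (sym (ℚ.+-identityʳ ρ))) (ℚ.+-monoʳ-≤ ρ 0≤valueConstant)))))
    where
    open ℤ-Solver algebra
    difference : ∀ b d u v → (b + d * 1+ u) - (b + d * 1+ v) ≡ d * (u - v)
    difference = solve 4 (λ b d u v → (b :+ d :* (con 1ℤ :+ u)) :- (b :+ d :* (con 1ℤ :+ v)) := d :* (u :- v)) refl

  eval-point-small : ∀ n → ‖ eval (h +ᴾ map (ℤ.+ m ℤ.*_) K) (point (iterate n)) ‖ ℚ.≤ ½ ^ℚ n ℚ.* limitConstant
  eval-point-small n = ℚ.≤-trans
    (ℚ.≤-reflexive (cong ‖_‖ (trans (FPolynomials.eval-+ᴾ algebra h _ y) (cong (eval h y +_) (eval-map-* algebra (ℤ.+ m) K y)))))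
    (ℚ.≤-trans (value-small n)
    (ℚ.≤-trans (ℚ.≤-reflexive (pull-out ‖ eval h (ι b) ‖ ‖ ι (ℤ.+ r) ‖ (½ ^ℚ n) ρ))
      (ℚ.*-monoˡ-≤-nonNeg (½ ^ℚ n) {{ℚ.nonNegative (0≤½^ n)}}
        (ℚ.≤-trans (ℚ.≤-reflexive (sym (ℚ.+-identityˡ valueConstant))) (ℚ.+-monoˡ-≤ valueConstant 0≤ρ)))))
    where
    y = point (iterate n)
    open +-*-Solver
    pull-out : ∀ a b p r → a ℚ.* (b ℚ.* (p ℚ.* r)) ≡ p ℚ.* (a ℚ.* (b ℚ.* r))
    pull-out = solve 4 (λ a b p r → a :* (b :* (p :* r)) := p :* (a :* (b :* r))) refl

  -- Isolates the rational factor b/q, by which the imaginary part of u₀ (1 + u) is multiplied.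
  point-scaled : ∀ u → point u ≡ ι b + κ (ℤ→ℚ b ℚ.* (ℤ.+ 1 ℚ./ q)) * (u₀ * 1+ u)
  point-scaled u = trans (solve 4 (λ b y u₀ v → b :+ b :* (y :* u₀) :* v := b :+ (b :* y) :* (u₀ :* v)) refl (ι b) (κ x) u₀ (1+ u))
    (cong (λ z → ι b + z * (u₀ * 1+ u)) (trans (cong (_* κ x) (sym (κ-ℤ b))) (sym (κ-* _ _))))
    where open ℤ-Solver algebra

p≤∣p∣ : ∀ p → p ℚ.≤ ℚ.∣ p ∣
p≤∣p∣ p with ℚ.≤-total 0ℚ p
... | inj₁ 0≤p = ℚ.≤-reflexive (sym (ℚ.0≤p⇒∣p∣≡p 0≤p))
... | inj₂ p≤0 = ℚ.≤-trans p≤0 (ℚ.0≤∣p∣ p)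

+-cancelʳ-≤ : ∀ {a c} b → a ℚ.+ b ℚ.≤ c ℚ.+ b → a ℚ.≤ c
+-cancelʳ-≤ {a} {c} b a+b≤c+b = subst₂ ℚ._≤_ (cancel a b) (cancel c b) (ℚ.+-monoˡ-≤ (ℚ.- b) a+b≤c+b)
  where
  open +-*-Solver
  cancel : ∀ a b → (a ℚ.+ b) ℚ.- b ≡ a
  cancel = solve 2 (λ a b → (a :+ b) :- b := a) refl


-- Imaginary parts of the iterates and the threshold for m

record ComplexAlgebra : Set₁ where
  field
    normed : NormedAlgebra
  open NormedAlgebra normed using (Carrier; _+_; _*_; ι; κ; ‖_‖)
  field
    Imag     : Carrier → ℚ
    Imag-+   : ∀ x y → Imag (x + y) ≡ Imag x ℚ.+ Imag y
    Imag-ι   : ∀ a → Imag (ι a) ≡ 0ℚ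
    Imag-κ*  : ∀ a x → Imag (κ a * x) ≡ a ℚ.* Imag x
    ∣Imag∣≤  : ∀ x → ℚ.∣ Imag x ∣ ℚ.≤ ‖ x ‖

HasLimits : ComplexAlgebra → Set
HasLimits 𝔾 = ∀ p (z : ℕ → Carrier) {C δ} → 0ℚ ℚ.≤ C →
    (∀ n k → ‖ z n - z (n ℕ.+ k) ‖ ℚ.≤ ½ ^ℚ n ℚ.* C) →
    (∀ n → ‖ eval p (z n) ‖ ℚ.≤ ½ ^ℚ n ℚ.* C) →
    0ℚ ℚ.< δ → (∀ n → δ ℚ.≤ ℚ.∣ Imag (z n) ∣) → HasNonRealRoot p
  where
  open ComplexAlgebra 𝔾
  open NormedAlgebra normed

module _ (𝔾 : ComplexAlgebra) (limit : HasLimits 𝔾) where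
  open ComplexAlgebra 𝔾
  open NormedAlgebra normed
  open Lipschitz normed

  -- The factor 1 + u moves the imaginary part of u₀ by at most ‖u₀‖ ρ.
  ∣Imag∣≥ : ∀ u₀ {δ} → δ ℚ.+ ‖ u₀ ‖ ℚ.* ρ ℚ.≤ Imag u₀ → ∀ u → ‖ u ‖ ℚ.≤ ρ → δ ℚ.≤ ℚ.∣ Imag (u₀ * (ι 1ℤ + u)) ∣
  ∣Imag∣≥ u₀ {δ} large u u≤ρ = +-cancelʳ-≤ (‖ u₀ ‖ ℚ.* ρ) (begin
    δ ℚ.+ ‖ u₀ ‖ ℚ.* ρ                 ≤⟨ large ⟩
    Imag u₀                            ≡⟨ Imag-u₀ ⟩
    y ℚ.- z                            ≤⟨ p≤∣p∣ (y ℚ.- z) ⟩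
    ℚ.∣ y ℚ.- z ∣                      ≤⟨ ℚ.∣p-q∣≤∣p∣+∣q∣ y z ⟩
    ℚ.∣ y ∣ ℚ.+ ℚ.∣ z ∣                ≤⟨ ℚ.+-monoʳ-≤ ℚ.∣ y ∣ (ℚ.≤-trans (∣Imag∣≤ (u₀ * u)) (‖*‖≤ u₀ u ℚ.≤-refl u≤ρ)) ⟩
    ℚ.∣ y ∣ ℚ.+ ‖ u₀ ‖ ℚ.* ρ           ∎)
    where
    open ℚ.≤-Reasoning
    y z : ℚ
    y = Imag (u₀ * (ι 1ℤ + u))
    z = Imag (u₀ * u)
    y≡ : y ≡ Imag u₀ ℚ.+ z
    y≡ = trans (cong Imag (solve 2 (λ a b → a :* (con 1ℤ :+ b) := a :+ a :* b) refl u₀ u)) (Imag-+ u₀ (u₀ * u))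
      where open ℤ-Solver algebra
    Imag-u₀ : Imag u₀ ≡ y ℚ.- z
    Imag-u₀ = trans (solve 2 (λ a b → a := (a :+ b) :- b) refl (Imag u₀) z) (cong (ℚ._- z) (sym y≡))
      where open +-*-Solver

  module _ (r : ℕ) .{{_ : ℕ.NonZero r}} (bounds : ContractionBounds r)
    (h K B : Poly) (b : ℤ) (expansion : Expansion normed r K B b) (∣b∣≡1 : ℚ.∣ ℤ→ℚ b ∣ ≡ 1ℚ)
    (sgn : ℤ) (α : ℕ) .{{_ : ℕ.NonZero α}} (h[b] : ℤ.- evalℤ h b ≡ sgn ℤ.* ℤ.+ α) (h[b]≢0 : evalℤ h b ≢ 0ℤ)
    (β : ℕ) .{{_ : ℕ.NonZero β}} {u₀ : Carrier} (direction : Direction normed r B sgn β u₀)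
    (u₀-nonReal : ½ ℚ.+ ‖ u₀ ‖ ℚ.* ρ ℚ.≤ Imag u₀) where

    module _ {M M′ C : ℚ} (0≤C : 0ℚ ℚ.≤ C)
      (h-lip : Lip (ℤ.+ 3 ℚ./ 1) (eval h) M C) (B-lip : Lip (ℤ.+ 3 ℚ./ 1) (eval B) M′ C)
      (m q : ℕ) .{{_ : ℕ.NonZero q}}
      (lower : α ℕ.* q ℕ.^ r ℕ.≤ β ℕ.* m) (upper : β ℕ.* m ℕ.≤ α ℕ.* suc q ℕ.^ r)
      (large : ℤ.+ 512 ℚ./ 1 ℚ.* C ℚ.≤ ℕ→ℚ q) (large′ : 1920 ℕ.≤ q) where

      private
        module S = Scaled normed r bounds h K B b expansion sgn α h[b] h[b]≢0 β direction
                     0≤C h-lip B-lip m q lower upper large large′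
        x : ℚ
        x = ℤ.+ 1 ℚ./ q

        Imag-scaled : ∀ s v → Imag (ι b + κ s * v) ≡ s ℚ.* Imag v
        Imag-scaled s v = trans (Imag-+ (ι b) (κ s * v))
          (trans (cong₂ ℚ._+_ (Imag-ι b) (Imag-κ* s v)) (ℚ.+-identityˡ (s ℚ.* Imag v)))

        ∣Imag-scaled∣ : ∀ v → ℚ.∣ Imag (ι b + κ (ℤ→ℚ b ℚ.* x) * v) ∣ ≡ x ℚ.* ℚ.∣ Imag v ∣
        ∣Imag-scaled∣ v = trans (cong ℚ.∣_∣ (Imag-scaled (ℤ→ℚ b ℚ.* x) v))
          (trans (ℚ.∣p*q∣≡∣p∣*∣q∣ (ℤ→ℚ b ℚ.* x) (Imag v))
            (cong (ℚ._* ℚ.∣ Imag v ∣) (trans (ℚ.∣p*q∣≡∣p∣*∣q∣ (ℤ→ℚ b) x)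
              (trans (cong₂ ℚ._*_ ∣b∣≡1 (ℚ.0≤p⇒∣p∣≡p (0≤1/r q))) (ℚ.*-identityˡ x)))))

        Imag-large : ∀ n → x ℚ.* ½ ℚ.≤ ℚ.∣ Imag (S.point (S.iterate n)) ∣
        Imag-large n = ℚ.≤-trans
          (ℚ.*-monoˡ-≤-nonNeg x {{ℚ.nonNegative (0≤1/r q)}} (∣Imag∣≥ u₀ u₀-nonReal (S.iterate n) (S.iterate-bounded n)))
          (ℚ.≤-reflexive (sym (trans (cong (λ y → ℚ.∣ Imag y ∣) (S.point-scaled (S.iterate n)))
            (∣Imag-scaled∣ (u₀ * (ι 1ℤ + S.iterate n))))))

        0<x½ : 0ℚ ℚ.< x ℚ.* ½
        0<x½ = ℚ.positive⁻¹ (x ℚ.* ½) {{ℚ.pos*pos⇒pos x {{ℚ.normalize-pos 1 q}} ½}}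

      nonRealRoot-scaled : HasNonRealRoot (h +ᴾ map (ℤ.+ m ℤ.*_) K)
      nonRealRoot-scaled = limit (h +ᴾ map (ℤ.+ m ℤ.*_) K) (λ n → S.point (S.iterate n))
        S.0≤limitConstant S.point-close S.eval-point-small 0<x½ Imag-large

    nonRealRoot-eventually : ∃ λ M → ∀ m → M ℕ.≤ m → HasNonRealRoot (h +ᴾ map (ℤ.+ m ℤ.*_) K)
    nonRealRoot-eventually =
      let
        _ , L , _ , 0≤L , h-lip   = eval-Lipschitz h {ℤ.+ 3 ℚ./ 1} (from-yes (0ℚ ℚ.≤? ℤ.+ 3 ℚ./ 1))
        _ , L′ , _ , 0≤L′ , B-lip = eval-Lipschitz B {ℤ.+ 3 ℚ./ 1} (from-yes (0ℚ ℚ.≤? ℤ.+ 3 ℚ./ 1))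
      in go (0≤+ 0≤L 0≤L′)
        (Lip-weaken ℚ.≤-refl (ℚ.≤-trans (ℚ.≤-reflexive (sym (ℚ.+-identityʳ L))) (ℚ.+-monoʳ-≤ L 0≤L′)) h-lip)
        (Lip-weaken ℚ.≤-refl (ℚ.≤-trans (ℚ.≤-reflexive (sym (ℚ.+-identityˡ L′))) (ℚ.+-monoˡ-≤ L′ 0≤L)) B-lip)
        (archimedean _)
      where
      go : ∀ {M M′ C} → 0ℚ ℚ.≤ C → Lip (ℤ.+ 3 ℚ./ 1) (eval h) M C → Lip (ℤ.+ 3 ℚ./ 1) (eval B) M′ C →
           (∃ λ Q → ℤ.+ 512 ℚ./ 1 ℚ.* C ℚ.≤ ℕ→ℚ Q) →
           ∃ λ M → ∀ m → M ℕ.≤ m → HasNonRealRoot (h +ᴾ map (ℤ.+ m ℤ.*_) K)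
      -- As β ≥ 1, this threshold lets the search for q start at 1920 + Q, which secures both lower
      -- bounds on q.
      go 0≤C h-lip B-lip (Q , large) = α ℕ.* (1920 ℕ.+ Q) ℕ.^ r , λ m M≤m →
        let q , lo≤q , lower , upper = integerRoot r α (1920 ℕ.+ Q) (β ℕ.* m) (ℕ.≤-trans M≤m (ℕ.m≤n*m m β))
            1920≤q = ℕ.≤-trans (ℕ.m≤m+n 1920 Q) lo≤q
            instance q≢0 = ℕ.>-nonZero (ℕ.≤-trans (ℕ.s≤s ℕ.z≤n) 1920≤q)
        in nonRealRoot-scaled 0≤C h-lip B-lip m q lower upper
             (ℚ.≤-trans large (ℕ→ℚ-mono {Q} {q} (ℕ.≤-trans (ℕ.m≤n+m Q 1920) lo≤q))) 1920≤q

gaussian : ComplexAlgebra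
gaussian = record
  { normed  = ℚ[i]-normed
  ; Imag    = Im
  ; Imag-+  = λ _ _ → refl
  ; Imag-ι  = λ _ → refl
  ; Imag-κ* = λ a x → Imag-real* a (Re x) (Im x)
  ; ∣Imag∣≤ = Im≤
  }
  where
  open +-*-Solver
  Imag-real* : ∀ a p q → a ℚ.* q ℚ.+ 0ℚ ℚ.* p ≡ a ℚ.* q
  Imag-real* = solve 3 (λ a p q → a :* q :+ con 0ℚ :* p := a :* q) refl

gaussian-limits : HasLimits gaussian
gaussian-limits = nonRealRoot

-- The contribution of one subdivision to the h-polynomial:
-- x (1 + x) ^ (k + 1) (1 - x) ^ (3 - k)
kernel : ℕ → Poly
kernel 0 = 0ℤ ∷ 1ℤ ∷ ℤ.- ℤ.+ 2 ∷ 0ℤ ∷ ℤ.+ 2 ∷ -1ℤ ∷ []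
kernel 1 = 0ℤ ∷ 1ℤ ∷ 0ℤ ∷ ℤ.- ℤ.+ 2 ∷ 0ℤ ∷ 1ℤ ∷ []
kernel 2 = 0ℤ ∷ 1ℤ ∷ ℤ.+ 2 ∷ 0ℤ ∷ ℤ.- ℤ.+ 2 ∷ -1ℤ ∷ []
kernel _ = 0ℤ ∷ 1ℤ ∷ ℤ.+ 4 ∷ ℤ.+ 6 ∷ ℤ.+ 4 ∷ 1ℤ ∷ []

-- With x = -1 - y and k ≥ 1 this is (-1) ^ k (1 + y) (2 + y) ^ (3 - k); for k = 0, with x = 1 + y,
-- it is -(1 + y) (2 + y).
cofactor : ℕ → Poly
cofactor 0 = ℤ.- ℤ.+ 2 ∷ ℤ.- ℤ.+ 3 ∷ -1ℤ ∷ []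
cofactor 1 = ℤ.- ℤ.+ 4 ∷ ℤ.- ℤ.+ 8 ∷ ℤ.- ℤ.+ 5 ∷ -1ℤ ∷ []
cofactor 2 = ℤ.+ 2 ∷ ℤ.+ 3 ∷ 1ℤ ∷ []
cofactor _ = -1ℤ ∷ -1ℤ ∷ []

-- Factorisation of the kernels and their relation to f-polynomials

module KernelIdentities (A : ℤ-Algebra) where
  open ℤ-Algebra A
  open ℤ-Solver A

  private
    horner : ∀ {n} → Poly → Polynomial n → Polynomial n
    horner p x = foldr (λ a r → con a :+ x :* r) (con 0ℤ) p

    power : ∀ {n} → Polynomial n → ℕ → Polynomial n
    power p zero    = con 1ℤ
    power p (suc r) = p :* power p r

  -- Horner's scheme ending in `ι 0ℤ`, which is what the solver expression `horner` denotes.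
  evalι : Poly → Carrier → Carrier
  evalι p x = foldr (λ a r → ι a + x * r) (ι 0ℤ) p

  eval≡evalι : ∀ p x → eval p x ≡ evalι p x
  eval≡evalι []      x = sym ι-0
  eval≡evalι (a ∷ p) x = cong (λ r → ι a + x * r) (eval≡evalι p x)

  _^ι_ : Carrier → ℕ → Carrier
  x ^ι zero  = ι 1ℤ
  x ^ι suc r = x * x ^ι r

  ^≡^ι : ∀ x r → x ^ r ≡ x ^ι r
  ^≡^ι x zero    = sym ι-1
  ^≡^ι x (suc r) = cong (x *_) (^≡^ι x r)

  factorι : ∀ k → k ℕ.≤ 2 → ∀ y → evalι (kernel (suc k)) (ι -1ℤ * (ι 1ℤ + y)) ≡ y ^ι (2 ℕ.+ k) * evalι (cofactor (suc k)) y
  factorι 0 _ = solve 1 (λ y → horner (kernel 1) (con -1ℤ :* (con 1ℤ :+ y)) := power y 2 :* horner (cofactor 1) y) refl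
  factorι 1 _ = solve 1 (λ y → horner (kernel 2) (con -1ℤ :* (con 1ℤ :+ y)) := power y 3 :* horner (cofactor 2) y) refl
  factorι 2 _ = solve 1 (λ y → horner (kernel 3) (con -1ℤ :* (con 1ℤ :+ y)) := power y 4 :* horner (cofactor 3) y) refl
  factorι (suc (suc (suc _))) (ℕ.s≤s (ℕ.s≤s ()))

  factorι₀ : ∀ y → evalι (kernel 0) (ι 1ℤ * (ι 1ℤ + y)) ≡ y ^ι 3 * evalι (cofactor 0) y
  factorι₀ = solve 1 (λ y → horner (kernel 0) (con 1ℤ :* (con 1ℤ :+ y)) := power y 3 :* horner (cofactor 0) y) refl

  kernel-factor : ∀ {r p q} x y → evalι p x ≡ y ^ι r * evalι q y → eval p x ≡ y ^ r * eval q y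
  kernel-factor {r} {p} {q} x y eq = trans (eval≡evalι p x) (trans eq (sym (cong₂ _*_ (^≡^ι y r) (eval≡evalι q y))))

  private
    homogenize : ∀ k → k ℕ.≤ 3 → ∀ p s → p ^ι 6 * evalι (kernel k) s ≡
      p * ((p * s) * ((p + p * s) ^ι suc k * (p - p * s) ^ι (3 ℕ.∸ k)))
    homogenize 0 _ = solve 2 (λ p s → power p 6 :* horner (kernel 0) s := p :* ((p :* s) :* (power (p :+ p :* s) 1 :* power (p :- p :* s) 3))) refl
    homogenize 1 _ = solve 2 (λ p s → power p 6 :* horner (kernel 1) s := p :* ((p :* s) :* (power (p :+ p :* s) 2 :* power (p :- p :* s) 2))) refl
    homogenize 2 _ = solve 2 (λ p s → power p 6 :* horner (kernel 2) s := p :* ((p :* s) :* (power (p :+ p :* s) 3 :* power (p :- p :* s) 1))) refl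
    homogenize 3 _ = solve 2 (λ p s → power p 6 :* horner (kernel 3) s := p :* ((p :* s) :* (power (p :+ p :* s) 4 :* power (p :- p :* s) 0))) refl
    homogenize (suc (suc (suc (suc _)))) (ℕ.s≤s (ℕ.s≤s (ℕ.s≤s ())))

    dehomogenize : ∀ k → k ℕ.≤ 3 → ∀ t →
      (ι 1ℤ + t) * (ι 1ℤ * (((ι 1ℤ + t) + ι 1ℤ) ^ι suc k * ((ι 1ℤ + t) - ι 1ℤ) ^ι (3 ℕ.∸ k))) ≡
      t ^ι (3 ℕ.∸ k) * ((t * ι 1ℤ + ι 1ℤ * ι 1ℤ) * (t + ι (ℤ.+ 2) * ι 1ℤ) ^ι suc k)
    dehomogenize 0 _ = solve 1 (λ t → (con 1ℤ :+ t) :* (con 1ℤ :* (power ((con 1ℤ :+ t) :+ con 1ℤ) 1 :* power ((con 1ℤ :+ t) :- con 1ℤ) 3)) :=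
      power t 3 :* ((t :* con 1ℤ :+ con 1ℤ :* con 1ℤ) :* power (t :+ con (ℤ.+ 2) :* con 1ℤ) 1)) refl
    dehomogenize 1 _ = solve 1 (λ t → (con 1ℤ :+ t) :* (con 1ℤ :* (power ((con 1ℤ :+ t) :+ con 1ℤ) 2 :* power ((con 1ℤ :+ t) :- con 1ℤ) 2)) :=
      power t 2 :* ((t :* con 1ℤ :+ con 1ℤ :* con 1ℤ) :* power (t :+ con (ℤ.+ 2) :* con 1ℤ) 2)) refl
    dehomogenize 2 _ = solve 1 (λ t → (con 1ℤ :+ t) :* (con 1ℤ :* (power ((con 1ℤ :+ t) :+ con 1ℤ) 3 :* power ((con 1ℤ :+ t) :- con 1ℤ) 1)) :=
      power t 1 :* ((t :* con 1ℤ :+ con 1ℤ :* con 1ℤ) :* power (t :+ con (ℤ.+ 2) :* con 1ℤ) 3)) refl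
    dehomogenize 3 _ = solve 1 (λ t → (con 1ℤ :+ t) :* (con 1ℤ :* (power ((con 1ℤ :+ t) :+ con 1ℤ) 4 :* power ((con 1ℤ :+ t) :- con 1ℤ) 0)) :=
      power t 0 :* ((t :* con 1ℤ :+ con 1ℤ :* con 1ℤ) :* power (t :+ con (ℤ.+ 2) :* con 1ℤ) 4)) refl
    dehomogenize (suc (suc (suc (suc _)))) (ℕ.s≤s (ℕ.s≤s (ℕ.s≤s ())))

    reverse : ∀ k → k ℕ.≤ 3 → ∀ t τ → t ^ι 6 * ((τ + τ * τ) * (ι 1ℤ + ι (ℤ.+ 2) * τ) ^ι suc k) ≡
      t ^ι (3 ℕ.∸ k) * ((t * (t * τ) + (t * τ) * (t * τ)) * (t + ι (ℤ.+ 2) * (t * τ)) ^ι suc k)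
    reverse 0 _ = solve 2 (λ t τ → power t 6 :* ((τ :+ τ :* τ) :* power (con 1ℤ :+ con (ℤ.+ 2) :* τ) 1) :=
      power t 3 :* ((t :* (t :* τ) :+ (t :* τ) :* (t :* τ)) :* power (t :+ con (ℤ.+ 2) :* (t :* τ)) 1)) refl
    reverse 1 _ = solve 2 (λ t τ → power t 6 :* ((τ :+ τ :* τ) :* power (con 1ℤ :+ con (ℤ.+ 2) :* τ) 2) :=
      power t 2 :* ((t :* (t :* τ) :+ (t :* τ) :* (t :* τ)) :* power (t :+ con (ℤ.+ 2) :* (t :* τ)) 2)) refl
    reverse 2 _ = solve 2 (λ t τ → power t 6 :* ((τ :+ τ :* τ) :* power (con 1ℤ :+ con (ℤ.+ 2) :* τ) 3) :=
      power t 1 :* ((t :* (t :* τ) :+ (t :* τ) :* (t :* τ)) :* power (t :+ con (ℤ.+ 2) :* (t :* τ)) 3)) refl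
    reverse 3 _ = solve 2 (λ t τ → power t 6 :* ((τ :+ τ :* τ) :* power (con 1ℤ :+ con (ℤ.+ 2) :* τ) 4) :=
      power t 0 :* ((t :* (t :* τ) :+ (t :* τ) :* (t :* τ)) :* power (t :+ con (ℤ.+ 2) :* (t :* τ)) 4)) refl
    reverse (suc (suc (suc (suc _)))) (ℕ.s≤s (ℕ.s≤s (ℕ.s≤s ())))

  -- The ring solver knows no inverses. Both sides are therefore rewritten so that s and τ occur
  -- only in the products (1 + t) s and t τ; with these replaced by 1, each becomes t ^ (3 - k) (1 +
  -- t) (2 + t) ^ (k + 1).
  kernel-h : ∀ k → k ℕ.≤ 3 → ∀ t τ s → t * τ ≡ 1# → (1# + t) * s ≡ 1# →
    (1# + t) ^ 6 * eval (kernel k) s ≡ t ^ 6 * ((τ + τ * τ) * (ι 1ℤ + ι (ℤ.+ 2) * τ) ^ suc k)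
  kernel-h k k≤3 t τ s tτ ps = begin
    (1# + t) ^ 6 * eval (kernel k) s        ≡⟨ cong₂ _*_ (trans (cong (λ o → (o + t) ^ 6) (sym ι-1)) (^≡^ι p 6)) (eval≡evalι (kernel k) s) ⟩
    p ^ι 6 * evalι (kernel k) s             ≡⟨ homogenize k k≤3 p s ⟩
    p * ((p * s) * ((p + p * s) ^ι suc k * (p - p * s) ^ι (3 ℕ.∸ k)))
      ≡⟨ cong (λ e → p * (e * ((p + e) ^ι suc k * (p - e) ^ι (3 ℕ.∸ k)))) (trans (cong (λ o → (o + t) * s) ι-1) (trans ps (sym ι-1))) ⟩
    p * (ι 1ℤ * ((p + ι 1ℤ) ^ι suc k * (p - ι 1ℤ) ^ι (3 ℕ.∸ k)))
      ≡⟨ dehomogenize k k≤3 t ⟩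
    t ^ι (3 ℕ.∸ k) * ((t * ι 1ℤ + ι 1ℤ * ι 1ℤ) * (t + ι (ℤ.+ 2) * ι 1ℤ) ^ι suc k)
      ≡⟨ cong (λ e → t ^ι (3 ℕ.∸ k) * ((t * e + e * e) * (t + ι (ℤ.+ 2) * e) ^ι suc k)) (trans tτ (sym ι-1)) ⟨
    t ^ι (3 ℕ.∸ k) * ((t * (t * τ) + (t * τ) * (t * τ)) * (t + ι (ℤ.+ 2) * (t * τ)) ^ι suc k)
      ≡⟨ reverse k k≤3 t τ ⟨
    t ^ι 6 * ((τ + τ * τ) * (ι 1ℤ + ι (ℤ.+ 2) * τ) ^ι suc k)
      ≡⟨ cong₂ (λ a b → a * ((τ + τ * τ) * b)) (^≡^ι t 6) (^≡^ι _ (suc k)) ⟨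
    t ^ 6 * ((τ + τ * τ) * (ι 1ℤ + ι (ℤ.+ 2) * τ) ^ suc k) ∎
    where
    open ≡-Reasoning
    p = ι 1ℤ + t

module _ (𝔸 : NormedAlgebra) where
  open NormedAlgebra 𝔸
  open Lipschitz 𝔸 using (‖ι‖)
  open KernelIdentities algebra

  expansion-at--1 : ∀ k → k ℕ.≤ 2 → Expansion 𝔸 (2 ℕ.+ k) (kernel (suc k)) (cofactor (suc k)) -1ℤ
  expansion-at--1 k k≤2 = record
    { b-unit = ℚ.≤-reflexive (‖ι‖ -1ℤ)
    ; factor = λ y → kernel-factor {2 ℕ.+ k} {kernel (suc k)} {cofactor (suc k)} _ y (factorι k k≤2 y)
    }

  expansion-at-1 : Expansion 𝔸 3 (kernel 0) (cofactor 0) 1ℤ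
  expansion-at-1 = record
    { b-unit = ℚ.≤-reflexive (‖ι‖ 1ℤ)
    ; factor = λ y → kernel-factor {3} {kernel 0} {cofactor 0} _ y (factorι₀ y)
    }

-- u₃ is close to a primitive cube root of unity, as 13/15 ≈ √3/2; u₄ ^ 4 = -4.
u₂ u₃ u₄ : ℚ[i]
u₂ = 0ℚ ⊹ 1ℚ
u₃ = ℚ.- ½ ⊹ ℤ.+ 13 ℚ./ 15
u₄ = 1ℚ ⊹ 1ℚ

-- In all four cases `sgn · β` is B (0) u₀ ^ r, up to the rounding w: -4 · i² = 4, 2 · u₃³ ≈ 2, -1 ·
-- (1 + i)⁴ = 4 and -2 · u₃³ ≈ -2.
direction₁ : Direction ℚ[i]-normed 2 (cofactor 1) 1ℤ 4 u₂
direction₁ = record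
  { B₀≢0 = λ () ; u₀≤2 = ℚ.≤ᵇ⇒≤ _ ; w = real 1ℚ ; w≈1 = ℚ.≤ᵇ⇒≤ _ ; power = refl }

direction₂ : Direction ℚ[i]-normed 3 (cofactor 2) 1ℤ 2 u₃
direction₂ = record
  { B₀≢0 = λ () ; u₀≤2 = ℚ.≤ᵇ⇒≤ _ ; w = u₃ ⊗ (u₃ ⊗ u₃) ; w≈1 = ℚ.≤ᵇ⇒≤ _ ; power = refl }

direction₃ : Direction ℚ[i]-normed 4 (cofactor 3) 1ℤ 4 u₄
direction₃ = record
  { B₀≢0 = λ () ; u₀≤2 = ℚ.≤ᵇ⇒≤ _ ; w = real 1ℚ ; w≈1 = ℚ.≤ᵇ⇒≤ _ ; power = refl }

direction₀ : Direction ℚ[i]-normed 3 (cofactor 0) -1ℤ 2 u₃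
direction₀ = record
  { B₀≢0 = λ () ; u₀≤2 = ℚ.≤ᵇ⇒≤ _ ; w = u₃ ⊗ (u₃ ⊗ u₃) ; w≈1 = ℚ.≤ᵇ⇒≤ _ ; power = refl }

nonZero-∣∣ : ∀ {i} → i ≢ 0ℤ → ℕ.NonZero ℤ.∣ i ∣
nonZero-∣∣ {ℤ.+ zero} i≢0 = ⊥-elim (i≢0 refl)
nonZero-∣∣ {+[1+ _ ]} _ = _
nonZero-∣∣ { -[1+ _ ]} _ = _

module _ (h : Poly) where

  nonRealRoot-near--1 : evalℤ h -1ℤ ℤ.< 0ℤ → ∀ k → 1 ℕ.≤ k → k ℕ.≤ 3 →
    ∃ λ M → ∀ m → M ℕ.≤ m → HasNonRealRoot (h +ᴾ map (ℤ.+ m ℤ.*_) (kernel k))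
  nonRealRoot-near--1 h[-1]<0 k 1≤k k≤3 = go k 1≤k k≤3
    where
    α = ℤ.∣ evalℤ h -1ℤ ∣
    ≢0 : evalℤ h -1ℤ ≢ 0ℤ
    ≢0 = ℤ.<⇒≢ h[-1]<0
    instance
      α≢0 : ℕ.NonZero α
      α≢0 = nonZero-∣∣ ≢0
    neg : ∀ {i} → i ℤ.< 0ℤ → ℤ.- i ≡ 1ℤ ℤ.* ℤ.+ ℤ.∣ i ∣
    neg {ℤ.+ _} (ℤ.+<+ ())
    neg { -[1+ n ]} _ = sym (ℤ.*-identityˡ (ℤ.+ suc n))
    go : ∀ k → 1 ℕ.≤ k → k ℕ.≤ 3 → ∃ λ M → ∀ m → M ℕ.≤ m → HasNonRealRoot (h +ᴾ map (ℤ.+ m ℤ.*_) (kernel k))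
    go 1 _ _ = nonRealRoot-eventually gaussian gaussian-limits 2 (from-yes (contractionBounds? 2)) h (kernel 1) (cofactor 1) -1ℤ
      (expansion-at--1 ℚ[i]-normed 0 ℕ.z≤n) refl 1ℤ α (neg h[-1]<0) ≢0 4 direction₁ (ℚ.≤ᵇ⇒≤ _)
    go 2 _ _ = nonRealRoot-eventually gaussian gaussian-limits 3 (from-yes (contractionBounds? 3)) h (kernel 2) (cofactor 2) -1ℤ
      (expansion-at--1 ℚ[i]-normed 1 (ℕ.s≤s ℕ.z≤n)) refl 1ℤ α (neg h[-1]<0) ≢0 2 direction₂ (ℚ.≤ᵇ⇒≤ _)
    go 3 _ _ = nonRealRoot-eventually gaussian gaussian-limits 4 (from-yes (contractionBounds? 4)) h (kernel 3) (cofactor 3) -1ℤ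
      (expansion-at--1 ℚ[i]-normed 2 (ℕ.s≤s (ℕ.s≤s ℕ.z≤n))) refl 1ℤ α (neg h[-1]<0) ≢0 4 direction₃ (ℚ.≤ᵇ⇒≤ _)
    go (suc (suc (suc (suc _)))) _ (ℕ.s≤s (ℕ.s≤s (ℕ.s≤s ())))

  nonRealRoot-near-1 : 0ℤ ℤ.< evalℤ h 1ℤ →
    ∃ λ M → ∀ m → M ℕ.≤ m → HasNonRealRoot (h +ᴾ map (ℤ.+ m ℤ.*_) (kernel 0))
  nonRealRoot-near-1 0<h[1] = nonRealRoot-eventually gaussian gaussian-limits 3 (from-yes (contractionBounds? 3)) h (kernel 0) (cofactor 0) 1ℤ
    (expansion-at-1 ℚ[i]-normed) refl -1ℤ ℤ.∣ evalℤ h 1ℤ ∣ {{nonZero-∣∣ ≢0}} (neg 0<h[1]) ≢0 2 direction₀ (ℚ.≤ᵇ⇒≤ _)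
    where
    ≢0 : evalℤ h 1ℤ ≢ 0ℤ
    ≢0 eq = ℤ.<⇒≢ 0<h[1] (sym eq)
    neg : ∀ {i} → 0ℤ ℤ.< i → ℤ.- i ≡ -1ℤ ℤ.* ℤ.+ ℤ.∣ i ∣
    neg {+[1+ n ]} _ = sym (ℤ.-1*i≡-i +[1+ n ])
    neg {ℤ.+ zero} (ℤ.+<+ ())

-- Inverses in ℚ, and vanishing as a consequence of boundedness

1/-unique : ∀ {x y} .{{_ : NonZero x}} → x ℚ.* y ≡ 1ℚ → 1/ x ≡ y
1/-unique {x} {y} xy≡1 = begin
  1/ x                   ≡⟨ ℚ.*-identityʳ (1/ x) ⟨
  1/ x ℚ.* 1ℚ            ≡⟨ cong (1/ x ℚ.*_) xy≡1 ⟨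
  1/ x ℚ.* (x ℚ.* y)     ≡⟨ ℚ.*-assoc (1/ x) x y ⟨
  (1/ x ℚ.* x) ℚ.* y     ≡⟨ cong (ℚ._* y) (ℚ.*-inverseˡ x) ⟩
  1ℚ ℚ.* y               ≡⟨ ℚ.*-identityˡ y ⟩
  y                      ∎
  where open ≡-Reasoning

inverse⇒nonZero : ∀ {x y} → x ℚ.* y ≡ 1ℚ → NonZero x
inverse⇒nonZero {x} {y} xy≡1 = ℚ.≢-nonZero {x} λ x≡0 →
  ℚ.1≢0 (trans (sym xy≡1) (trans (cong (ℚ._* y) x≡0) (ℚ.*-zeroˡ y)))

-- Stands in for a limit: a number that is at most C/n for every n vanishes.
bounded-multiples⇒≡0 : ∀ {a C} → (∀ n → ℕ→ℚ n ℚ.* ℚ.∣ a ∣ ℚ.≤ C) → a ≡ 0ℚ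
bounded-multiples⇒≡0 {a} {C} bounded with a ℚ.≟ 0ℚ
... | yes a≡0 = a≡0
... | no  a≢0 with archimedean ((C ℚ.+ 1ℚ) ℚ.* (1/ ℚ.∣ a ∣) {{∣a∣≢0}})
  where
  ∣a∣≢0 : NonZero ℚ.∣ a ∣
  ∣a∣≢0 = ℚ.≢-nonZero (a≢0 ∘ ℚ.∣p∣≡0⇒p≡0 a)
...   | K , le = ⊥-elim (ℚ.<-irrefl refl (begin-strict
  C                                                  ≡⟨ ℚ.+-identityʳ C ⟨
  C ℚ.+ 0ℚ                                           <⟨ ℚ.+-monoʳ-< C (from-yes (0ℚ ℚ.<? 1ℚ)) ⟩
  C ℚ.+ 1ℚ                                           ≡⟨ ℚ.*-identityʳ (C ℚ.+ 1ℚ) ⟨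
  (C ℚ.+ 1ℚ) ℚ.* 1ℚ                                  ≡⟨ cong ((C ℚ.+ 1ℚ) ℚ.*_) (ℚ.*-inverseˡ ℚ.∣ a ∣) ⟨
  (C ℚ.+ 1ℚ) ℚ.* (1/ ℚ.∣ a ∣ ℚ.* ℚ.∣ a ∣)            ≡⟨ ℚ.*-assoc (C ℚ.+ 1ℚ) (1/ ℚ.∣ a ∣) ℚ.∣ a ∣ ⟨
  (C ℚ.+ 1ℚ) ℚ.* 1/ ℚ.∣ a ∣ ℚ.* ℚ.∣ a ∣              ≤⟨ ℚ.*-monoʳ-≤-nonNeg ℚ.∣ a ∣ {{ℚ.∣-∣-nonNeg a}} le ⟩
  ℕ→ℚ K ℚ.* ℚ.∣ a ∣                                  ≤⟨ bounded K ⟩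
  C                                                  ∎))
  where
  open ℚ.≤-Reasoning
  instance
    ∣a∣≢0 : NonZero ℚ.∣ a ∣
    ∣a∣≢0 = ℚ.≢-nonZero (a≢0 ∘ ℚ.∣p∣≡0⇒p≡0 a)

-- The h-polynomial of the subdivisions

h-combine : (A : ℤ-Algebra) → let open ℤ-Algebra A in
  ∀ a b H K m F G → a * H ≡ b * F → a * K ≡ b * G → a * (H + m * K) ≡ b * (F + m * G)
h-combine A a b H K m F G aH aK = trans (expand a H m K) (trans (cong₂ (λ y z → y + m * z) aH aK) (sym (expand b F m G)))
  where
  open ℤ-Algebra A
  open ℤ-Solver A
  expand : ∀ a H m K → a * (H + m * K) ≡ a * H + m * (a * K)
  expand = solve 4 (λ a H m K → a :* (H :+ m :* K) := a :* H :+ m :* (a :* K)) refl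

-- The passage from f to h is linear, so m equal increments of f become m copies of `kernel k`.
isHPoly-Sub^ : ∀ {N} (X : Complex N) h → IsHPoly 6 X h → (η : Edge X) → ∀ k → k ℕ.≤ 3 →
  LinkEdge X η IsCopyOf crossPolytope k → ∀ m c →
  IsHPoly 6 (Sub^ m X η c) (h +ᴾ map (ℤ.+ m ℤ.*_) (kernel k))
isHPoly-Sub^ X h isH η k k≤3 copy m c t = begin
  p ^ℚ 6 ℚ.* evalℚ (h +ᴾ map (ℤ.+ m ℤ.*_) (kernel k)) s
    ≡⟨ cong (p ^ℚ 6 ℚ.*_) (trans (eval-+ᴾ h (map (ℤ.+ m ℤ.*_) (kernel k)) s) (cong (evalℚ h s ℚ.+_) (eval-map-* ℚ-algebra (ℤ.+ m) (kernel k) s))) ⟩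
  p ^ℚ 6 ℚ.* (evalℚ h s ℚ.+ ℕ→ℚ m ℚ.* evalℚ (kernel k) s)
    ≡⟨ h-combine ℚ-algebra (p ^ℚ 6) (t ^ℚ 6) (evalℚ h s) (evalℚ (kernel k) s) (ℕ→ℚ m) (f X τ) ((τ ℚ.+ τ ℚ.* τ) ℚ.* f (LinkEdge X η) τ)
         (trans (isH t) (cong (t ^ℚ 6 ℚ.*_) (eval-fPoly X τ)))
         (trans (kernel-h k k≤3 t τ s (ℚ.*-inverseʳ t) (ℚ.*-inverseʳ p))
           (cong (λ z → t ^ℚ 6 ℚ.* ((τ ℚ.+ τ ℚ.* τ) ℚ.* z)) (sym (trans (f-copy copy τ) (f-joinPower (suc k) τ))))) ⟩
  t ^ℚ 6 ℚ.* (f X τ ℚ.+ ℕ→ℚ m ℚ.* ((τ ℚ.+ τ ℚ.* τ) ℚ.* f (LinkEdge X η) τ))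
    ≡⟨ cong (t ^ℚ 6 ℚ.*_) (trans (eval-fPoly (Sub^ m X η c) τ) (proj₂ (f-iterateSub X η c m τ))) ⟨
  t ^ℚ 6 ℚ.* evalℚ (fPoly (Sub^ m X η c)) τ ∎
  where
  open ≡-Reasoning
  open FPolynomials ℚ-algebra
  open Subdivisions ℚ-algebra
  open KernelIdentities ℚ-algebra
  p s τ : ℚ
  p = 1ℚ ℚ.+ t
  s = 1/ p
  τ = 1/ t

-- Positivity of h (1)

∑-≥ : ∀ {n} (g : Subset n → ℚ) → (∀ σ → 0ℚ ℚ.≤ g σ) → ∀ ρ → g ρ ℚ.≤ FPolynomials.∑ ℚ-algebra g
∑-≥ g 0≤g [] = ℚ.≤-refl
∑-≥ {suc n} g 0≤g (b ∷ ρ) = go b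
  where
  open FPolynomials ℚ-algebra
  ∑≥0 : ∀ {n} (g : Subset n → ℚ) → (∀ σ → 0ℚ ℚ.≤ g σ) → 0ℚ ℚ.≤ ∑ g
  ∑≥0 {zero}  g 0≤g = 0≤g []
  ∑≥0 {suc n} g 0≤g = 0≤+ (∑≥0 (g ∘ (outside ∷_)) (0≤g ∘ (outside ∷_))) (∑≥0 (g ∘ (inside ∷_)) (0≤g ∘ (inside ∷_)))
  out = g ∘ (outside ∷_)
  ins = g ∘ (inside ∷_)
  go : ∀ b → g (b ∷ ρ) ℚ.≤ ∑ out ℚ.+ ∑ ins
  go outside = ℚ.≤-trans (∑-≥ out (0≤g ∘ (outside ∷_)) ρ)
    (ℚ.≤-trans (ℚ.≤-reflexive (sym (ℚ.+-identityʳ (∑ out)))) (ℚ.+-monoʳ-≤ (∑ out) (∑≥0 ins (0≤g ∘ (inside ∷_)))))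
  go inside = ℚ.≤-trans (∑-≥ ins (0≤g ∘ (inside ∷_)) ρ)
    (ℚ.≤-trans (ℚ.≤-reflexive (sym (ℚ.+-identityˡ (∑ ins)))) (ℚ.+-monoˡ-≤ (∑ ins) (∑≥0 out (0≤g ∘ (outside ∷_)))))

f-≥ : ∀ {N} (X : Complex N) {σ} → Face X σ → ∀ {x} → 0ℚ ℚ.≤ x → x ^ℚ ∣ σ ∣ ℚ.≤ FPolynomials.f ℚ-algebra X x
f-≥ X {σ} σ∈X {x} 0≤x = ℚ.≤-trans
  (ℚ.≤-reflexive (sym (trans (cong (ℚ._* x ^ℚ ∣ σ ∣) (χ-yes (face? X σ) σ∈X)) (ℚ.*-identityˡ (x ^ℚ ∣ σ ∣)))))
  (∑-≥ (fTerm X x) (λ τ → 0≤* (0≤χ (does (face? X τ))) (0≤^ 0≤x ∣ τ ∣)) σ)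
  where
  open FPolynomials ℚ-algebra
  0≤χ : ∀ b → 0ℚ ℚ.≤ χ b
  0≤χ true  = from-yes (0ℚ ℚ.≤? 1ℚ)
  0≤χ false = ℚ.≤-refl

-- A face with 6 vertices gives t⁶ f (1/t) ≥ 1 for t > 0. If h (1) ≤ 0, the left side of the
-- defining identity would be at most 64 L t for t ≤ 1. As t = 0 is excluded from the identity, t =
-- 1/(K + 1) with K ≥ 64 L yields the contradiction.
h[1]-positive : ∀ {N} (X : Complex N) h → HasDimension X 5 → IsHPoly 6 X h → 0ℤ ℤ.< evalℤ h 1ℤ
h[1]-positive X h (_ , σ , σ∈X , ∣σ∣≡6) isH with eval-Lipschitz h {1ℚ} (from-yes (0ℚ ℚ.≤? 1ℚ))
  where open Lipschitz ℚ-normed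
... | _ , L , _ , 0≤L , h-lip with archimedean (ℤ.+ 64 ℚ./ 1 ℚ.* L)
...   | K , 64L≤K = ℤ.≰⇒> λ h[1]≤0 → ℚ.<-irrefl refl (begin-strict
  1ℚ                                       ≡⟨ Q^x^ {t} {1/ t} (ℚ.*-inverseʳ t) 6 ⟨
  t ^ℚ 6 ℚ.* (1/ t) ^ℚ 6                   ≤⟨ ℚ.*-monoˡ-≤-nonNeg (t ^ℚ 6) {{ℚ.nonNegative (0≤^ 0≤t 6)}}
                                                (subst (λ d → (1/ t) ^ℚ d ℚ.≤ f X (1/ t)) ∣σ∣≡6 (f-≥ X σ∈X (ℚ.<⇒≤ 0<1/t))) ⟩
  t ^ℚ 6 ℚ.* f X (1/ t)                    ≡⟨ trans (isH t) (cong (t ^ℚ 6 ℚ.*_) (eval-fPoly X (1/ t))) ⟨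
  p ^ℚ 6 ℚ.* evalℚ h s                     ≤⟨ ℚ.*-monoˡ-≤-nonNeg (p ^ℚ 6) {{ℚ.nonNegative 0≤p^6}} (h[s]≤ h[1]≤0) ⟩
  p ^ℚ 6 ℚ.* (L ℚ.* t)                     ≤⟨ ℚ.*-monoʳ-≤-nonNeg (L ℚ.* t) {{ℚ.nonNegative (0≤* 0≤L 0≤t)}} p^6≤64 ⟩
  (ℤ.+ 64 ℚ./ 1) ℚ.* (L ℚ.* t)             ≡⟨ ℚ.*-assoc (ℤ.+ 64 ℚ./ 1) L t ⟨
  (ℤ.+ 64 ℚ./ 1) ℚ.* L ℚ.* t               ≤⟨ ℚ.*-monoʳ-≤-nonNeg t {{ℚ.nonNegative 0≤t}} 64L≤K ⟩
  ℕ→ℚ K ℚ.* t                              <⟨ ℚ.*-monoˡ-<-pos t (ℤ→ℚ-mono-< {ℤ.+ K} {ℤ.+ suc K} (ℤ.+<+ ℕ.≤-refl)) ⟩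
  ℕ→ℚ (suc K) ℚ.* t                        ≡⟨ Qt≡1 ⟩
  1ℚ                                       ∎)
  where
  open ℚ.≤-Reasoning
  open FPolynomials ℚ-algebra
  open Lipschitz ℚ-normed
  t : ℚ
  t = ℤ.+ 1 ℚ./ suc K
  p : ℚ
  p = 1ℚ ℚ.+ t
  0≤t : 0ℚ ℚ.≤ t
  0≤t = 0≤1/r (suc K)
  Qt≡1 : ℕ→ℚ (suc K) ℚ.* t ≡ 1ℚ
  Qt≡1 = trans (ℚ.*-comm (ℕ→ℚ (suc K)) t) (1/r*r (suc K))
  0<p : 0ℚ ℚ.< p
  0<p = ℚ.<-≤-trans (from-yes (0ℚ ℚ.<? 1ℚ)) (ℚ.≤-trans (ℚ.≤-reflexive (sym (ℚ.+-identityʳ 1ℚ))) (ℚ.+-monoʳ-≤ 1ℚ 0≤t))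
  instance
    t-pos : ℚ.Positive t
    t-pos = ℚ.normalize-pos 1 (suc K)
    t≢0 : NonZero t
    t≢0 = ℚ.pos⇒nonZero t
    p-pos : ℚ.Positive p
    p-pos = ℚ.positive 0<p
    p≢0 : NonZero p
    p≢0 = ℚ.pos⇒nonZero p
  s : ℚ
  s = 1/ p
  0<1/t : 0ℚ ℚ.< 1/ t
  0<1/t = ℚ.positive⁻¹ (1/ t) {{ℚ.1/pos⇒pos t}}
  0≤s : 0ℚ ℚ.≤ s
  0≤s = ℚ.<⇒≤ (ℚ.positive⁻¹ s {{ℚ.1/pos⇒pos p}})
  0≤p^6 : 0ℚ ℚ.≤ p ^ℚ 6
  0≤p^6 = 0≤^ (ℚ.<⇒≤ 0<p) 6
  t≤1 : t ℚ.≤ 1ℚ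
  t≤1 = ℚ.≤-trans (ℚ.≤-reflexive (sym (ℚ.*-identityˡ t)))
    (ℚ.≤-trans (*-mono-≤ (from-yes (0ℚ ℚ.≤? 1ℚ)) (ℕ→ℚ-mono {1} {suc K} (ℕ.s≤s ℕ.z≤n)) 0≤t ℚ.≤-refl) (ℚ.≤-reflexive Qt≡1))
  p^6≤64 : p ^ℚ 6 ℚ.≤ ℤ.+ 64 ℚ./ 1
  p^6≤64 = ℚ.≤-trans (1+x^≤ 6 0≤t t≤1) (ℚ.+-monoʳ-≤ 1ℚ (ℚ.*-monoˡ-≤-nonNeg (growth 6) t≤1))
  s≤1 : s ℚ.≤ 1ℚ
  s≤1 = ℚ.≤-trans (ℚ.≤-reflexive (sym (ℚ.*-identityʳ s)))
    (ℚ.≤-trans (ℚ.*-monoˡ-≤-nonNeg s {{ℚ.nonNegative 0≤s}} (ℚ.≤-trans (ℚ.≤-reflexive (sym (ℚ.+-identityʳ 1ℚ))) (ℚ.+-monoʳ-≤ 1ℚ 0≤t)))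
      (ℚ.≤-reflexive (ℚ.*-inverseˡ p)))
  1-s≡ : 1ℚ ℚ.- s ≡ t ℚ.* s
  1-s≡ = trans (cong (ℚ._- s) (sym (ℚ.*-inverseʳ p))) (cancel t s)
    where
    open +-*-Solver
    cancel : ∀ t s → (1ℚ ℚ.+ t) ℚ.* s ℚ.- s ≡ t ℚ.* s
    cancel = solve 2 (λ t s → (con 1ℚ :+ t) :* s :- s := t :* s) refl
  ∣s-1∣≤t : ℚ.∣ s ℚ.- 1ℚ ∣ ℚ.≤ t
  ∣s-1∣≤t = ℚ.≤-trans (ℚ.≤-reflexive (trans (sym (ℚ.∣-p∣≡∣p∣ (s ℚ.- 1ℚ))) (trans (cong ℚ.∣_∣ (trans (flip s) 1-s≡)) (ℚ.0≤p⇒∣p∣≡p (0≤* 0≤t 0≤s)))))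
    (ℚ.≤-trans (ℚ.*-monoˡ-≤-nonNeg t {{ℚ.nonNegative 0≤t}} s≤1) (ℚ.≤-reflexive (ℚ.*-identityʳ t)))
    where
    open +-*-Solver
    flip : ∀ s → ℚ.- (s ℚ.- 1ℚ) ≡ 1ℚ ℚ.- s
    flip = solve 1 (λ s → :- (s :- con 1ℚ) := con 1ℚ :- s) refl
  h[s]≤ : evalℤ h 1ℤ ℤ.≤ 0ℤ → evalℚ h s ℚ.≤ L ℚ.* t
  h[s]≤ h[1]≤0 = begin
    evalℚ h s                                            ≡⟨ split (evalℚ h s) (evalℚ h 1ℚ) ⟩
    (evalℚ h s ℚ.- evalℚ h 1ℚ) ℚ.+ evalℚ h 1ℚ            ≤⟨ ℚ.+-mono-≤ (p≤∣p∣ (evalℚ h s ℚ.- evalℚ h 1ℚ)) (ℚ.≤-trans (ℚ.≤-reflexive (eval-ι ℚ-algebra h 1ℤ)) (ℤ→ℚ-mono-≤ {evalℤ h 1ℤ} {0ℤ} h[1]≤0)) ⟩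
    ℚ.∣ evalℚ h s ℚ.- evalℚ h 1ℚ ∣ ℚ.+ 0ℚ                ≡⟨ ℚ.+-identityʳ ℚ.∣ evalℚ h s ℚ.- evalℚ h 1ℚ ∣ ⟩
    ℚ.∣ evalℚ h s ℚ.- evalℚ h 1ℚ ∣                       ≤⟨ lip h-lip s 1ℚ (ℚ.≤-trans (ℚ.≤-reflexive (ℚ.0≤p⇒∣p∣≡p 0≤s)) s≤1) ℚ.≤-refl ⟩
    L ℚ.* ℚ.∣ s ℚ.- 1ℚ ∣                                 ≤⟨ ℚ.*-monoˡ-≤-nonNeg L {{ℚ.nonNegative 0≤L}} ∣s-1∣≤t ⟩
    L ℚ.* t                                              ∎
    where
    split : ∀ a b → a ≡ (a ℚ.- b) ℚ.+ b
    split = solve 2 (λ a b → a := (a :- b) :+ b) refl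
      where open +-*-Solver

-- The coefficient of t³ in γ

coeff-drop : ∀ p i → coeff (drop 1 p) i ≡ coeff p (suc i)
coeff-drop []      i = refl
coeff-drop (a ∷ p) i = refl

higher : Poly → Poly
higher γ = drop 1 (drop 1 (drop 1 (drop 1 γ)))

-- With x = 1 + t and t / x² = u, the defining identity of γ reads
-- h (t) = low-order terms + t³ u γ' (u), where γ' collects the coefficients
-- of index at least 4. As x → 0 the left hand side stays bounded while u → ∞.
module GammaIdentities (A : ℤ-Algebra) (h γ : Poly) where
  open ℤ-Algebra A
  open ℤ-Solver A
  open KernelIdentities A using (_^ι_; ^≡^ι)

  private
    g : ℕ → Carrier
    g i = ι (coeff γ i)

    eval-uncons : ∀ p u → eval p u ≡ ι (coeff p 0) + u * eval (drop 1 p) u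
    eval-uncons []      u = sym (trans (cong₂ _+_ ι-0 (zeroʳ u)) (+-identityʳ 0#))
    eval-uncons (a ∷ p) u = refl

  eval-γ : ∀ u → eval γ u ≡ g 0 + u * (g 1 + u * (g 2 + u * (g 3 + u * eval (higher γ) u)))
  eval-γ u =
    trans (eval-uncons γ u) (cong (λ z → g 0 + u * z)
    (trans (eval-uncons (d 1) u) (cong₂ (λ c z → ι c + u * z) (coeff-drop γ 0)
    (trans (eval-uncons (d 2) u) (cong₂ (λ c z → ι c + u * z) (trans (coeff-drop (d 1) 0) (coeff-drop γ 1))
    (trans (eval-uncons (d 3) u) (cong (λ c → ι c + u * eval (higher γ) u)
      (trans (coeff-drop (d 2) 0) (trans (coeff-drop (d 1) 1) (coeff-drop γ 2))))))))))
    where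
    d : ℕ → Poly
    d zero    = γ
    d (suc i) = drop 1 (d i)

  low : Carrier → Carrier
  low x = g 0 * (x * (x * (x * (x * (x * x))))) + (g 1 * (t * (x * (x * (x * x)))) +
          (g 2 * ((t * t) * (x * x)) + g 3 * (t * (t * t))))
    where t = x - ι 1ℤ

  -- Multiplication by `ι -1ℤ` replaces subtraction so that `Lip-scale` applies.
  rest : Carrier → Carrier
  rest x = eval h (x - ι 1ℤ) + ι -1ℤ * low x

  -- Since x⁶ uⁱ = tⁱ x^(6 - 2i), the terms with i ≤ 3 cancel against `low`. The inverse n is
  -- gathered into e = x n by `expand`; `collapse` works with e already replaced by 1.
  rest-higher : ∀ x n → x * n ≡ ι 1ℤ → let t = x - ι 1ℤ; u = t * (n * n) in
    eval h t ≡ x ^ι 6 * eval γ u → rest x ≡ (t * (t * t)) * (u * eval (higher γ) u)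
  rest-higher x n xn≡1 h≡ = trans
    (cong (_+ ι -1ℤ * low x) (trans h≡ (cong (x ^ι 6 *_) (eval-γ u))))
    (trans (expand x n t (g 0) (g 1) (g 2) (g 3) (eval (higher γ) u))
    (trans (cong (λ e → terms e) xn≡1) (collapse x n t (g 0) (g 1) (g 2) (g 3) (eval (higher γ) u))))
    where
    t = x - ι 1ℤ
    u = t * (n * n)
    Lo : ∀ {k} → Polynomial k → Polynomial k → (a b c d : Polynomial k) → Polynomial k → Polynomial k
    Lo x t a b c d e = a :* (x :* (x :* (x :* (x :* (x :* x))))) :+ (b :* (t :* (x :* (x :* (x :* x)))) :* (e :* e) :+
      (c :* ((t :* t) :* (x :* x)) :* ((e :* e) :* (e :* e)) :+ d :* (t :* (t :* t)) :* ((e :* e) :* ((e :* e) :* (e :* e)))))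
    L₁ : ∀ {k} → Polynomial k → Polynomial k → (a b c d : Polynomial k) → Polynomial k
    L₁ x t a b c d = a :* (x :* (x :* (x :* (x :* (x :* x))))) :+ (b :* (t :* (x :* (x :* (x :* x)))) :+
      (c :* ((t :* t) :* (x :* x)) :+ d :* (t :* (t :* t))))
    terms : Carrier → Carrier
    terms e = g 0 * (x * (x * (x * (x * (x * x))))) + (g 1 * (t * (x * (x * (x * x)))) * (e * e) +
      (g 2 * ((t * t) * (x * x)) * ((e * e) * (e * e)) + g 3 * (t * (t * t)) * ((e * e) * ((e * e) * (e * e)))))
      + (t * (t * t)) * ((e * e) * ((e * e) * (e * e))) * (u * eval (higher γ) u)
      + ι -1ℤ * low x
    expand : ∀ x n t a b c d δ →
      let u = t * (n * n); e = x * n in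
      x ^ι 6 * (a + u * (b + u * (c + u * (d + u * δ)))) + ι -1ℤ * (a * (x * (x * (x * (x * (x * x))))) + (b * (t * (x * (x * (x * x)))) +
        (c * ((t * t) * (x * x)) + d * (t * (t * t))))) ≡
      a * (x * (x * (x * (x * (x * x))))) + (b * (t * (x * (x * (x * x)))) * (e * e) +
        (c * ((t * t) * (x * x)) * ((e * e) * (e * e)) + d * (t * (t * t)) * ((e * e) * ((e * e) * (e * e)))))
        + (t * (t * t)) * ((e * e) * ((e * e) * (e * e))) * (u * δ)
        + ι -1ℤ * (a * (x * (x * (x * (x * (x * x))))) + (b * (t * (x * (x * (x * x)))) +
        (c * ((t * t) * (x * x)) + d * (t * (t * t)))))
    expand = solve 8 (λ x n t a b c d δ → let u = t :* (n :* n); e = x :* n in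
      (x :* (x :* (x :* (x :* (x :* (x :* con 1ℤ)))))) :* (a :+ u :* (b :+ u :* (c :+ u :* (d :+ u :* δ)))) :+ con -1ℤ :* L₁ x t a b c d :=
      Lo x t a b c d e :+ (t :* (t :* t)) :* ((e :* e) :* ((e :* e) :* (e :* e))) :* (u :* δ) :+ con -1ℤ :* L₁ x t a b c d) refl
    collapse : ∀ x n t a b c d δ → let u = t * (n * n); e = ι 1ℤ in
      a * (x * (x * (x * (x * (x * x))))) + (b * (t * (x * (x * (x * x)))) * (e * e) +
        (c * ((t * t) * (x * x)) * ((e * e) * (e * e)) + d * (t * (t * t)) * ((e * e) * ((e * e) * (e * e)))))
        + (t * (t * t)) * ((e * e) * ((e * e) * (e * e))) * (u * δ)
        + ι -1ℤ * (a * (x * (x * (x * (x * (x * x))))) + (b * (t * (x * (x * (x * x)))) +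
        (c * ((t * t) * (x * x)) + d * (t * (t * t))))) ≡
      (t * (t * t)) * (u * δ)
    collapse = solve 8 (λ x n t a b c d δ → let u = t :* (n :* n); e = con 1ℤ in
      Lo x t a b c d e :+ (t :* (t :* t)) :* ((e :* e) :* ((e :* e) :* (e :* e))) :* (u :* δ) :+ con -1ℤ :* L₁ x t a b c d :=
      (t :* (t :* t)) :* (u :* δ)) refl

  -- At x = 0, where t = -1, only the term γ₃ t³ of `low` survives.
  rest-0 : rest (ι 0ℤ) ≡ ι (evalℤ h -1ℤ ℤ.+ coeff γ 3)
  rest-0 = trans (cong₂ _+_ (trans (cong (eval h) (solve 0 (con 0ℤ :- con 1ℤ := con -1ℤ) refl)) (eval-ι A h -1ℤ))
      (simplify (g 0) (g 1) (g 2) (g 3)))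
    (sym (ι-+ (evalℤ h -1ℤ) (coeff γ 3)))
    where
    simplify : ∀ a b c d → let x = ι 0ℤ; t = x - ι 1ℤ in
      ι -1ℤ * (a * (x * (x * (x * (x * (x * x))))) + (b * (t * (x * (x * (x * x)))) +
        (c * ((t * t) * (x * x)) + d * (t * (t * t))))) ≡ d
    simplify = solve 4 (λ a b c d → let x = con 0ℤ; t = x :- con 1ℤ in
      con -1ℤ :* (a :* (x :* (x :* (x :* (x :* (x :* x))))) :+ (b :* (t :* (x :* (x :* (x :* x)))) :+
        (c :* ((t :* t) :* (x :* x)) :+ d :* (t :* (t :* t))))) := d) refl

module GammaLipschitz (𝔸 : NormedAlgebra) (h γ : Poly) where
  open NormedAlgebra 𝔸
  open Lipschitz 𝔸
  open GammaIdentities algebra h γ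

  Lip-shift : ∀ {k M L} → Lip (1ℚ ℚ.+ 1ℚ) k M L → Lip 1ℚ (λ x → k (x - ι 1ℤ)) M L
  Lip-shift {k} {M} {L} K = record
    { bound = λ x x∈ → bound K (x - ι 1ℤ) (shifted x x∈)
    ; lip   = λ x y x∈ y∈ → subst (λ z → ‖ k (x - ι 1ℤ) - k (y - ι 1ℤ) ‖ ℚ.≤ L ℚ.* ‖ z ‖) (cancel x y)
        (lip K (x - ι 1ℤ) (y - ι 1ℤ) (shifted x x∈) (shifted y y∈))
    }
    where
    open ℤ-Solver algebra
    shifted : ∀ x → ‖ x ‖ ℚ.≤ 1ℚ → ‖ x - ι 1ℤ ‖ ℚ.≤ 1ℚ ℚ.+ 1ℚ
    shifted x x∈ = ‖+‖≤ x (- ι 1ℤ) x∈ (ℚ.≤-reflexive (trans (‖neg‖ (ι 1ℤ)) (‖ι‖ 1ℤ)))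
    cancel : ∀ x y → (x - ι 1ℤ) - (y - ι 1ℤ) ≡ x - y
    cancel = solve 2 (λ x y → (x :- con 1ℤ) :- (y :- con 1ℤ) := x :- y) refl

  rest-Lipschitz : ∃ λ M → ∃ λ L → Lip 1ℚ rest M L
  rest-Lipschitz with eval-Lipschitz h {1ℚ ℚ.+ 1ℚ} (from-yes (0ℚ ℚ.≤? 1ℚ ℚ.+ 1ℚ))
  ... | M , L , _ , _ , H = _ , _ , Lip-+ (Lip-shift H) (Lip-scale (ι -1ℤ) ℚ.≤-refl
    (Lip-+ (Lip-scale (ι (coeff γ 0)) ℚ.≤-refl (Lip-* X (Lip-* X (Lip-* X (Lip-* X (Lip-* X X))))))
    (Lip-+ (Lip-scale (ι (coeff γ 1)) ℚ.≤-refl (Lip-* T (Lip-* X (Lip-* X (Lip-* X X)))))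
    (Lip-+ (Lip-scale (ι (coeff γ 2)) ℚ.≤-refl (Lip-* (Lip-* T T) (Lip-* X X)))
           (Lip-scale (ι (coeff γ 3)) ℚ.≤-refl (Lip-* T (Lip-* T T)))))))
    where
    X : Lip 1ℚ (λ x → x) 1ℚ 1ℚ
    X = Lip-id
    T : Lip 1ℚ (λ x → x - ι 1ℤ) (1ℚ ℚ.+ 1ℚ) 1ℚ
    T = Lip-shift Lip-id

-- Let p = a + y r (y). Dividing |v (a + v r)| ≤ C by |v| ≥ 1 bounds v r by C + |a|, so r vanishes
-- by induction. Then |v a| ≤ C with |v| unbounded forces a = 0.
bounded⇒vanishing : ∀ (u : ℕ → ℚ) → (∀ n → ℕ→ℚ (suc n) ℚ.≤ ℚ.∣ u n ∣) →
  ∀ p C → (∀ n → ℚ.∣ u n ℚ.* evalℚ p (u n) ∣ ℚ.≤ C) → ∀ y → evalℚ p y ≡ 0ℚ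
bounded⇒vanishing u large []      C bounded y = refl
bounded⇒vanishing u large (a ∷ p) C bounded y = begin-equality
  ℤ→ℚ a ℚ.+ y ℚ.* evalℚ p y  ≡⟨ cong₂ (λ b r → b ℚ.+ y ℚ.* r) a≡0 (p≡0 y) ⟩
  0ℚ ℚ.+ y ℚ.* 0ℚ            ≡⟨ trans (ℚ.+-identityˡ (y ℚ.* 0ℚ)) (ℚ.*-zeroʳ y) ⟩
  0ℚ                         ∎
  where
  open ℚ.≤-Reasoning
  1≤∣u∣ : ∀ n → 1ℚ ℚ.≤ ℚ.∣ u n ∣
  1≤∣u∣ n = ℚ.≤-trans (ℕ→ℚ-mono {1} {suc n} (ℕ.s≤s ℕ.z≤n)) (large n)
  0≤C : 0ℚ ℚ.≤ C
  0≤C = ℚ.≤-trans (ℚ.0≤∣p∣ _) (bounded 0)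
  bounded′ : ∀ n → ℚ.∣ u n ℚ.* evalℚ p (u n) ∣ ℚ.≤ C ℚ.+ ℚ.∣ ℤ→ℚ a ∣
  bounded′ n = ℚ.*-cancelˡ-≤-pos ℚ.∣ v ∣ {{ℚ.positive (ℚ.<-≤-trans (from-yes (0ℚ ℚ.<? 1ℚ)) (1≤∣u∣ n))}} (begin
    ℚ.∣ v ∣ ℚ.* ℚ.∣ v ℚ.* r ∣                                 ≡⟨ ℚ.∣p*q∣≡∣p∣*∣q∣ v (v ℚ.* r) ⟨
    ℚ.∣ v ℚ.* (v ℚ.* r) ∣                                     ≡⟨ cong ℚ.∣_∣ (isolate v (ℤ→ℚ a) r) ⟩
    ℚ.∣ v ℚ.* (ℤ→ℚ a ℚ.+ v ℚ.* r) ℚ.- v ℚ.* ℤ→ℚ a ∣           ≤⟨ ℚ.∣p-q∣≤∣p∣+∣q∣ (v ℚ.* (ℤ→ℚ a ℚ.+ v ℚ.* r)) (v ℚ.* ℤ→ℚ a) ⟩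
    ℚ.∣ v ℚ.* (ℤ→ℚ a ℚ.+ v ℚ.* r) ∣ ℚ.+ ℚ.∣ v ℚ.* ℤ→ℚ a ∣     ≤⟨ ℚ.+-mono-≤ (bounded n) (ℚ.≤-reflexive (ℚ.∣p*q∣≡∣p∣*∣q∣ v (ℤ→ℚ a))) ⟩
    C ℚ.+ ℚ.∣ v ∣ ℚ.* ℚ.∣ ℤ→ℚ a ∣                             ≤⟨ ℚ.+-monoˡ-≤ (ℚ.∣ v ∣ ℚ.* ℚ.∣ ℤ→ℚ a ∣) (ℚ.≤-trans (ℚ.≤-reflexive (sym (ℚ.*-identityˡ C)))
                                                                   (ℚ.*-monoʳ-≤-nonNeg C {{ℚ.nonNegative 0≤C}} (1≤∣u∣ n))) ⟩
    ℚ.∣ v ∣ ℚ.* C ℚ.+ ℚ.∣ v ∣ ℚ.* ℚ.∣ ℤ→ℚ a ∣                 ≡⟨ ℚ.*-distribˡ-+ ℚ.∣ v ∣ C ℚ.∣ ℤ→ℚ a ∣ ⟨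
    ℚ.∣ v ∣ ℚ.* (C ℚ.+ ℚ.∣ ℤ→ℚ a ∣)                           ∎)
    where
    v r : ℚ
    v = u n
    r = evalℚ p (u n)
    isolate : ∀ v a r → v ℚ.* (v ℚ.* r) ≡ v ℚ.* (a ℚ.+ v ℚ.* r) ℚ.- v ℚ.* a
    isolate = solve 3 (λ v a r → v :* (v :* r) := v :* (a :+ v :* r) :- v :* a) refl
      where open +-*-Solver
  p≡0 : ∀ y → evalℚ p y ≡ 0ℚ
  p≡0 = bounded⇒vanishing u large p (C ℚ.+ ℚ.∣ ℤ→ℚ a ∣) bounded′
  a≡0 : ℤ→ℚ a ≡ 0ℚ
  a≡0 = bounded-multiples⇒≡0 {ℤ→ℚ a} {C} λ n → begin
    ℕ→ℚ n ℚ.* ℚ.∣ ℤ→ℚ a ∣                          ≤⟨ ℚ.*-monoʳ-≤-nonNeg ℚ.∣ ℤ→ℚ a ∣ {{ℚ.∣-∣-nonNeg (ℤ→ℚ a)}} (ℚ.≤-trans (ℕ→ℚ-mono (ℕ.n≤1+n n)) (large n)) ⟩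
    ℚ.∣ u n ∣ ℚ.* ℚ.∣ ℤ→ℚ a ∣                      ≡⟨ ℚ.∣p*q∣≡∣p∣*∣q∣ (u n) (ℤ→ℚ a) ⟨
    ℚ.∣ u n ℚ.* ℤ→ℚ a ∣                            ≡⟨ cong (λ z → ℚ.∣ u n ℚ.* z ∣) (trans (cong (ℤ→ℚ a ℚ.+_) (trans (cong (u n ℚ.*_) (p≡0 (u n))) (ℚ.*-zeroʳ (u n)))) (ℚ.+-identityʳ (ℤ→ℚ a))) ⟨
    ℚ.∣ u n ℚ.* (ℤ→ℚ a ℚ.+ u n ℚ.* evalℚ p (u n)) ∣ ≤⟨ bounded n ⟩
    C                                              ∎

module _ (h γ : Poly) (isγ : IsγPoly 6 h γ) where
  open GammaIdentities ℚ-algebra h γ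
  open GammaLipschitz ℚ-normed h γ
  open Lipschitz ℚ-normed
  open KernelIdentities ℚ-algebra using (_^ι_; ^≡^ι)
  open ℚ.≤-Reasoning

  private
    -- A sequence x = 1/Q tending to 0. Starting at Q = 2 keeps x ≤ ½, so t stays away from 0 while
    -- u = t / x² is unbounded.
    Q x t u : ℕ → ℚ
    Q n = ℕ→ℚ (2 ℕ.+ n)
    x n = ℤ.+ 1 ℚ./ (2 ℕ.+ n)
    t n = x n ℚ.- 1ℚ
    u n = t n ℚ.* (Q n ℚ.* Q n)

    xQ≡1 : ∀ n → x n ℚ.* Q n ≡ 1ℚ
    xQ≡1 n = 1/r*r (2 ℕ.+ n)

    0≤x : ∀ n → 0ℚ ℚ.≤ x n
    0≤x n = 0≤1/r (2 ℕ.+ n)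

    x≤½ : ∀ n → x n ℚ.≤ ½
    x≤½ n = begin
      x n                          ≡⟨ halve (x n) ⟩
      (x n ℚ.* ℕ→ℚ 2) ℚ.* ½        ≤⟨ ℚ.*-monoʳ-≤-nonNeg ½ (ℚ.*-monoˡ-≤-nonNeg (x n) {{ℚ.nonNegative (0≤x n)}} (ℕ→ℚ-mono {2} {2 ℕ.+ n} (ℕ.s≤s (ℕ.s≤s ℕ.z≤n)))) ⟩
      (x n ℚ.* Q n) ℚ.* ½          ≡⟨ cong (ℚ._* ½) (xQ≡1 n) ⟩
      1ℚ ℚ.* ½                     ≡⟨ ℚ.*-identityˡ ½ ⟩
      ½                            ∎
      where
      halve : ∀ x → x ≡ (x ℚ.* ℕ→ℚ 2) ℚ.* ½
      halve = solve 1 (λ x → x := (x :* con (ℕ→ℚ 2)) :* con ½) refl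
        where open +-*-Solver

    ½≤∣t∣ : ∀ n → ½ ℚ.≤ ℚ.∣ t n ∣
    ½≤∣t∣ n = begin
      ½                  ≤⟨ ℚ.+-monoʳ-≤ 1ℚ (ℚ.neg-antimono-≤ (x≤½ n)) ⟩
      1ℚ ℚ.- x n         ≡⟨ flip (x n) ⟩
      ℚ.- t n            ≤⟨ p≤∣p∣ (ℚ.- t n) ⟩
      ℚ.∣ ℚ.- t n ∣      ≡⟨ ℚ.∣-p∣≡∣p∣ (t n) ⟩
      ℚ.∣ t n ∣          ∎
      where
      flip : ∀ x → 1ℚ ℚ.- x ≡ ℚ.- (x ℚ.- 1ℚ)
      flip = solve 1 (λ x → con 1ℚ :- x := :- (x :- con 1ℚ)) refl
        where open +-*-Solver

    u-large : ∀ n → ℕ→ℚ (suc n) ℚ.≤ ℚ.∣ u n ∣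
    u-large n = begin
      ℕ→ℚ (suc n)                          ≤⟨ ℕ→ℚ-mono (ℕ.n≤1+n (suc n)) ⟩
      Q n                                  ≡⟨ halve (Q n) ⟩
      ½ ℚ.* (ℕ→ℚ 2 ℚ.* Q n)                ≤⟨ *-mono-≤ (from-yes (0ℚ ℚ.≤? ½)) (½≤∣t∣ n) (0≤* (0≤ℕ→ℚ 2) 0≤Q)
                                                (*-mono-≤ (0≤ℕ→ℚ 2) (ℕ→ℚ-mono {2} {2 ℕ.+ n} (ℕ.s≤s (ℕ.s≤s ℕ.z≤n))) 0≤Q ℚ.≤-refl) ⟩
      ℚ.∣ t n ∣ ℚ.* (Q n ℚ.* Q n)          ≡⟨ cong (ℚ.∣ t n ∣ ℚ.*_) (ℚ.0≤p⇒∣p∣≡p (0≤* 0≤Q 0≤Q)) ⟨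
      ℚ.∣ t n ∣ ℚ.* ℚ.∣ Q n ℚ.* Q n ∣      ≡⟨ ℚ.∣p*q∣≡∣p∣*∣q∣ (t n) (Q n ℚ.* Q n) ⟨
      ℚ.∣ u n ∣                            ∎
      where
      0≤Q : 0ℚ ℚ.≤ Q n
      0≤Q = 0≤ℕ→ℚ (2 ℕ.+ n)
      halve : ∀ q → q ≡ ½ ℚ.* (ℕ→ℚ 2 ℚ.* q)
      halve = solve 1 (λ q → q := con ½ :* (con (ℕ→ℚ 2) :* q)) refl
        where open +-*-Solver

    h[t] : ∀ n → evalℚ h (t n) ≡ x n ^ι 6 ℚ.* evalℚ γ (u n)
    h[t] n = begin-equality
      evalℚ h (t n)
        ≡⟨ isγ (t n) ⟩
      (1ℚ ℚ.+ t n) ^ℚ 6 ℚ.* evalℚ γ (t n ℚ.* (1/ (1ℚ ℚ.+ t n)) ^ℚ 2)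
        ≡⟨ cong₂ (λ y i → y ^ℚ 6 ℚ.* evalℚ γ (t n ℚ.* (i ℚ.* i′ i))) (1+t≡x (x n)) (1/-unique {1ℚ ℚ.+ t n} {Q n} 1+t-inverse) ⟩
      x n ^ℚ 6 ℚ.* evalℚ γ (t n ℚ.* (Q n ℚ.* (Q n ℚ.* 1ℚ)))
        ≡⟨ cong₂ (λ p q → p ℚ.* evalℚ γ (t n ℚ.* (Q n ℚ.* q))) (^≡^ι (x n) 6) (ℚ.*-identityʳ (Q n)) ⟩
      x n ^ι 6 ℚ.* evalℚ γ (u n) ∎
      where
      i′ : ℚ → ℚ
      i′ i = i ℚ.* 1ℚ
      1+t≡x : ∀ x → 1ℚ ℚ.+ (x ℚ.- 1ℚ) ≡ x
      1+t≡x = solve 1 (λ x → con 1ℚ :+ (x :- con 1ℚ) := x) refl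
        where open +-*-Solver
      1+t-inverse : (1ℚ ℚ.+ t n) ℚ.* Q n ≡ 1ℚ
      1+t-inverse = trans (cong (ℚ._* Q n) (1+t≡x (x n))) (xQ≡1 n)
      instance
        1+t≢0 : NonZero (1ℚ ℚ.+ t n)
        1+t≢0 = inverse⇒nonZero {1ℚ ℚ.+ t n} {Q n} 1+t-inverse

    rest-x : ∀ n → rest (x n) ≡ (t n ℚ.* (t n ℚ.* t n)) ℚ.* (u n ℚ.* evalℚ (higher γ) (u n))
    rest-x n = rest-higher (x n) (Q n) (xQ≡1 n) (h[t] n)

    M L : ℚ
    M = proj₁ rest-Lipschitz
    L = proj₁ (proj₂ rest-Lipschitz)

    rest-lip : Lip 1ℚ rest M L
    rest-lip = proj₂ (proj₂ rest-Lipschitz)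

    ∣x∣≤1 : ∀ n → ℚ.∣ x n ∣ ℚ.≤ 1ℚ
    ∣x∣≤1 n = ℚ.≤-trans (ℚ.≤-reflexive (ℚ.0≤p⇒∣p∣≡p (0≤x n))) (ℚ.≤-trans (x≤½ n) (from-yes (½ ℚ.≤? 1ℚ)))

    -- `rest` is bounded near 0, and its factor t³ has absolute value at least 1/8.
    higher-bounded : ∀ n → ℚ.∣ u n ℚ.* evalℚ (higher γ) (u n) ∣ ℚ.≤ (ℤ.+ 8 ℚ./ 1) ℚ.* M
    higher-bounded n = begin
      w                                                       ≡⟨ eighth w ⟩
      (ℤ.+ 8 ℚ./ 1) ℚ.* ((½ ℚ.* (½ ℚ.* ½)) ℚ.* w)             ≤⟨ ℚ.*-monoˡ-≤-nonNeg (ℤ.+ 8 ℚ./ 1) (ℚ.*-monoʳ-≤-nonNeg w {{ℚ.∣-∣-nonNeg (u n ℚ.* evalℚ (higher γ) (u n))}}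
                                                                   (*-mono-≤ 0≤½ (½≤∣t∣ n) (0≤* 0≤½ 0≤½) (*-mono-≤ 0≤½ (½≤∣t∣ n) 0≤½ (½≤∣t∣ n)))) ⟩
      (ℤ.+ 8 ℚ./ 1) ℚ.* ((τ ℚ.* (τ ℚ.* τ)) ℚ.* w)             ≡⟨ cong ((ℤ.+ 8 ℚ./ 1) ℚ.*_) ∣rest∣≡ ⟨
      (ℤ.+ 8 ℚ./ 1) ℚ.* ℚ.∣ rest (x n) ∣                      ≤⟨ ℚ.*-monoˡ-≤-nonNeg (ℤ.+ 8 ℚ./ 1) (bound rest-lip (x n) (∣x∣≤1 n)) ⟩
      (ℤ.+ 8 ℚ./ 1) ℚ.* M                                     ∎
      where
      w τ : ℚ
      w = ℚ.∣ u n ℚ.* evalℚ (higher γ) (u n) ∣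
      τ = ℚ.∣ t n ∣
      0≤½ : 0ℚ ℚ.≤ ½
      0≤½ = from-yes (0ℚ ℚ.≤? ½)
      eighth : ∀ w → w ≡ (ℤ.+ 8 ℚ./ 1) ℚ.* ((½ ℚ.* (½ ℚ.* ½)) ℚ.* w)
      eighth = solve 1 (λ w → w := con (ℤ.+ 8 ℚ./ 1) :* ((con ½ :* (con ½ :* con ½)) :* w)) refl
        where open +-*-Solver
      ∣rest∣≡ : ℚ.∣ rest (x n) ∣ ≡ (τ ℚ.* (τ ℚ.* τ)) ℚ.* w
      ∣rest∣≡ = trans (cong ℚ.∣_∣ (rest-x n)) (trans (ℚ.∣p*q∣≡∣p∣*∣q∣ (t n ℚ.* (t n ℚ.* t n)) (u n ℚ.* evalℚ (higher γ) (u n)))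
        (cong (ℚ._* w) (trans (ℚ.∣p*q∣≡∣p∣*∣q∣ (t n) (t n ℚ.* t n)) (cong (τ ℚ.*_) (ℚ.∣p*q∣≡∣p∣*∣q∣ (t n) (t n))))))

    rest-x≡0 : ∀ n → rest (x n) ≡ 0ℚ
    rest-x≡0 n = trans (rest-x n) (trans (cong (λ z → (t n ℚ.* (t n ℚ.* t n)) ℚ.* (u n ℚ.* z))
        (bounded⇒vanishing u u-large (higher γ) _ higher-bounded (u n)))
      (zero-product (t n ℚ.* (t n ℚ.* t n)) (u n)))
      where
      zero-product : ∀ a b → a ℚ.* (b ℚ.* 0ℚ) ≡ 0ℚ
      zero-product = solve 2 (λ a b → a :* (b :* con 0ℚ) := con 0ℚ) refl
        where open +-*-Solver

    -- Continuity at 0 in Lipschitz form: `rest` vanishes at 1/(n + 2), hence |rest 0| ≤ L/(n + 2).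
    rest-0≡0 : rest 0ℚ ≡ 0ℚ
    rest-0≡0 = bounded-multiples⇒≡0 {rest 0ℚ} {L} λ n → begin
      ℕ→ℚ n ℚ.* ℚ.∣ rest 0ℚ ∣                  ≤⟨ ℚ.*-monoʳ-≤-nonNeg ℚ.∣ rest 0ℚ ∣ {{ℚ.∣-∣-nonNeg (rest 0ℚ)}} (ℕ→ℚ-mono (ℕ.m≤n+m n 2)) ⟩
      Q n ℚ.* ℚ.∣ rest 0ℚ ∣                    ≡⟨ cong (λ z → Q n ℚ.* ℚ.∣ z ∣) (minus-zero n) ⟩
      Q n ℚ.* ℚ.∣ rest 0ℚ ℚ.- rest (x n) ∣     ≤⟨ ℚ.*-monoˡ-≤-nonNeg (Q n) {{ℚ.nonNegative (0≤ℕ→ℚ (2 ℕ.+ n))}} (lip rest-lip 0ℚ (x n) (from-yes (0ℚ ℚ.≤? 1ℚ)) (∣x∣≤1 n)) ⟩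
      Q n ℚ.* (L ℚ.* ℚ.∣ 0ℚ ℚ.- x n ∣)         ≡⟨ cong (λ z → Q n ℚ.* (L ℚ.* z)) (∣0-x∣ n) ⟩
      Q n ℚ.* (L ℚ.* x n)                      ≡⟨ regroup (Q n) L (x n) ⟩
      L ℚ.* (x n ℚ.* Q n)                      ≡⟨ cong (L ℚ.*_) (xQ≡1 n) ⟩
      L ℚ.* 1ℚ                                 ≡⟨ ℚ.*-identityʳ L ⟩
      L                                        ∎
      where
      minus-zero : ∀ n → rest 0ℚ ≡ rest 0ℚ ℚ.- rest (x n)
      minus-zero n = sym (trans (cong (λ z → rest 0ℚ ℚ.- z) (rest-x≡0 n)) (ℚ.+-identityʳ (rest 0ℚ)))
      ∣0-x∣ : ∀ n → ℚ.∣ 0ℚ ℚ.- x n ∣ ≡ x n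
      ∣0-x∣ n = trans (cong ℚ.∣_∣ (ℚ.+-identityˡ (ℚ.- x n))) (trans (ℚ.∣-p∣≡∣p∣ (x n)) (ℚ.0≤p⇒∣p∣≡p (0≤x n)))
      regroup : ∀ q l x → q ℚ.* (l ℚ.* x) ≡ l ℚ.* (x ℚ.* q)
      regroup = solve 3 (λ q l x → q :* (l :* x) := l :* (x :* q)) refl
        where open +-*-Solver

  γ₃≡-h[-1] : coeff γ 3 ≡ ℤ.- evalℤ h -1ℤ
  γ₃≡-h[-1] = ℤ-unique (evalℤ h -1ℤ) (coeff γ 3)
    (cong ℚ.numerator (trans (sym (ℤ→ℚ-fromℤ _)) (trans (sym rest-0) rest-0≡0)))
    where
    ℤ-unique : ∀ a b → a ℤ.+ b ≡ 0ℤ → b ≡ ℤ.- a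
    ℤ-unique a b a+b≡0 = trans (sym (ℤ.+-identityˡ b)) (trans (cong (ℤ._+ b) (sym (ℤ.+-inverseˡ a)))
      (trans (ℤ.+-assoc (ℤ.- a) a b) (trans (cong (ℤ._+_ (ℤ.- a)) a+b≡0) (ℤ.+-identityʳ (ℤ.- a)))))

theorem3p3p3 : ∀ {N} (X : Complex N) → Flag X → TriangulatesSphere 5 X →
  ∀ h → IsHPoly 6 X h →
  (∀ γ → IsγPoly 6 h γ → (evalℤ h -1ℤ < 0ℤ) ⇔ (0ℤ < coeff γ 3)) ×
  (∀ (η : Edge X) → IsCrossPolytope (LinkEdge X η) → evalℤ h -1ℤ < 0ℤ →
    ∃ λ M → ∀ m → M ≤ m → ∀ (c : ℕ → Endpoint) →
      ∃ λ h′ → IsHPoly 6 (Sub^ m X η c) h′ × HasNonRealRoot h′)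
theorem3p3p3 X _ (dimension , _) h isH = gamma , root
  where
  gamma : ∀ γ → IsγPoly 6 h γ → (evalℤ h -1ℤ ℤ.< 0ℤ) ⇔ (0ℤ ℤ.< coeff γ 3)
  gamma γ isγ = mk⇔
    (λ h<0 → subst (0ℤ ℤ.<_) (sym (γ₃≡-h[-1] h γ isγ)) (ℤ.neg-mono-< h<0))
    (λ 0<γ₃ → ℤ.neg-cancel-< (subst (0ℤ ℤ.<_) (γ₃≡-h[-1] h γ isγ) 0<γ₃))

  -- For k = 0 the kernel has only a simple zero at -1, which gives no non-real solution y; the
  -- triple zero at 1 takes its place.
  eventually : evalℤ h -1ℤ ℤ.< 0ℤ → ∀ k → k ℕ.≤ 3 →
    ∃ λ M → ∀ m → M ℕ.≤ m → HasNonRealRoot (h +ᴾ map (ℤ.+ m ℤ.*_) (kernel k))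
  eventually h<0 zero    _   = nonRealRoot-near-1 h (h[1]-positive X h dimension isH)
  eventually h<0 (suc k) k≤3 = nonRealRoot-near--1 h h<0 (suc k) (ℕ.s≤s ℕ.z≤n) k≤3

  root : ∀ (η : Edge X) → IsCrossPolytope (LinkEdge X η) → evalℤ h -1ℤ ℤ.< 0ℤ →
    ∃ λ M → ∀ m → M ℕ.≤ m → ∀ (c : ℕ → Endpoint) →
    ∃ λ h′ → IsHPoly 6 (Sub^ m X η c) h′ × HasNonRealRoot h′
  root η (k , copy) h<0 =
    let k≤3 = ℕ.+-cancelˡ-≤ 3 k 3 (link-dimension X 5 dimension η k copy)
        M , nonReal = eventually h<0 k k≤3
    in M , λ m M≤m c → h +ᴾ map (ℤ.+ m ℤ.*_) (kernel k) , isHPoly-Sub^ X h isH η k k≤3 copy m c , nonReal m M≤m
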